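{- For nonzero complex numbers $a,b$ with $|a|<1$ and $|b|<1$, $$\frac{(q;q)_{\infty}^3\,(a b;q)_{\infty}}{(a;q)_{\infty}^2\,(b;q)_{\infty}^2}=\sum_{n=0}^{\infty}\left\{\frac{n\,(q / a;q)_n\, a^n}{(b;q)_{n+1}}+\frac{(n+1)\,(q / b;q)_n\, b^n}{(a;q)_{n+1}}\right\}.$$
   Context: $q$ is a complex number with $0<|q|<1$. $(a;q)_\infty=\prod_{j=0}^{\infty}(1-aq^j)$, and for an integer $n\ge 0$, $(a;q)_n=\prod_{j=0}^{n-1}(1-aq^j)$. -}

module Defs where

open import Level using (_⊔_; suc)
open import Algebra.Bundles using (CommutativeRing; RawRing)
open import Algebra.Apartness.Bundles using (HeytingField)
import Algebra.Definitions.RawSemiring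
import Algebra.Apartness.Properties.HeytingCommutativeRing
import Algebra.Properties.Ring
import Algebra.Solver.Ring.NaturalCoefficients.Default
import Relation.Binary.Reasoning.Setoid
open import Data.Empty using (⊥-elim)
open import Data.Fin.Base using (Fin; toℕ) renaming (zero to fzero; suc to fsuc)
open import Data.Nat.Base as ℕ using (ℕ)
open import Data.Product.Base using (∃-syntax; _×_; _,_; proj₁)
open import Data.Sum.Base using (_⊎_; inj₁; inj₂)
open import Relation.Binary.Core using (Rel)
open import Relation.Binary.Definitions using (Cotransitive)
open import Relation.Binary.PropositionalEquality.Core as ≡ using (_≡_)
open import Relation.Binary.Structures using (IsStrictPartialOrder)
open import Relation.Nullary.Negation using (¬_)

-- The real numbers, axiomatised as a Cauchy-complete Archimedean ordered field
-- (hence unique up to isomorphism).  The order axioms are the constructive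
-- ones: cotransitivity of _<_ takes the place of trichotomy, and x # y means
-- x < y or y < x.  Classically these are the usual axioms of ℝ.
record Reals c ℓ₁ ℓ₂ ℓ₃ : Set (suc (c ⊔ ℓ₁ ⊔ ℓ₂ ⊔ ℓ₃)) where
  infix 4 _<_
  field
    heytingField : HeytingField c ℓ₁ ℓ₂

  open HeytingField heytingField public

  commutativeRing : CommutativeRing c ℓ₁
  commutativeRing = record { isCommutativeRing = isCommutativeRing }

  field
    _<_                  : Rel Carrier ℓ₃
    isStrictPartialOrder : IsStrictPartialOrder _≈_ _<_
    <-cotrans            : Cotransitive _<_
    #⇒<⊎>                : ∀ {x y} → x # y → x < y ⊎ y < x
    <⇒#                  : ∀ {x y} → x < y → x # y
    +-monoˡ-<            : ∀ {x y} z → x < y → x + z < y + z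
    *-pos                : ∀ {x y} → 0# < x → 0# < y → 0# < x * y

  open Algebra.Definitions.RawSemiring
    (RawRing.rawSemiring (CommutativeRing.rawRing commutativeRing))
    using () renaming (_×_ to _·_)

  -- The hypothesis is symmetric in m and n, so this bounds | s m - s n | by ε.
  Cauchy : (ℕ → Carrier) → Set (c ⊔ ℓ₃)
  Cauchy s = ∀ ε → 0# < ε → ∃[ N ] (∀ m n → N ℕ.≤ m → N ℕ.≤ n → s m < s n + ε)

  Converges : (ℕ → Carrier) → Carrier → Set (c ⊔ ℓ₃)
  Converges s l = ∀ ε → 0# < ε →
    ∃[ N ] (∀ n → N ℕ.≤ n → (s n < l + ε) × (l < s n + ε))

  field
    archimedean : ∀ x → ∃[ n ] (x < n · 1#)
    complete    : ∀ s → Cauchy s → ∃[ l ] (Converges s l)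

  open IsStrictPartialOrder isStrictPartialOrder public
    using (<-resp-≈; <-respʳ-≈; <-respˡ-≈)
    renaming (irrefl to <-irrefl; trans to <-trans; asym to <-asym)


module RealLemmas {c ℓ₁ ℓ₂ ℓ₃} (R : Reals c ℓ₁ ℓ₂ ℓ₃) where
  open Reals R
  open CommutativeRing commutativeRing using (ring; commutativeSemiring)
  open Algebra.Properties.Ring ring
    using (-‿involutive; -‿distribˡ-*; -‿distribʳ-*)
  open Algebra.Apartness.Properties.HeytingCommutativeRing heytingCommutativeRing
    using (1#0; invertibleʳ⇒#; x-0≈x)
  open Algebra.Solver.Ring.NaturalCoefficients.Default commutativeSemiring
  open Relation.Binary.Reasoning.Setoid setoid

  -x*-y≈x*y : ∀ x y → - x * - y ≈ x * y
  -x*-y≈x*y x y = begin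
    - x * - y     ≈⟨ -‿distribˡ-* x (- y) ⟨
    - (x * - y)   ≈⟨ -‿cong (-‿distribʳ-* x y) ⟨
    - - (x * y)   ≈⟨ -‿involutive (x * y) ⟩
    x * y         ∎

  x+y-y≈x : ∀ x y → x + y - y ≈ x
  x+y-y≈x x y = trans (+-assoc x y (- y)) (trans (+-congˡ (-‿inverseʳ y)) (+-identityʳ x))

  x-y+y≈x : ∀ x y → x - y + y ≈ x
  x-y+y≈x x y = trans (+-assoc x (- y) y) (trans (+-congˡ (-‿inverseˡ y)) (+-identityʳ x))

  x+y<y⇒x<0 : ∀ {x y} → x + y < y → x < 0#
  x+y<y⇒x<0 {x} {y} p = <-respˡ-≈ (x+y-y≈x x y) (<-respʳ-≈ (-‿inverseʳ y) (+-monoˡ-< (- y) p))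

  x<y⇒0<y-x : ∀ {x y} → x < y → 0# < y - x
  x<y⇒0<y-x {x} p = <-respˡ-≈ (-‿inverseʳ x) (+-monoˡ-< (- x) p)

  0<y-x⇒x<y : ∀ {x y} → 0# < y - x → x < y
  0<y-x⇒x<y {x} {y} p = <-respʳ-≈ (x-y+y≈x y x) (<-respˡ-≈ (+-identityˡ x) (+-monoˡ-< x p))

  x#0⇒0<x² : ∀ {x} → x # 0# → 0# < x * x
  x#0⇒0<x² {x} x#0 with #⇒<⊎> x#0
  ... | inj₂ 0<x = *-pos 0<x 0<x
  ... | inj₁ x<0 = <-respʳ-≈ (-x*-y≈x*y x x) (*-pos 0<-x 0<-x)
    where 0<-x = <-respʳ-≈ (+-identityˡ (- x)) (x<y⇒0<y-x x<0)

  xy#0⇒x#0 : ∀ {x y} → x * y # 0# → x # 0#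
  xy#0⇒x#0 {x} {y} xy#0 with #⇒invertible xy#0
  ... | z , _ , xyz≈1 = invertibleʳ⇒# (y * z , (begin
    (x - 0#) * (y * z)   ≈⟨ *-congʳ (x-0≈x x) ⟩
    x * (y * z)          ≈⟨ *-assoc x y z ⟨
    x * y * z            ≈⟨ *-congʳ (x-0≈x (x * y)) ⟨
    (x * y - 0#) * z     ≈⟨ xyz≈1 ⟩
    1#                   ∎))

  0<x⇒x#0 : ∀ {x} → 0# < x → x # 0#
  0<x⇒x#0 p = #-sym (<⇒# p)

  0<1 : 0# < 1#
  0<1 = <-respʳ-≈ (*-identityˡ 1#) (x#0⇒0<x² 1#0)

  x²≮0 : ∀ x → ¬ (x * x < 0#)
  x²≮0 x p = <-asym p (x#0⇒0<x² (xy#0⇒x#0 (<⇒# p)))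

  +-pos-nonneg : ∀ {x y} → 0# < x → ¬ (y < 0#) → 0# < x + y
  +-pos-nonneg {x} {y} 0<x y≮0 with <-cotrans 0<x (x + y)
  ... | inj₁ 0<x+y = 0<x+y
  ... | inj₂ x+y<x = ⊥-elim (y≮0 (x+y<y⇒x<0 (<-respˡ-≈ (+-comm x y) x+y<x)))

  +-nonneg : ∀ {x y} → ¬ (x < 0#) → ¬ (y < 0#) → ¬ (x + y < 0#)
  +-nonneg {x} {y} x≮0 y≮0 p with <-cotrans p y
  ... | inj₁ x+y<y = x≮0 (x+y<y⇒x<0 x+y<y)
  ... | inj₂ y<0   = y≮0 y<0

  *-nonneg-pos : ∀ {x y} → ¬ (x < 0#) → 0# < y → ¬ (x * y < 0#)
  *-nonneg-pos x≮0 0<y p with #⇒<⊎> (xy#0⇒x#0 (<⇒# p))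
  ... | inj₁ x<0 = x≮0 x<0
  ... | inj₂ 0<x = <-asym p (*-pos 0<x 0<y)

  x<1∧y<1⇒xy<1 : ∀ {x y} → ¬ (x < 0#) → x < 1# → y < 1# → x * y < 1#
  x<1∧y<1⇒xy<1 {x} {y} x≮0 x<1 y<1 = 0<y-x⇒x<y (<-respʳ-≈ eq
    (+-pos-nonneg (x<y⇒0<y-x x<1) (*-nonneg-pos x≮0 (x<y⇒0<y-x y<1))))
    where
    eq : (1# - x) + x * (1# - y) ≈ 1# - x * y
    eq = begin
      (1# - x) + x * (1# - y)        ≈⟨ solve 3 (λ m x n → (con 1 :+ m) :+ x :* (con 1 :+ n) := (con 1 :+ x :* n) :+ m :+ x) refl (- x) x (- y) ⟩
      (1# + x * - y) - x + x         ≈⟨ x-y+y≈x (1# + x * - y) x ⟩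
      1# + x * - y                   ≈⟨ +-congˡ (-‿distribʳ-* x y) ⟨
      1# - x * y                     ∎

  x²+y²<1⇒1-x#0 : ∀ {x y} → x * x + y * y < 1# → 1# - x # 0#
  x²+y²<1⇒1-x#0 {x} {y} p = xy#0⇒x#0 (0<x⇒x#0 (<-respʳ-≈ eq (x<y⇒0<y-x x²<1)))
    where
    x²<1 : x * x < 1#
    x²<1 with <-cotrans p (x * x)
    ... | inj₂ x²<1        = x²<1
    ... | inj₁ x²+y²<x²    = ⊥-elim (x²≮0 y (x+y<y⇒x<0 (<-respˡ-≈ (+-comm _ _) x²+y²<x²)))

    eq : 1# - x * x ≈ (1# - x) * (1# + x)
    eq = begin
      1# - x * x                 ≈⟨ +-congˡ (-‿distribˡ-* x x) ⟩
      1# + - x * x               ≈⟨ x-y+y≈x _ x ⟨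
      1# + - x * x - x + x       ≈⟨ solve 2 (λ m x → con 1 :+ m :* x :+ m :+ x := (con 1 :+ m) :* (con 1 :+ x)) refl (- x) x ⟩
      (1# - x) * (1# + x)        ∎

  norm-mult : ∀ a b c d →
    (a * c - b * d) * (a * c - b * d) + (a * d + b * c) * (a * d + b * c)
      ≈ (a * a + b * b) * (c * c + d * d)
  norm-mult a b c d = begin
    (a * c + n) * (a * c + n) + (a * d + b * c) * (a * d + b * c)
      ≈⟨ solve 5 (λ a b c d n →
           (a :* c :+ n) :* (a :* c :+ n) :+ (a :* d :+ b :* c) :* (a :* d :+ b :* c)
             := (a :* c :* (a :* c) :+ a :* d :* (a :* d) :+ b :* c :* (b :* c)) :+ n :* n
                :+ (con 2 :* (a :* c) :* (n :+ b :* d)))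
         refl a b c d n ⟩
    s + n * n + (k * (n + b * d))
      ≈⟨ +-cong (+-congˡ (-x*-y≈x*y (b * d) (b * d))) (trans (*-congˡ (-‿inverseˡ (b * d))) (zeroʳ k)) ⟩
    s + b * d * (b * d) + 0#
      ≈⟨ solve 4 (λ a b c d →
           (a :* c :* (a :* c) :+ a :* d :* (a :* d) :+ b :* c :* (b :* c)) :+ b :* d :* (b :* d) :+ con 0
             := (a :* a :+ b :* b) :* (c :* c :+ d :* d))
         refl a b c d ⟩
    (a * a + b * b) * (c * c + d * d) ∎
    where
    n = - (b * d)
    s = a * c * (a * c) + a * d * (a * d) + b * c * (b * c)
    k = (1# + 1#) * (a * c)


module Complex {c ℓ₁ ℓ₂ ℓ₃} (R : Reals c ℓ₁ ℓ₂ ℓ₃) where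
  private module ℝ = Reals R
  open ℝ using (0#; 1#; _<_) renaming (Carrier to ℝ)
  private module L = RealLemmas R

  infix 5 _+i_
  record ℂ : Set c where
    constructor _+i_
    field
      re im : ℝ
  open ℂ public

  rawRing : RawRing c ℓ₁
  rawRing = record
    { Carrier = ℂ
    ; _≈_     = λ z w → (re z ℝ.≈ re w) × (im z ℝ.≈ im w)
    ; _+_     = λ z w → (re z ℝ.+ re w) +i (im z ℝ.+ im w)
    ; _*_     = λ z w → (re z ℝ.* re w ℝ.- im z ℝ.* im w) +i (re z ℝ.* im w ℝ.+ im z ℝ.* re w)
    ; -_      = λ z → (ℝ.- re z) +i (ℝ.- im z)
    ; 0#      = 0# +i 0#
    ; 1#      = 1# +i 0#
    }

  open RawRing rawRing public
    using (_≈_; _+_; _*_; -_)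
    renaming (0# to 0ℂ; 1# to 1ℂ)

  -- n · z is the n-fold sum z + ⋯ + z.
  open Algebra.Definitions.RawSemiring (RawRing.rawSemiring rawRing) public
    using (_^_; sum; product)
    renaming (_×_ to _·_)

  infixl 6 _-_
  _-_ : ℂ → ℂ → ℂ
  z - w = z + (- w)

  ∣_∣² : ℂ → ℝ
  ∣ z ∣² = re z ℝ.* re z ℝ.+ im z ℝ.* im z

  -- | z | < r, stated without the square root.
  infix 4 ∣_∣<_
  ∣_∣<_ : ℂ → ℝ → Set ℓ₃
  ∣ z ∣< r = (0# < r) × (∣ z ∣² < r ℝ.* r)

  -- 0 < | z |, the constructive form of z ≠ 0.
  NonZero : ℂ → Set ℓ₃
  NonZero z = 0# < ∣ z ∣²

  -- z⁻¹ = z̄ / | z |²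
  inv : (z : ℂ) → NonZero z → ℂ
  inv z z≠0 = (re z ℝ.* d) +i (ℝ.- im z ℝ.* d)
    where d = proj₁ (ℝ.#⇒invertible (L.0<x⇒x#0 z≠0))

  infixl 7 _/_⟨_⟩
  _/_⟨_⟩ : ℂ → (w : ℂ) → NonZero w → ℂ
  z / w ⟨ w≠0 ⟩ = z * inv w w≠0

  infix 4 _⟶_
  _⟶_ : (ℕ → ℂ) → ℂ → Set (c ⊔ ℓ₃)
  s ⟶ l = ∀ (ε : ℝ) → 0# < ε → ∃[ N ] (∀ n → N ℕ.≤ n → ∣ s n - l ∣< ε)

  SumsTo : (ℕ → ℂ) → ℂ → Set (c ⊔ ℓ₃)
  SumsTo t l = (λ N → sum {N} (λ n → t (toℕ n))) ⟶ l

  ⟨_﹔_⟩ : ℂ → ℂ → ℕ → ℂ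
  ⟨ a ﹔ q ⟩ n = product {n} (λ j → 1ℂ - a * q ^ toℕ j)

  -- (a;q)_∞ = l
  ⟨_﹔_⟩∞≔_ : ℂ → ℂ → ℂ → Set (c ⊔ ℓ₃)
  ⟨ a ﹔ q ⟩∞≔ l = ⟨ a ﹔ q ⟩ ⟶ l

  ∣∣²≮0 : ∀ z → ¬ (∣ z ∣² < 0#)
  ∣∣²≮0 z = L.+-nonneg (L.x²≮0 (re z)) (L.x²≮0 (im z))

  ∣zw∣² : ∀ z w → ∣ z * w ∣² ℝ.≈ ∣ z ∣² ℝ.* ∣ w ∣²
  ∣zw∣² z w = L.norm-mult (re z) (im z) (re w) (im w)

  ∣1∣²≈1 : ∣ 1ℂ ∣² ℝ.≈ 1#
  ∣1∣²≈1 = ℝ.trans (ℝ.+-cong (ℝ.*-identityˡ 1#) (ℝ.zeroˡ 0#)) (ℝ.+-identityʳ 1#)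

  *-nonZero : ∀ {z w} → NonZero z → NonZero w → NonZero (z * w)
  *-nonZero {z} {w} z≠0 w≠0 = ℝ.<-respʳ-≈ (ℝ.sym (∣zw∣² z w)) (ℝ.*-pos z≠0 w≠0)

  product-nonZero : ∀ n (f : Fin n → ℂ) → (∀ j → NonZero (f j)) → NonZero (product f)
  product-nonZero ℕ.zero    f f≠0 = ℝ.<-respʳ-≈ (ℝ.sym ∣1∣²≈1) L.0<1
  product-nonZero (ℕ.suc n) f f≠0 =
    *-nonZero {f fzero} (f≠0 fzero) (product-nonZero n (λ j → f (fsuc j)) (λ j → f≠0 (fsuc j)))

  1-z-nonZero : ∀ {z} → ∣ z ∣² < 1# → NonZero (1ℂ - z)
  1-z-nonZero p = L.+-pos-nonneg (L.x#0⇒0<x² (L.x²+y²<1⇒1-x#0 p)) (L.x²≮0 _)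

  ∣aqʲ∣²<1 : ∀ {a q} → ∣ a ∣² < 1# → ∣ q ∣² < 1# → ∀ j → ∣ a * q ^ j ∣² < 1#
  ∣aqʲ∣²<1 {a} a<1 q<1 ℕ.zero = ℝ.<-respˡ-≈
    (ℝ.sym (ℝ.trans (∣zw∣² a 1ℂ) (ℝ.trans (ℝ.*-congˡ ∣1∣²≈1) (ℝ.*-identityʳ _)))) a<1
  ∣aqʲ∣²<1 {a} {q} a<1 q<1 (ℕ.suc j) = ℝ.<-respˡ-≈ eq
    (L.x<1∧y<1⇒xy<1 (∣∣²≮0 q) q<1 (∣aqʲ∣²<1 {a} {q} a<1 q<1 j))
    where
    open Relation.Binary.Reasoning.Setoid ℝ.setoid
    eq : ∣ q ∣² ℝ.* ∣ a * q ^ j ∣² ℝ.≈ ∣ a * (q * q ^ j) ∣²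
    eq = begin
      ∣ q ∣² ℝ.* ∣ a * q ^ j ∣²              ≈⟨ ℝ.*-congˡ (∣zw∣² a (q ^ j)) ⟩
      ∣ q ∣² ℝ.* (∣ a ∣² ℝ.* ∣ q ^ j ∣²)     ≈⟨ ℝ.*-assoc _ _ _ ⟨
      ∣ q ∣² ℝ.* ∣ a ∣² ℝ.* ∣ q ^ j ∣²       ≈⟨ ℝ.*-congʳ (ℝ.*-comm _ _) ⟩
      ∣ a ∣² ℝ.* ∣ q ∣² ℝ.* ∣ q ^ j ∣²       ≈⟨ ℝ.*-assoc _ _ _ ⟩
      ∣ a ∣² ℝ.* (∣ q ∣² ℝ.* ∣ q ^ j ∣²)     ≈⟨ ℝ.*-congˡ (∣zw∣² q (q ^ j)) ⟨
      ∣ a ∣² ℝ.* ∣ q * q ^ j ∣²              ≈⟨ ∣zw∣² a (q * q ^ j) ⟨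
      ∣ a * (q * q ^ j) ∣²                   ∎

  ⟨﹔⟩-nonZero : ∀ {a q} → ∣ a ∣< 1# → ∣ q ∣< 1# → ∀ n → NonZero (⟨ a ﹔ q ⟩ n)
  ⟨﹔⟩-nonZero {a} {q} (_ , a<1) (_ , q<1) n = product-nonZero n _ λ j →
    1-z-nonZero {a * q ^ toℕ j} (∣aqʲ∣²<1 {a} {q} (to1 a<1) (to1 q<1) (toℕ j))
    where
    to1 : ∀ {x} → x < 1# ℝ.* 1# → x < 1#
    to1 = ℝ.<-respʳ-≈ (ℝ.*-identityˡ 1#)

{-# OPTIONS --safe #-}
module Submission where

-- For n ∈ ℤ let u n = (q/a)ₙ aⁿ / (b)ₙ₊₁, so that u (- n - 1) = - (q/b)ₙ bⁿ / (a)ₙ₊₁;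
-- the right-hand side is S(a,b) = Σ n u n.  The relation
-- (1 - ab) u n (aq,b) = (1 - a) (u n (a,b) - a u (n - 1) (a,b)), summed over ℤ, gives
-- (1 - ab) U(aq,b) = (1 - a)² U(a,b) for U = Σ u n.  Iterating it moves a, and by the
-- antisymmetry of U also b, to 0, where U vanishes; so U = 0.  This makes S symmetric
-- and gives S the same functional equation, whence
-- (a)∞² (b)∞² S(a,b) = (ab)∞ S(0,0).  At a = b = q only one term of S survives,
-- which yields S(0,0) = (q)∞³.

-- In the shift relation `u (n - 1)` carries the weight n, so after reindexing the weight n has
-- become n + 1. For S it therefore reads (1 - ab) S(aq,b) = (1 - a) (S - a (S + U)), and it is a
-- relation for S alone only once U = 0. The same sum S + U equals S(b,a), because the reflection n
-- ↦ - n - 1 exchanges a and b and also the two weights. The iteration ends at a = 0, where q/a is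
-- meaningless; hence (q/a)ₙ aⁿ is replaced by the polynomial ∏ (a - qʲ), 1 ≤ j ≤ n. Passing to the
-- limit along a qⁿ needs continuity of the sums at a = 0, and so bounds that are uniform on a disc
-- containing q, a and b. These bounds are obtained without square roots, logarithms or maxima of
-- reals: moduli are compared through their squares, products are majorised by one explicit product,
-- and roots are replaced by arithmetic means.

open import Defs
open import Level using (Level; _⊔_) renaming (suc to lsuc)
open import Algebra.Bundles using (CommutativeRing; Monoid)
open import Data.Empty using (⊥-elim)
open import Data.Fin.Base using (Fin; toℕ) renaming (zero to fzero; suc to fsuc)
open import Data.Integer.Base as ℤ using (ℤ; +_; -[1+_]; _⊖_)
import Data.Integer.Properties as ℤₚ
open import Data.Maybe.Base using (Maybe; just; nothing)
open import Data.Nat.Base as ℕ using (ℕ; zero; suc; z≤n; s≤s)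
import Data.Nat.Properties as ℕₚ
open import Data.Product.Base using (Σ-syntax; ∃-syntax; _×_; _,_; proj₁; proj₂)
open import Data.Sum.Base using (inj₁; inj₂; [_,_]′)
open import Data.Vec.Functional using (foldr)
open import Relation.Binary.PropositionalEquality.Core as ≡ using (_≡_)
open import Relation.Binary.Structures using (IsPreorder)
open import Relation.Nullary.Decidable.Core using (yes; no)
open import Relation.Nullary.Negation using (¬_)
import Algebra.Properties.AbelianGroup
import Algebra.Properties.CommutativeSemiring.Exp
import Algebra.Properties.Ring
import Algebra.Properties.Semiring.Exp
import Algebra.Properties.Semiring.Mult
import Algebra.Properties.Semiring.Mult.TCOptimised
import Algebra.Solver.Ring
open import Algebra.Solver.Ring.AlmostCommutativeRing using (fromCommutativeRing; _-Raw-AlmostCommutative⟶_)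
import Relation.Binary.Reasoning.Base.Triple
import Relation.Binary.Reasoning.Setoid

-- Ring solver with integer coefficients.

module ℤ-Solver {c ℓ : Level} (A : CommutativeRing c ℓ) where
  open CommutativeRing A
  open Algebra.Properties.Ring ring using (-‿distribˡ-*; -‿distribʳ-*; -‿involutive; -0#≈0#)
  open Algebra.Properties.AbelianGroup +-abelianGroup using (⁻¹-∙-comm)
  open Algebra.Properties.Semiring.Mult.TCOptimised semiring renaming (_×_ to _·_)
  open Relation.Binary.Reasoning.Setoid setoid

  -- With the optimised multiple, `con (+ 1)` and `con (+ 2)` evaluate to `1#` and `1# + 1#` on the
  -- nose, so solver equations match the goals as they are written.
  fromℤ : ℤ → Carrier
  fromℤ (+ n)      = n · 1#
  fromℤ -[1+ n ]   = - (suc n · 1#)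

  private
    suc-· : ∀ n → suc n · 1# ≈ 1# + n · 1#
    suc-· n = ×-homo-+ 1# 1 n

  ⊖-homo : ∀ m n → fromℤ (m ⊖ n) ≈ m · 1# - n · 1#
  ⊖-homo m zero = begin
    fromℤ (m ⊖ 0)  ≡⟨ ≡.cong fromℤ (ℤₚ.⊖-≥ (ℕ.z≤n {m})) ⟩
    m · 1#           ≈⟨ +-identityʳ _ ⟨
    m · 1# + 0#      ≈⟨ +-congˡ -0#≈0# ⟨
    m · 1# - 0#      ∎
  ⊖-homo zero (suc n) = sym (+-identityˡ _)
  ⊖-homo (suc m) (suc n) = begin
    fromℤ (suc m ⊖ suc n)                    ≡⟨ ≡.cong fromℤ (ℤₚ.[1+m]⊖[1+n]≡m⊖n m n) ⟩
    fromℤ (m ⊖ n)                            ≈⟨ ⊖-homo m n ⟩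
    m · 1# - n · 1#                          ≈⟨ +-congʳ (+-identityʳ _) ⟨
    (m · 1# + 0#) - n · 1#                   ≈⟨ +-congʳ (+-congˡ (-‿inverseʳ 1#)) ⟨
    (m · 1# + (1# - 1#)) - n · 1#            ≈⟨ +-congʳ (+-assoc _ _ _) ⟨
    ((m · 1# + 1#) - 1#) - n · 1#            ≈⟨ +-assoc _ _ _ ⟩
    (m · 1# + 1#) + (- 1# - n · 1#)          ≈⟨ +-cong (trans (+-comm _ _) (sym (suc-· m)))
                                                       (trans (⁻¹-∙-comm _ _) (-‿cong (sym (suc-· n)))) ⟩
    suc m · 1# - suc n · 1#                  ∎

  -‿homo : ∀ i → fromℤ (ℤ.- i) ≈ - fromℤ i
  -‿homo (+ zero)  = sym -0#≈0#
  -‿homo (+ suc n) = refl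
  -‿homo -[1+ n ]  = sym (-‿involutive _)

  +-homo : ∀ i j → fromℤ (i ℤ.+ j) ≈ fromℤ i + fromℤ j
  +-homo (+ m)    (+ n)    = ×-homo-+ 1# m n
  +-homo (+ m)    -[1+ n ] = ⊖-homo m (suc n)
  +-homo -[1+ m ] (+ n)    = trans (⊖-homo n (suc m)) (+-comm _ _)
  +-homo -[1+ m ] -[1+ n ] = begin
    - (suc (suc (m ℕ.+ n)) · 1#)         ≡⟨ ≡.cong (λ k → - (suc k · 1#)) (≡.sym (ℕₚ.+-suc m n)) ⟩
    - ((suc m ℕ.+ suc n) · 1#)           ≈⟨ -‿cong (×-homo-+ 1# (suc m) (suc n)) ⟩
    - (suc m · 1# + suc n · 1#)          ≈⟨ ⁻¹-∙-comm _ _ ⟨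
    - (suc m · 1#) - suc n · 1#          ∎
    where import Data.Nat.Properties as ℕₚ

  *-homo : ∀ i j → fromℤ (i ℤ.* j) ≈ fromℤ i * fromℤ j
  *-homo-pos : ∀ m j → fromℤ (+ m ℤ.* j) ≈ fromℤ (+ m) * fromℤ j
  *-homo-pos m (+ n) = begin
    fromℤ (+ m ℤ.* + n)      ≡⟨ ≡.cong fromℤ (ℤₚ.pos-* m n) ⟨
    (m ℕ.* n) · 1#           ≈⟨ ×1-homo-* m n ⟩
    (m · 1#) * (n · 1#)      ∎
  *-homo-pos m -[1+ n ] = begin
    fromℤ (+ m ℤ.* -[1+ n ])        ≡⟨ ≡.cong fromℤ (ℤₚ.neg-distribʳ-* (+ m) (+ suc n)) ⟨
    fromℤ (ℤ.- (+ m ℤ.* + suc n))   ≈⟨ -‿homo (+ m ℤ.* + suc n) ⟩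
    - fromℤ (+ m ℤ.* + suc n)       ≈⟨ -‿cong (*-homo-pos m (+ suc n)) ⟩
    - ((m · 1#) * (suc n · 1#))     ≈⟨ -‿distribʳ-* _ _ ⟩
    (m · 1#) * - (suc n · 1#)       ∎
  *-homo (+ m)    j = *-homo-pos m j
  *-homo -[1+ m ] j = begin
    fromℤ (-[1+ m ] ℤ.* j)          ≡⟨ ≡.cong fromℤ (ℤₚ.neg-distribˡ-* (+ suc m) j) ⟨
    fromℤ (ℤ.- (+ suc m ℤ.* j))     ≈⟨ -‿homo (+ suc m ℤ.* j) ⟩
    - fromℤ (+ suc m ℤ.* j)         ≈⟨ -‿cong (*-homo-pos (suc m) j) ⟩
    - ((suc m · 1#) * fromℤ j)      ≈⟨ -‿distribˡ-* _ _ ⟩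
    - (suc m · 1#) * fromℤ j        ∎

  private
    morphism : CommutativeRing.rawRing ℤₚ.+-*-commutativeRing -Raw-AlmostCommutative⟶ fromCommutativeRing A
    morphism = record
      { ⟦_⟧ = fromℤ ; +-homo = +-homo ; *-homo = *-homo ; -‿homo = -‿homo ; 0-homo = refl ; 1-homo = refl }

    _coeff≟_ : ∀ i j → Maybe (fromℤ i ≈ fromℤ j)
    i coeff≟ j with i ℤₚ.≟ j
    ... | yes i≡j = just (reflexive (≡.cong fromℤ i≡j))
    ... | no  _   = nothing

  open Algebra.Solver.Ring (CommutativeRing.rawRing ℤₚ.+-*-commutativeRing)
    (fromCommutativeRing A) morphism _coeff≟_ public
    using (solve; con; _:+_; _:*_; _:-_; :-_; _:=_)

-- Order, reciprocals and geometric estimates in the reals.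

module RealOrder {c ℓ₁ ℓ₂ ℓ₃} (R : Reals c ℓ₁ ℓ₂ ℓ₃) where
  open Reals R
  open RealLemmas R public hiding (0<1)
  open CommutativeRing commutativeRing using (semiring; ring)
  open Algebra.Properties.Semiring.Exp semiring public
    using (_^_)
  open Algebra.Properties.Semiring.Mult semiring public
    using () renaming (_×_ to _·_)
  open ℤ-Solver commutativeRing public

  -- Opaque, because its normal form contains ring-solver proofs.
  opaque
    0<1 : 0# < 1#
    0<1 = RealLemmas.0<1 R

  infix 4 _≤_
  -- A negation, so a non-strict inequality may always be proved by contradiction; cotransitivity
  -- supplies the mixed transitivity laws.
  _≤_ : Carrier → Carrier → Set ℓ₃
  x ≤ y = ¬ (y < x)

  <⇒≤ : ∀ {x y} → x < y → x ≤ y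
  <⇒≤ x<y y<x = <-asym x<y y<x

  ≤-reflexive : ∀ {x y} → x ≈ y → x ≤ y
  ≤-reflexive x≈y y<x = <-irrefl (sym x≈y) y<x

  ≤-refl : ∀ {x} → x ≤ x
  ≤-refl = ≤-reflexive refl

  ≤-trans : ∀ {x y z} → x ≤ y → y ≤ z → x ≤ z
  ≤-trans {y = y} x≤y y≤z z<x with <-cotrans z<x y
  ... | inj₁ z<y = y≤z z<y
  ... | inj₂ y<x = x≤y y<x

  ≤-<-trans : ∀ {x y z} → x ≤ y → y < z → x < z
  ≤-<-trans {x} x≤y y<z with <-cotrans y<z x
  ... | inj₁ y<x = ⊥-elim (x≤y y<x)
  ... | inj₂ x<z = x<z

  <-≤-trans : ∀ {x y z} → x < y → y ≤ z → x < z
  <-≤-trans {z = z} x<y y≤z with <-cotrans x<y z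
  ... | inj₁ x<z = x<z
  ... | inj₂ z<y = ⊥-elim (y≤z z<y)

  ≤-isPreorder : IsPreorder _≈_ _≤_
  ≤-isPreorder = record { isEquivalence = isEquivalence ; reflexive = ≤-reflexive ; trans = ≤-trans }

  module ≤-Reasoning = Relation.Binary.Reasoning.Base.Triple
    ≤-isPreorder <-asym <-trans <-resp-≈ <⇒≤ <-≤-trans ≤-<-trans

  opaque
    +-monoˡ-≤ : ∀ {x y} z → x ≤ y → x + z ≤ y + z
    +-monoˡ-≤ z x≤y y+z<x+z =
      x≤y (<-respˡ-≈ (x+y-y≈x _ z) (<-respʳ-≈ (x+y-y≈x _ z) (+-monoˡ-< (- z) y+z<x+z)))

    +-monoʳ-≤ : ∀ {x y} z → x ≤ y → z + x ≤ z + y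
    +-monoʳ-≤ z x≤y = ≤-trans (≤-reflexive (+-comm z _)) (≤-trans (+-monoˡ-≤ z x≤y) (≤-reflexive (+-comm _ z)))

    +-mono-≤ : ∀ {w x y z} → w ≤ x → y ≤ z → w + y ≤ x + z
    +-mono-≤ {x = x} {y} w≤x y≤z = ≤-trans (+-monoˡ-≤ y w≤x) (+-monoʳ-≤ x y≤z)

    x≤y⇒0≤y-x : ∀ {x y} → x ≤ y → 0# ≤ y - x
    x≤y⇒0≤y-x {x} x≤y = ≤-trans (≤-reflexive (sym (-‿inverseʳ x))) (+-monoˡ-≤ (- x) x≤y)

    y≈x+z⇒x≤y : ∀ {x y z} → 0# ≤ z → y ≈ x + z → x ≤ y
    y≈x+z⇒x≤y {x} 0≤z y≈x+z =
      ≤-trans (≤-reflexive (sym (+-identityʳ x))) (≤-trans (+-monoʳ-≤ x 0≤z) (≤-reflexive (sym y≈x+z)))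

    0≤1 : 0# ≤ 1#
    0≤1 = <⇒≤ 0<1

    0≤+ : ∀ {x y} → 0# ≤ x → 0# ≤ y → 0# ≤ x + y
    0≤+ = +-nonneg

    yx#0⇒x#0 : ∀ {x y} → y * x # 0# → x # 0#
    yx#0⇒x#0 {x} {y} yx#0 = xy#0⇒x#0 {x} {y} ([ (λ p → <⇒# (<-respˡ-≈ (*-comm y x) p)) , (λ p → #-sym (<⇒# (<-respʳ-≈ (*-comm y x) p))) ]′ (#⇒<⊎> yx#0))

    x#0∧0≤x⇒0<x : ∀ {x} → x # 0# → 0# ≤ x → 0# < x
    x#0∧0≤x⇒0<x x#0 0≤x = [ (λ x<0 → ⊥-elim (0≤x x<0)) , (λ 0<x → 0<x) ]′ (#⇒<⊎> x#0)

    -- If xy < 0 then both factors are apart from 0, hence positive, and so is their product.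
    0≤* : ∀ {x y} → 0# ≤ x → 0# ≤ y → 0# ≤ x * y
    0≤* {x} {y} 0≤x 0≤y xy<0 = <-asym xy<0
      (*-pos (x#0∧0≤x⇒0<x (xy#0⇒x#0 (<⇒# xy<0)) 0≤x) (x#0∧0≤x⇒0<x (yx#0⇒x#0 (<⇒# xy<0)) 0≤y))

    *-monoˡ-≤ : ∀ {x y} z → 0# ≤ z → x ≤ y → x * z ≤ y * z
    *-monoˡ-≤ {x} {y} z 0≤z x≤y = y≈x+z⇒x≤y (0≤* (x≤y⇒0≤y-x x≤y) 0≤z)
      (solve 3 (λ x y z → y :* z := x :* z :+ (y :- x) :* z) refl x y z)

    *-monoʳ-≤ : ∀ {x y} z → 0# ≤ z → x ≤ y → z * x ≤ z * y
    *-monoʳ-≤ z 0≤z x≤y = ≤-trans (≤-reflexive (*-comm z _)) (≤-trans (*-monoˡ-≤ z 0≤z x≤y) (≤-reflexive (*-comm _ z)))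

    *-mono-≤ : ∀ {w x y z} → 0# ≤ w → w ≤ x → 0# ≤ y → y ≤ z → w * y ≤ x * z
    *-mono-≤ {x = x} {y} 0≤w w≤x 0≤y y≤z = ≤-trans (*-monoˡ-≤ y 0≤y w≤x) (*-monoʳ-≤ x (≤-trans 0≤w w≤x) y≤z)

    *-monoˡ-< : ∀ {x y} z → 0# < z → x < y → x * z < y * z
    *-monoˡ-< {x} {y} z 0<z x<y = 0<y-x⇒x<y (<-respʳ-≈
      (solve 3 (λ x y z → (y :- x) :* z := y :* z :- x :* z) refl x y z)
      (*-pos (x<y⇒0<y-x x<y) 0<z))

    *-cancelʳ-≤ : ∀ {x y} z → 0# < z → x * z ≤ y * z → x ≤ y
    *-cancelʳ-≤ z 0<z xz≤yz y<x = xz≤yz (*-monoˡ-< z 0<z y<x)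

    0≤x² : ∀ x → 0# ≤ x * x
    0≤x² = x²≮0

    x²-mono-≤ : ∀ {x y} → 0# ≤ x → x ≤ y → x * x ≤ y * y
    x²-mono-≤ 0≤x x≤y = *-mono-≤ 0≤x x≤y 0≤x x≤y

    x²≤y²⇒x≤y : ∀ {x y} → 0# ≤ y → x * x ≤ y * y → x ≤ y
    x²≤y²⇒x≤y {x} {y} 0≤y x²≤y² y<x = x²≤y² (0<y-x⇒x<y (<-respʳ-≈
      (solve 2 (λ x y → (x :- y) :* (x :+ y) := x :* x :- y :* y) refl x y)
      (*-pos (x<y⇒0<y-x y<x) (+-pos-nonneg (≤-<-trans 0≤y y<x) 0≤y))))

    x²≤0⇒x≈0 : ∀ {x} → x * x ≤ 0# → x ≈ 0#
    x²≤0⇒x≈0 x²≤0 = proj₁ (tight _ _) λ x#0 → x²≤0 (x#0⇒0<x² x#0)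

    -- Contradiction only yields x ≤ y. Strictness comes from apartness: (y - x) z > 0 forces y - x
    -- to be apart from 0.
    <-*-cancelʳ : ∀ {x y} z → 0# < z → x * z < y * z → x < y
    <-*-cancelʳ {x} {y} z 0<z xz<yz = 0<y-x⇒x<y (x#0∧0≤x⇒0<x
      (xy#0⇒x#0 {y - x} {z} (0<x⇒x#0 (<-respʳ-≈
        (solve 3 (λ x y z → y :* z :- x :* z := (y :- x) :* z) refl x y z) (x<y⇒0<y-x xz<yz))))
      (x≤y⇒0≤y-x (*-cancelʳ-≤ z 0<z (<⇒≤ xz<yz))))

    reciprocal : ∀ {x} → 0# < x → ∃[ y ] (0# < y × y * x ≈ 1#)
    reciprocal {x} 0<x with #⇒invertible (0<x⇒x#0 0<x)
    ... | y , y*x≈1 , _ = y , <-*-cancelʳ x 0<x (<-respˡ-≈ (sym (zeroˡ x)) (<-respʳ-≈ (sym eq) 0<1)) , eq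
      where
      eq : y * x ≈ 1#
      eq = trans (*-congˡ (sym (solve 1 (λ x → x :- con (+ 0) := x) refl x))) y*x≈1

    0<^ : ∀ {x} → 0# < x → ∀ n → 0# < x ^ n
    0<^ 0<x zero    = 0<1
    0<^ 0<x (suc n) = *-pos 0<x (0<^ 0<x n)

    0≤^ : ∀ {x} → 0# ≤ x → ∀ n → 0# ≤ x ^ n
    0≤^ 0≤x zero    = 0≤1
    0≤^ 0≤x (suc n) = 0≤* 0≤x (0≤^ 0≤x n)

    x^n≤1 : ∀ {x} → 0# ≤ x → x ≤ 1# → ∀ n → x ^ n ≤ 1#
    x^n≤1 0≤x x≤1 zero    = ≤-refl
    x^n≤1 0≤x x≤1 (suc n) = ≤-trans (*-mono-≤ 0≤x x≤1 (0≤^ 0≤x n) (x^n≤1 0≤x x≤1 n)) (≤-reflexive (*-identityˡ 1#))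

    ^-antiʳ-≤ : ∀ {x} → 0# ≤ x → x ≤ 1# → ∀ {m n} → m ℕ.≤ n → x ^ n ≤ x ^ m
    ^-antiʳ-≤ 0≤x x≤1 {n = n} z≤n = x^n≤1 0≤x x≤1 n
    ^-antiʳ-≤ {x} 0≤x x≤1 (s≤s m≤n) = *-monoʳ-≤ x 0≤x (^-antiʳ-≤ 0≤x x≤1 m≤n)

    -- The arithmetic mean of 1 and x stands in for the square root of x: with h = 1/2, ((1 + x)/2)²
    -- = x + ((1 - x)/2)².
    x≤√′ : ∀ {h x} → 0# < h → h * (1# + 1#) ≈ 1# → 0# ≤ x → x < 1# →
      0# < h * (1# + x) × h * (1# + x) < 1# × x ≤ (h * (1# + x)) * (h * (1# + x))
    x≤√′ {h} {x} 0<h h2≈1 0≤x x<1 =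
      *-pos 0<h (+-pos-nonneg 0<1 0≤x) ,
      0<y-x⇒x<y (<-respʳ-≈ eq₁ (*-pos 0<h (x<y⇒0<y-x x<1))) ,
      y≈x+z⇒x≤y (0≤x² (h * (1# - x))) eq₂
      where
      open ≤-Reasoning
      eq₁ : h * (1# - x) ≈ 1# - h * (1# + x)
      eq₁ = begin-equality
        h * (1# - x)                      ≈⟨ solve 2 (λ h x → h :* (con (+ 1) :- x)
                                               := h :* (con (+ 1) :+ con (+ 1)) :- h :* (con (+ 1) :+ x)) refl h x ⟩
        h * (1# + 1#) - h * (1# + x)      ≈⟨ +-congʳ h2≈1 ⟩
        1# - h * (1# + x)                 ∎
      eq₂ : (h * (1# + x)) * (h * (1# + x)) ≈ x + (h * (1# - x)) * (h * (1# - x))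
      eq₂ = begin-equality
        (h * (1# + x)) * (h * (1# + x))
          ≈⟨ solve 2 (λ h x → (h :* (con (+ 1) :+ x)) :* (h :* (con (+ 1) :+ x))
               := ((h :* (con (+ 1) :+ con (+ 1))) :* (h :* (con (+ 1) :+ con (+ 1)))) :* x
                  :+ (h :* (con (+ 1) :- x)) :* (h :* (con (+ 1) :- x))) refl h x ⟩
        ((h * (1# + 1#)) * (h * (1# + 1#))) * x + (h * (1# - x)) * (h * (1# - x))
          ≈⟨ +-congʳ (*-congʳ (*-cong h2≈1 h2≈1)) ⟩
        (1# * 1#) * x + (h * (1# - x)) * (h * (1# - x))
          ≈⟨ +-congʳ (trans (*-congʳ (*-identityˡ 1#)) (*-identityˡ x)) ⟩
        x + (h * (1# - x)) * (h * (1# - x)) ∎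

    x≤√ : ∀ {x} → 0# ≤ x → x < 1# → ∃[ y ] (0# < y × y < 1# × x ≤ y * y)
    x≤√ 0≤x x<1 = let h , 0<h , h2≈1 = reciprocal (+-pos-nonneg 0<1 0≤1) in h * (1# + _) , x≤√′ 0<h h2≈1 0≤x x<1

  infix 9 _⁴
  _⁴ : Carrier → Carrier
  x ⁴ = (x * x) * (x * x)

  ν : ℕ → Carrier
  ν n = suc n · 1#

  0<ν : ∀ n → 0# < ν n
  0<ν zero    = +-pos-nonneg 0<1 ≤-refl
  0<ν (suc n) = +-pos-nonneg 0<1 (<⇒≤ (0<ν n))

  1≤ν : ∀ n → 1# ≤ ν n
  1≤ν zero    = ≤-reflexive (sym (+-identityʳ 1#))
  1≤ν (suc n) = y≈x+z⇒x≤y (<⇒≤ (0<ν n)) refl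

  module Geometric {r} (0<r : 0# < r) (r<1 : r < 1#) where
    0≤r : 0# ≤ r
    0≤r = <⇒≤ 0<r

    r≤1 : r ≤ 1#
    r≤1 = <⇒≤ r<1

    0≤r^ : ∀ n → 0# ≤ r ^ n
    0≤r^ = 0≤^ 0≤r

    r^≤1 : ∀ n → r ^ n ≤ 1#
    r^≤1 = x^n≤1 0≤r r≤1

    private
      1-r⁻¹ = reciprocal (x<y⇒0<y-x r<1)

    -- 1 / (1 - r), the sum of the geometric series.
    g : Carrier
    g = proj₁ 1-r⁻¹

    0<g : 0# < g
    0<g = proj₁ (proj₂ 1-r⁻¹)

    0≤g : 0# ≤ g
    0≤g = <⇒≤ 0<g

    g*[1-r]≈1 : g * (1# - r) ≈ 1#
    g*[1-r]≈1 = proj₂ (proj₂ 1-r⁻¹)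

    1≤g : 1# ≤ g
    1≤g = y≈x+z⇒x≤y (0≤* 0≤g 0≤r) (begin-equality
      g                       ≈⟨ solve 2 (λ g r → g := g :* (con (+ 1) :- r) :+ g :* r) refl g r ⟩
      g * (1# - r) + g * r    ≈⟨ +-congʳ g*[1-r]≈1 ⟩
      1# + g * r              ∎)
      where open ≤-Reasoning

    private
      -- Each of the n + 1 terms of 1 + r + ⋯ + rⁿ is at least rⁿ; both sides are multiplied by 1 -
      -- r to avoid the quotient.
      νr^n[1-r]≤1-r^[1+n] : ∀ n → ν n * r ^ n * (1# - r) ≤ 1# - r ^ suc n
      νr^n[1-r]≤1-r^[1+n] zero = ≤-reflexive
        (solve 1 (λ r → (con (+ 1) :+ con (+ 0)) :* con (+ 1) :* (con (+ 1) :- r) := con (+ 1) :- r :* con (+ 1)) refl r)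
      νr^n[1-r]≤1-r^[1+n] (suc n) = y≈x+z⇒x≤y
        (0≤+ (0≤* 0≤r (x≤y⇒0≤y-x (νr^n[1-r]≤1-r^[1+n] n)))
             (0≤* (x≤y⇒0≤y-x r≤1) (x≤y⇒0≤y-x (r^≤1 (suc n)))))
        (solve 3 (λ r p v → con (+ 1) :- r :* (r :* p)
            := (con (+ 1) :+ v) :* (r :* p) :* (con (+ 1) :- r)
               :+ (r :* ((con (+ 1) :- r :* p) :- v :* p :* (con (+ 1) :- r))
                   :+ (con (+ 1) :- r) :* (con (+ 1) :- r :* p))) refl r (r ^ n) (ν n))

    νr^≤g : ∀ n → ν n * r ^ n ≤ g
    νr^≤g n = *-cancelʳ-≤ (1# - r) (x<y⇒0<y-x r<1)
      (≤-trans (νr^n[1-r]≤1-r^[1+n] n)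
      (≤-trans (y≈x+z⇒x≤y {1# - r ^ suc n} (0≤r^ (suc n)) (sym (x-y+y≈x 1# (r ^ suc n))))
      (≤-reflexive (sym g*[1-r]≈1))))

    -- From (N + 1) r^N ≤ g follows r^N ≤ g / (N + 1), so every N above C g / δ works, and the
    -- Archimedean axiom provides one.
    Cr^n-small : ∀ {C δ} → 0# ≤ C → 0# < δ → ∃[ N ] (∀ n → N ℕ.≤ n → C * r ^ n < δ)
    Cr^n-small {C} {δ} 0≤C 0<δ = N , λ n N≤n →
      ≤-<-trans (*-monoʳ-≤ C 0≤C (^-antiʳ-≤ 0≤r r≤1 N≤n)) (<-*-cancelʳ (ν N) (0<ν N) (begin-strict
        C * r ^ N * ν N        ≈⟨ trans (*-assoc _ _ _) (*-congˡ (*-comm _ _)) ⟩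
        C * (ν N * r ^ N)      ≤⟨ *-monoʳ-≤ C 0≤C (νr^≤g N) ⟩
        C * g                  ≈⟨ trans (*-congˡ eq) (*-identityʳ (C * g)) ⟨
        C * g * (δ⁻¹ * δ)      ≈⟨ *-assoc _ _ _ ⟨
        C * g * δ⁻¹ * δ        <⟨ *-monoˡ-< δ 0<δ (<-trans x<N (0<y-x⇒x<y (<-respʳ-≈ (sym (x+y-y≈x 1# _)) 0<1))) ⟩
        ν N * δ                ≈⟨ *-comm _ _ ⟩
        δ * ν N                ∎))
      where
      open ≤-Reasoning
      δ⁻¹ = proj₁ (reciprocal 0<δ)
      eq = proj₂ (proj₂ (reciprocal 0<δ))
      N = proj₁ (archimedean (C * g * δ⁻¹))
      x<N = proj₂ (archimedean (C * g * δ⁻¹))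

-- A complete normed ring, where z ⊑ s plays the role of | z | ≤ s.
record NormedRing {c ℓ₁ ℓ₂ ℓ₃} (R : Reals c ℓ₁ ℓ₂ ℓ₃) (a ℓ ℓ′ : Level) : Set (lsuc (a ⊔ ℓ ⊔ ℓ′) ⊔ c ⊔ ℓ₁ ⊔ ℓ₃) where
  private module ℝ = Reals R
  open RealOrder R using (_≤_)
  infix 4 _⊑_
  field
    commutativeRing : CommutativeRing a ℓ
  open CommutativeRing commutativeRing public
  field
    _⊑_     : Carrier → ℝ.Carrier → Set ℓ′
    ⊑-resp  : ∀ {x y s} → x ≈ y → x ⊑ s → y ⊑ s
    ⊑-mono  : ∀ {x s t} → x ⊑ s → s ≤ t → x ⊑ t
    ⊑⇒0≤    : ∀ {x s} → x ⊑ s → ℝ.0# ≤ s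
    0⊑0     : 0# ⊑ ℝ.0#
    1⊑1     : 1# ⊑ ℝ.1#
    ⊑0⇒≈0   : ∀ {x} → x ⊑ ℝ.0# → x ≈ 0#
    ⊑-+     : ∀ {x y s t} → x ⊑ s → y ⊑ t → x + y ⊑ s ℝ.+ t
    ⊑-*     : ∀ {x y s t} → x ⊑ s → y ⊑ t → x * y ⊑ s ℝ.* t
    ⊑-neg   : ∀ {x s} → x ⊑ s → - x ⊑ s
    bounded : ∀ x → ∃[ s ] x ⊑ s
    ⊑-closed : ∀ {x s} → (∀ {ε} → ℝ.0# ℝ.< ε → x ⊑ s ℝ.+ ε) → x ⊑ s
    complete : ∀ (f : ℕ → Carrier) →
      (∀ {ε} → ℝ.0# ℝ.< ε → ∃[ N ] (∀ n → N ℕ.≤ n → f n - f N ⊑ ε)) →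
      ∃[ l ] (∀ {ε} → ℝ.0# ℝ.< ε → ∃[ N ] (∀ n → N ℕ.≤ n → f n - l ⊑ ε))
    1-z-invertible : ∀ {z s} → z ⊑ s → s ℝ.< ℝ.1# → ∃[ u ] u * (1# - z) ≈ 1#
    -- The estimate | u | ≤ t / (1 - s), with 1 / (1 - s) replaced by any upper bound w, so that a
    -- majorant of convenient shape can be inserted.
    u[1-z]⊑⇒u⊑ : ∀ {z u s t w} → z ⊑ s → s ℝ.< ℝ.1# → ℝ.1# ≤ w ℝ.* (ℝ.1# ℝ.- s) →
      u * (1# - z) ⊑ t → u ⊑ t ℝ.* w

-- Convergence at a geometric rate.

module GeometricLimits {c ℓ₁ ℓ₂ ℓ₃ a ℓ ℓ′} {R : Reals c ℓ₁ ℓ₂ ℓ₃} (A : NormedRing R a ℓ ℓ′)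
  {r : Reals.Carrier R} (0<r : Reals._<_ R (Reals.0# R) r) (r<1 : Reals._<_ R r (Reals.1# R)) where
  private
    module ℝ = Reals R
    module 𝕆 = RealOrder R
  open 𝕆 using (_≤_)
  module 𝔾 = RealOrder.Geometric R 0<r r<1
  open 𝔾 using (g; 0≤r^)
  open NormedRing A
  open ℤ-Solver commutativeRing
  open Algebra.Properties.Semiring.Exp semiring using (_^_)

  infixl 7 _·r^_
  _·r^_ : ℝ.Carrier → ℕ → ℝ.Carrier
  C ·r^ n = C ℝ.* r 𝕆.^ n

  opaque
    ⊑-- : ∀ {x y s t} → x ⊑ s → y ⊑ t → x - y ⊑ s ℝ.+ t
    ⊑-- x⊑s y⊑t = ⊑-+ x⊑s (⊑-neg y⊑t)

    0⊑ : ∀ {s} → ℝ.0# ≤ s → 0# ⊑ s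
    0⊑ = ⊑-mono 0⊑0

    ⊑-cong : ∀ {x s t} → s ℝ.≈ t → x ⊑ s → x ⊑ t
    ⊑-cong s≈t x⊑s = ⊑-mono x⊑s (𝕆.≤-reflexive s≈t)

    ⊑-^ : ∀ {x s} → x ⊑ s → ∀ n → x ^ n ⊑ s 𝕆.^ n
    ⊑-^ x⊑s zero    = 1⊑1
    ⊑-^ x⊑s (suc n) = ⊑-* x⊑s (⊑-^ x⊑s n)

    x-y≈0⇒x≈y : ∀ {x y} → x - y ≈ 0# → x ≈ y
    x-y≈0⇒x≈y {x} {y} eq = begin
      x          ≈⟨ solve 2 (λ x y → x := (x :- y) :+ y) refl x y ⟩
      x - y + y  ≈⟨ +-congʳ eq ⟩
      0# + y     ≈⟨ +-identityˡ y ⟩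
      y          ∎
      where open import Relation.Binary.Reasoning.Setoid setoid

    x-y⊑⇒y-x⊑ : ∀ {x y s} → x - y ⊑ s → y - x ⊑ s
    x-y⊑⇒y-x⊑ {x} {y} p = ⊑-resp (solve 2 (λ x y → :- (x :- y) := y :- x) refl x y) (⊑-neg p)

    ⊑-triangle : ∀ {x y z s t} → x - y ⊑ s → y - z ⊑ t → x - z ⊑ s ℝ.+ t
    ⊑-triangle {x} {y} {z} p q = ⊑-resp (solve 3 (λ x y z → (x :- y) :+ (y :- z) := x :- z) refl x y z) (⊑-+ p q)

    ⊑-closed-r^ : ∀ {x s C} → ℝ.0# ≤ C → (∀ n → x ⊑ s ℝ.+ C ·r^ n) → x ⊑ s
    ⊑-closed-r^ {s = s} 0≤C x⊑ = ⊑-closed λ 0<ε →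
      let N , small = 𝔾.Cr^n-small 0≤C 0<ε
      in ⊑-mono (x⊑ N) (𝕆.+-monoʳ-≤ s (𝕆.<⇒≤ (small N ℕₚ.≤-refl)))

    sum-of-increments : ∀ {f : ℕ → Carrier} {B} → ℝ.0# ≤ B → (∀ n → f (suc n) - f n ⊑ B ·r^ n) →
      ∀ m k → f (k ℕ.+ m) - f m ⊑ B ℝ.* g ·r^ m
    sum-of-increments {f} {B} 0≤B f′⊑ m k = ⊑-mono (telescope k)
      (𝕆.y≈x+z⇒x≤y (𝕆.0≤* (𝕆.0≤* 0≤B 𝔾.0≤g) (0≤r^ (k ℕ.+ m))) (ℝ.sym (𝕆.x-y+y≈x _ _)))
      where
      eq : ∀ p e → (B ℝ.* g ℝ.* e ℝ.- B ℝ.* g ℝ.* p) ℝ.+ B ℝ.* p ℝ.≈ B ℝ.* g ℝ.* e ℝ.- B ℝ.* g ℝ.* (r ℝ.* p)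
      eq p e = begin-equality
        (B ℝ.* g ℝ.* e ℝ.- B ℝ.* g ℝ.* p) ℝ.+ B ℝ.* p
          ≈⟨ ℝ.+-congˡ (ℝ.trans (ℝ.*-congˡ 𝔾.g*[1-r]≈1) (ℝ.*-identityʳ _)) ⟨
        (B ℝ.* g ℝ.* e ℝ.- B ℝ.* g ℝ.* p) ℝ.+ B ℝ.* p ℝ.* (g ℝ.* (ℝ.1# ℝ.- r))
          ≈⟨ 𝕆.solve 5 (λ B g e p r → (B 𝕆.:* g 𝕆.:* e 𝕆.:- B 𝕆.:* g 𝕆.:* p) 𝕆.:+ B 𝕆.:* p 𝕆.:* (g 𝕆.:* (𝕆.con (+ 1) 𝕆.:- r))
               𝕆.:= B 𝕆.:* g 𝕆.:* e 𝕆.:- B 𝕆.:* g 𝕆.:* (r 𝕆.:* p)) ℝ.refl B g e p r ⟩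
        B ℝ.* g ℝ.* e ℝ.- B ℝ.* g ℝ.* (r ℝ.* p) ∎
        where open 𝕆.≤-Reasoning
      -- The induction needs the exact geometric sum B (r^m + ⋯ + r^(m+k-1)) = B g (r^m - r^(k+m));
      -- the subtracted part is dropped only afterwards.
      telescope : ∀ k → f (k ℕ.+ m) - f m ⊑ B ℝ.* g ·r^ m ℝ.- B ℝ.* g ·r^ (k ℕ.+ m)
      telescope zero = ⊑-resp (sym (-‿inverseʳ _)) (⊑-cong (ℝ.sym (ℝ.-‿inverseʳ _)) 0⊑0)
      telescope (suc k) = ⊑-cong (eq _ _)
        (⊑-resp (solve 3 (λ x y z → (y :- z) :+ (x :- y) := x :- z) refl (f (suc k ℕ.+ m)) (f (k ℕ.+ m)) (f m))
          (⊑-+ (telescope k) (f′⊑ (k ℕ.+ m))))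

    limit-of-increments : ∀ {f : ℕ → Carrier} {B} → ℝ.0# ≤ B → (∀ n → f (suc n) - f n ⊑ B ·r^ n) →
      ∃[ l ] (∀ n → f n - l ⊑ B ℝ.* g ·r^ n)
    limit-of-increments {f} {B} 0≤B f′⊑ = l , λ m → ⊑-closed λ 0<ε →
      let N , f⊑ = f→l 0<ε
      in ⊑-triangle {y = f (N ℕ.+ m)} (x-y⊑⇒y-x⊑ (sum-of-increments {f} 0≤B f′⊑ m N)) (f⊑ (N ℕ.+ m) (ℕₚ.m≤m+n N m))
      where
      cauchy : ∀ {ε} → ℝ.0# ℝ.< ε → ∃[ N ] (∀ n → N ℕ.≤ n → f n - f N ⊑ ε)
      cauchy 0<ε =
        let N , small = 𝔾.Cr^n-small (𝕆.0≤* 0≤B 𝔾.0≤g) 0<ε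
        in N , λ n N≤n → ⊑-mono (≡.subst (λ k → f k - f N ⊑ _) (ℕₚ.m∸n+n≡m N≤n) (sum-of-increments {f} 0≤B f′⊑ N (n ℕ.∸ N)))
                                (𝕆.<⇒≤ (small N ℕₚ.≤-refl))
      l : Carrier
      l = proj₁ (complete f cauchy)
      f→l : ∀ {ε} → ℝ.0# ℝ.< ε → ∃[ N ] (∀ n → N ℕ.≤ n → f n - l ⊑ ε)
      f→l = proj₂ (complete f cauchy)

  infix 4 _⇝_
  -- The base r is fixed once and for all, so sums and products of limits change only `rate`, and no
  -- ε has to be split.
  record _⇝_ (f : ℕ → Carrier) (l : Carrier) : Set (c ⊔ ℓ₃ ⊔ ℓ′) where
    constructor geometrically
    field
      {rate} : ℝ.Carrier
      0≤rate : ℝ.0# ≤ rate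
      f-l⊑   : ∀ n → f n - l ⊑ rate ·r^ n

  opaque
    ⇝-unique : ∀ {f l m} → f ⇝ l → f ⇝ m → l ≈ m
    ⇝-unique (geometrically {C} 0≤C p) (geometrically {D} 0≤D q) = x-y≈0⇒x≈y (⊑0⇒≈0 (⊑-closed-r^ (𝕆.0≤+ 0≤C 0≤D) λ n →
      ⊑-cong (ℝ.trans (ℝ.sym (ℝ.distribʳ _ C D)) (ℝ.sym (ℝ.+-identityˡ _)))
        (⊑-triangle (x-y⊑⇒y-x⊑ (p n)) (q n))))

    ⇝-cong : ∀ {f f′ l} → (∀ n → f n ≈ f′ n) → f ⇝ l → f′ ⇝ l
    ⇝-cong f≈f′ (geometrically 0≤C p) = geometrically 0≤C λ n → ⊑-resp (+-congʳ (f≈f′ n)) (p n)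

    ⇝-congʳ : ∀ {f l m} → l ≈ m → f ⇝ l → f ⇝ m
    ⇝-congʳ l≈m (geometrically 0≤C p) = geometrically 0≤C λ n → ⊑-resp (+-congˡ (-‿cong l≈m)) (p n)

    ⇝-const : ∀ l → (λ _ → l) ⇝ l
    ⇝-const l = geometrically 𝕆.≤-refl λ n → ⊑-resp (sym (-‿inverseʳ l)) (0⊑ (𝕆.0≤* 𝕆.≤-refl (0≤r^ n)))

    ⇝-+ : ∀ {f f′ l l′} → f ⇝ l → f′ ⇝ l′ → (λ n → f n + f′ n) ⇝ l + l′
    ⇝-+ {f} {f′} {l} {l′} (geometrically {C} 0≤C p) (geometrically {D} 0≤D q) = geometrically (𝕆.0≤+ 0≤C 0≤D) λ n →
      ⊑-resp (solve 4 (λ x y l m → (x :- l) :+ (y :- m) := (x :+ y) :- (l :+ m)) refl (f n) (f′ n) l l′)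
        (⊑-cong (ℝ.sym (ℝ.distribʳ _ C D)) (⊑-+ (p n) (q n)))

    ⇝-neg : ∀ {f l} → f ⇝ l → (λ n → - f n) ⇝ - l
    ⇝-neg {f} {l} (geometrically 0≤C p) = geometrically 0≤C λ n →
      ⊑-resp (solve 2 (λ x l → :- (x :- l) := :- x :- :- l) refl (f n) l) (⊑-neg (p n))

    ⇝-- : ∀ {f f′ l l′} → f ⇝ l → f′ ⇝ l′ → (λ n → f n - f′ n) ⇝ l - l′
    ⇝-- p q = ⇝-+ p (⇝-neg q)

    -- xy - lm = (x - l)(y - m) + l (y - m) + m (x - l). The first product decays like r²ⁿ, of which
    -- one factor rⁿ is bounded by 1.
    ⇝-* : ∀ {f f′ l l′} → f ⇝ l → f′ ⇝ l′ → (λ n → f n * f′ n) ⇝ l * l′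
    ⇝-* {f} {f′} {l} {l′} (geometrically {C} 0≤C p) (geometrically {D} 0≤D q) =
      geometrically (𝕆.0≤+ (𝕆.0≤+ (𝕆.0≤* 0≤C 0≤D) (𝕆.0≤* (⊑⇒0≤ l⊑s) 0≤D)) (𝕆.0≤* (⊑⇒0≤ l′⊑t) 0≤C)) λ n →
        ⊑-resp (solve 4 (λ x y l m → ((x :- l) :* (y :- m) :+ l :* (y :- m)) :+ m :* (x :- l) := x :* y :- l :* m) refl (f n) (f′ n) l l′)
          (⊑-mono (⊑-+ (⊑-+ (⊑-* (p n) (q n)) (⊑-* l⊑s (q n))) (⊑-* l′⊑t (p n)))
            (𝕆.≤-trans (𝕆.+-monoˡ-≤ _ (𝕆.+-monoˡ-≤ _ (𝕆.*-monoʳ-≤ _ (𝕆.0≤* 0≤C (0≤r^ n))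
                (𝕆.≤-trans (𝕆.*-monoʳ-≤ D 0≤D (𝔾.r^≤1 n)) (𝕆.≤-reflexive (ℝ.*-identityʳ D))))))
              (𝕆.≤-reflexive (𝕆.solve 5 (λ C D e s t → (C 𝕆.:* e 𝕆.:* D 𝕆.:+ s 𝕆.:* (D 𝕆.:* e)) 𝕆.:+ t 𝕆.:* (C 𝕆.:* e)
                 𝕆.:= (C 𝕆.:* D 𝕆.:+ s 𝕆.:* D 𝕆.:+ t 𝕆.:* C) 𝕆.:* e) ℝ.refl C D (r 𝕆.^ n) s t))))
      where
      s t : ℝ.Carrier
      s = proj₁ (bounded l)
      t = proj₁ (bounded l′)
      l⊑s : l ⊑ s
      l⊑s = proj₂ (bounded l)
      l′⊑t : l′ ⊑ t
      l′⊑t = proj₂ (bounded l′)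

-- A uniform bound for the products ∏ (1 + x rʲ).

module BoundedProduct {c ℓ₁ ℓ₂ ℓ₃} (R : Reals c ℓ₁ ℓ₂ ℓ₃)
  {r : Reals.Carrier R} (0<r : Reals._<_ R (Reals.0# R) r) (r<1 : Reals._<_ R r (Reals.1# R)) where
  open Reals R
  open RealOrder R
  open Geometric 0<r r<1
  open ≤-Reasoning

  -- The product (-x;r)ₙ. It recurses at the front because the bounds below are inductions along x ↦
  -- r x.
  ∏1+xr^ : Carrier → ℕ → Carrier
  ∏1+xr^ x zero    = 1#
  ∏1+xr^ x (suc n) = (1# + x) * ∏1+xr^ (r * x) n

  opaque
    ∏1+xr^-snoc : ∀ x n → ∏1+xr^ x (suc n) ≈ ∏1+xr^ x n * (1# + x * r ^ n)
    ∏1+xr^-snoc x zero = solve 1 (λ x → (con (+ 1) :+ x) :* con (+ 1) := con (+ 1) :* (con (+ 1) :+ x :* con (+ 1))) refl x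
    ∏1+xr^-snoc x (suc n) = begin-equality
      (1# + x) * ∏1+xr^ (r * x) (suc n)                        ≈⟨ *-congˡ (∏1+xr^-snoc (r * x) n) ⟩
      (1# + x) * (∏1+xr^ (r * x) n * (1# + r * x * r ^ n))     ≈⟨ solve 4 (λ x p r e → (con (+ 1) :+ x) :* (p :* (con (+ 1) :+ r :* x :* e))
                                                                   := (con (+ 1) :+ x) :* p :* (con (+ 1) :+ x :* (r :* e))) refl x _ r (r ^ n) ⟩
      (1# + x) * ∏1+xr^ (r * x) n * (1# + x * (r * r ^ n))     ∎

    1≤1+x : ∀ {x} → 0# ≤ x → 1# ≤ 1# + x
    1≤1+x 0≤x = y≈x+z⇒x≤y 0≤x refl

    1≤∏1+xr^ : ∀ {x} → 0# ≤ x → ∀ n → 1# ≤ ∏1+xr^ x n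
    1≤∏1+xr^ 0≤x zero    = ≤-refl
    1≤∏1+xr^ {x} 0≤x (suc n) = ≤-trans (≤-reflexive (sym (*-identityˡ 1#)))
      (*-mono-≤ 0≤1 (1≤1+x 0≤x) 0≤1 (1≤∏1+xr^ (0≤* 0≤r 0≤x) n))

    -- The hypothesis says 2 g x ≤ 1, and it is inherited by r x. Since g (1 - r) = 1, the bound
    -- exceeds (1 + x)(1 + 2 g r x) by x (1 - r · 2 g x), which is then nonnegative.
    ∏1+xr^≤1+2gx : ∀ {x} → 0# ≤ x → (1# + 1#) * x ≤ 1# - r → ∀ n → ∏1+xr^ x n ≤ 1# + (1# + 1#) * (g * x)
    ∏1+xr^≤1+2gx 0≤x _ zero = 1≤1+x (0≤* (0≤+ 0≤1 0≤1) (0≤* 0≤g 0≤x))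
    ∏1+xr^≤1+2gx {x} 0≤x 2x≤1-r (suc n) = begin
      (1# + x) * ∏1+xr^ (r * x) n
        ≤⟨ *-monoʳ-≤ (1# + x) (0≤+ 0≤1 0≤x) (∏1+xr^≤1+2gx (0≤* 0≤r 0≤x) 2rx≤1-r n) ⟩
      (1# + x) * (1# + (1# + 1#) * (g * (r * x)))
        ≤⟨ y≈x+z⇒x≤y (0≤* 0≤x (x≤y⇒0≤y-x small)) refl ⟩
      (1# + x) * (1# + (1# + 1#) * (g * (r * x))) + x * (1# - r * (g * ((1# + 1#) * x)))
        ≈⟨ solve 3 (λ x g r → (con (+ 1) :+ x) :* (con (+ 1) :+ con (+ 2) :* (g :* (r :* x))) :+ x :* (con (+ 1) :- r :* (g :* (con (+ 2) :* x)))
             := (con (+ 1) :+ con (+ 2) :* (g :* x)) :+ con (+ 2) :* x :* (con (+ 1) :- g :* (con (+ 1) :- r))) refl x g r ⟩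
      (1# + (1# + 1#) * (g * x)) + (1# + 1#) * x * (1# - g * (1# - r))
        ≈⟨ +-congˡ (*-congˡ (trans (+-congˡ (-‿cong g*[1-r]≈1)) (-‿inverseʳ 1#))) ⟩
      (1# + (1# + 1#) * (g * x)) + (1# + 1#) * x * 0#
        ≈⟨ trans (+-congˡ (zeroʳ _)) (+-identityʳ _) ⟩
      1# + (1# + 1#) * (g * x) ∎
      where
      2rx≤1-r : (1# + 1#) * (r * x) ≤ 1# - r
      2rx≤1-r = begin
        (1# + 1#) * (r * x)   ≤⟨ *-monoʳ-≤ _ (0≤+ 0≤1 0≤1) (*-monoˡ-≤ x 0≤x r≤1) ⟩
        (1# + 1#) * (1# * x)  ≈⟨ *-congˡ (*-identityˡ x) ⟩
        (1# + 1#) * x         ≤⟨ 2x≤1-r ⟩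
        1# - r                ∎
      small : r * (g * ((1# + 1#) * x)) ≤ 1#
      small = begin
        r * (g * ((1# + 1#) * x))  ≤⟨ *-mono-≤ 0≤r r≤1 (0≤* 0≤g (0≤* (0≤+ 0≤1 0≤1) 0≤x)) (*-monoʳ-≤ g 0≤g 2x≤1-r) ⟩
        1# * (g * (1# - r))        ≈⟨ trans (*-identityˡ _) g*[1-r]≈1 ⟩
        1#                         ∎

    private
      -- Splitting off J factors replaces x by x r^J, which is small enough for `∏1+xr^≤1+2gx`; the
      -- factors split off go into the constant.
      ∏1+xr^-bounded′ : ∀ J {x} → 0# ≤ x → (1# + 1#) * x * r ^ J ≤ 1# - r → ∃[ K ] (∀ n → ∏1+xr^ x n ≤ K)
      ∏1+xr^-bounded′ zero {x} 0≤x p = _ , ∏1+xr^≤1+2gx 0≤x (≤-trans (≤-reflexive (sym (*-identityʳ _))) p)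
      ∏1+xr^-bounded′ (suc J) {x} 0≤x p = bound (∏1+xr^-bounded′ J (0≤* 0≤r 0≤x) (≤-trans (≤-reflexive
          (solve 3 (λ x r e → con (+ 2) :* (r :* x) :* e := con (+ 2) :* x :* (r :* e)) refl x r (r ^ J))) p))
        where
        bound : ∃[ K ] (∀ n → ∏1+xr^ (r * x) n ≤ K) → ∃[ K ] (∀ n → ∏1+xr^ x n ≤ K)
        bound (K , ∏≤K) = (1# + x) * K , λ where
          zero    → ≤-trans (≤-reflexive (sym (*-identityˡ 1#))) (*-mono-≤ 0≤1 (1≤1+x 0≤x) 0≤1 (∏≤K 0))
          (suc n) → *-monoʳ-≤ (1# + x) (0≤+ 0≤1 0≤x) (∏≤K n)

    ∏1+xr^-bounded : ∀ {x} → 0# ≤ x → ∃[ K ] (∀ n → ∏1+xr^ x n ≤ K)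
    ∏1+xr^-bounded 0≤x =
      let J , small = Cr^n-small (0≤* (0≤+ 0≤1 0≤1) 0≤x) (x<y⇒0<y-x r<1)
      in ∏1+xr^-bounded′ J 0≤x (<⇒≤ (small J ℕₚ.≤-refl))

-- Stated for foldr, because sum and product depend on a whole raw structure,
-- including its equality.
module FoldrProperties {c ℓ} (M : Monoid c ℓ) where
  open Monoid M

  foldr-snoc : ∀ (f : ℕ → Carrier) n → foldr _∙_ ε {suc n} (λ i → f (toℕ i)) ≈ foldr _∙_ ε {n} (λ i → f (toℕ i)) ∙ f n
  foldr-snoc f zero    = trans (identityʳ _) (sym (identityˡ _))
  foldr-snoc f (suc n) = trans (∙-congˡ (foldr-snoc (λ i → f (suc i)) n)) (sym (assoc _ _ _))

  foldr-cong : ∀ n {f g : Fin n → Carrier} → (∀ i → f i ≈ g i) → foldr _∙_ ε f ≈ foldr _∙_ ε g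
  foldr-cong zero    f≈g = refl
  foldr-cong (suc n) f≈g = ∙-cong (f≈g fzero) (foldr-cong n (λ i → f≈g (fsuc i)))

-- Uniform bounds for q-shifted factorials on a disc.

module QBounds {c ℓ₁ ℓ₂ ℓ₃ a ℓ ℓ′} {R : Reals c ℓ₁ ℓ₂ ℓ₃} (A : NormedRing R a ℓ ℓ′)
  {r : Reals.Carrier R} (0<r : Reals._<_ R (Reals.0# R) r) (r<1 : Reals._<_ R r (Reals.1# R))
  {q : NormedRing.Carrier A} (q⊑ρ : NormedRing._⊑_ A q (RealOrder._⁴ R r)) where
  private module ℝ = Reals R
  module 𝕆 = RealOrder R
  open 𝕆 using (_≤_; ν)
  open GeometricLimits A 0<r r<1 public
  open 𝔾 using (g)
  module 𝔹 = BoundedProduct R 0<r r<1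

  -- On the disc of radius r⁴ all bounds have spare powers of r, which absorb the
  -- factors ν n = n + 1 and leave a geometric rate rⁿ.
  ρ : ℝ.Carrier
  ρ = r 𝕆.⁴

  -- The product of the 1 + g rʲ, j < n, is a common majorant of (x;q)ₙ, of 1/(x;q)ₙ and of ρ⁻ⁿ
  -- (q/x;q)ₙ xⁿ. The comparison goes factor by factor: g ≥ 1 serves the numerators, and 1/(1 - s) ≤
  -- 1 + g s for 0 ≤ s ≤ r serves the denominators.
  W : ℕ → ℝ.Carrier
  W = 𝔹.∏1+xr^ g

  K : ℝ.Carrier
  K = proj₁ (𝔹.∏1+xr^-bounded 𝔾.0≤g)

  module _ where
    open ℝ using (_*_; _+_) renaming (1# to 1ℝ; 0# to 0ℝ)
    open 𝕆.≤-Reasoning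
    opaque
      W≤K : ∀ n → W n ≤ K
      W≤K = proj₂ (𝔹.∏1+xr^-bounded 𝔾.0≤g)

      0≤W : ∀ n → 0ℝ ≤ W n
      0≤W n = 𝕆.≤-trans 𝕆.0≤1 (𝔹.1≤∏1+xr^ 𝔾.0≤g n)

      0≤K : 0ℝ ≤ K
      0≤K = 𝕆.≤-trans (0≤W 0) (W≤K 0)

      0<ρ : 0ℝ ℝ.< ρ
      0<ρ = ℝ.*-pos (ℝ.*-pos 0<r 0<r) (ℝ.*-pos 0<r 0<r)

      0≤ρ : 0ℝ ≤ ρ
      0≤ρ = 𝕆.<⇒≤ 0<ρ

      r²≤r : r * r ≤ r
      r²≤r = 𝕆.≤-trans (𝕆.*-monoʳ-≤ r 𝔾.0≤r 𝔾.r≤1) (𝕆.≤-reflexive (ℝ.*-identityʳ r))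

      ρ≤r : ρ ≤ r
      ρ≤r = 𝕆.≤-trans (𝕆.x²-mono-≤ (𝕆.0≤* 𝔾.0≤r 𝔾.0≤r) r²≤r) r²≤r

      ρ<1 : ρ ℝ.< 1ℝ
      ρ<1 = 𝕆.≤-<-trans ρ≤r r<1

    κ : ℝ.Carrier
    κ = proj₁ (𝕆.reciprocal 0<ρ)

    opaque
      0≤κ : 0ℝ ≤ κ
      0≤κ = 𝕆.<⇒≤ (proj₁ (proj₂ (𝕆.reciprocal 0<ρ)))

      κρ≈1 : κ * ρ ℝ.≈ 1ℝ
      κρ≈1 = proj₂ (proj₂ (𝕆.reciprocal 0<ρ))

      0≤ρ^ : ∀ n → 0ℝ ≤ ρ 𝕆.^ n
      0≤ρ^ = 𝕆.0≤^ 0≤ρ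

      0≤ν : ∀ n → 0ℝ ≤ ν n
      0≤ν n = 𝕆.<⇒≤ (𝕆.0<ν n)

      ρ^≈ : ∀ n → ρ 𝕆.^ n ℝ.≈ (r 𝕆.^ n * r 𝕆.^ n) * (r 𝕆.^ n * r 𝕆.^ n)
      ρ^≈ n = ℝ.trans (^-distrib-* (r * r) (r * r) n) (ℝ.*-cong (^-distrib-* r r n) (^-distrib-* r r n))
        where open Algebra.Properties.CommutativeSemiring.Exp (CommutativeRing.commutativeSemiring ℝ.commutativeRing)

      -- Of the four powers in ρⁿ = r⁴ⁿ, two absorb the factors `ν n`, one is bounded by 1, and one
      -- remains as the rate. One factor `ν n` will come from the weight, the other from `P-P0⊑`.
      ν²ρ^≤ : ∀ n → ν n * (ν n * ρ 𝕆.^ n) ≤ g * g * r 𝕆.^ n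
      ν²ρ^≤ n = begin
        ν n * (ν n * ρ 𝕆.^ n)
          ≈⟨ ℝ.*-congˡ (ℝ.*-congˡ (ρ^≈ n)) ⟩
        ν n * (ν n * ((p * p) * (p * p)))
          ≈⟨ 𝕆.solve 2 (λ v p → v 𝕆.:* (v 𝕆.:* ((p 𝕆.:* p) 𝕆.:* (p 𝕆.:* p))) 𝕆.:= (v 𝕆.:* p) 𝕆.:* (v 𝕆.:* p) 𝕆.:* p 𝕆.:* p) ℝ.refl (ν n) p ⟩
        (ν n * p) * (ν n * p) * p * p
          ≤⟨ 𝕆.*-mono-≤ (𝕆.0≤* (𝕆.0≤* 0≤νp 0≤νp) (𝔾.0≤r^ n)) (𝕆.*-monoˡ-≤ p (𝔾.0≤r^ n) (𝕆.x²-mono-≤ 0≤νp (𝔾.νr^≤g n))) (𝔾.0≤r^ n) (𝔾.r^≤1 n) ⟩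
        g * g * p * 1ℝ
          ≈⟨ ℝ.*-identityʳ _ ⟩
        g * g * p ∎
        where
        p : ℝ.Carrier
        p = r 𝕆.^ n
        0≤νp : 0ℝ ≤ ν n * p
        0≤νp = 𝕆.0≤* (0≤ν n) (𝔾.0≤r^ n)

      νρ^≤ : ∀ n → ν n * ρ 𝕆.^ n ≤ g * g * r 𝕆.^ n
      νρ^≤ n = begin
        ν n * ρ 𝕆.^ n           ≈⟨ ℝ.*-identityˡ _ ⟨
        1ℝ * (ν n * ρ 𝕆.^ n)    ≤⟨ 𝕆.*-monoˡ-≤ _ (𝕆.0≤* (0≤ν n) (0≤ρ^ n)) (𝕆.1≤ν n) ⟩
        ν n * (ν n * ρ 𝕆.^ n)   ≤⟨ ν²ρ^≤ n ⟩
        g * g * r 𝕆.^ n         ∎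

      r^[1+n]<1 : ∀ n → r 𝕆.^ suc n ℝ.< 1ℝ
      r^[1+n]<1 n = 𝕆.≤-<-trans (𝕆.≤-trans (𝕆.*-monoʳ-≤ r 𝔾.0≤r (𝔾.r^≤1 n)) (𝕆.≤-reflexive (ℝ.*-identityʳ r))) r<1

      ρ^≤r^ : ∀ n → ρ 𝕆.^ n ≤ r 𝕆.^ n
      ρ^≤r^ zero    = 𝕆.≤-refl
      ρ^≤r^ (suc n) = 𝕆.*-mono-≤ 0≤ρ ρ≤r (0≤ρ^ n) (ρ^≤r^ n)

      1+r^[1+n]≤1+gr^n : ∀ n → 1ℝ + r 𝕆.^ suc n ≤ 1ℝ + g * r 𝕆.^ n
      1+r^[1+n]≤1+gr^n n = 𝕆.+-monoʳ-≤ 1ℝ (𝕆.*-monoˡ-≤ _ (𝔾.0≤r^ n) (𝕆.≤-trans 𝔾.r≤1 𝔾.1≤g))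

      1≤[1+gs][1-s] : ∀ {s} → 0ℝ ≤ s → s ≤ r → 1ℝ ≤ (1ℝ + g * s) * (1ℝ ℝ.- s)
      1≤[1+gs][1-s] {s} 0≤s s≤r = 𝕆.y≈x+z⇒x≤y
        (𝕆.0≤* 0≤s (𝕆.x≤y⇒0≤y-x 1≤g[1-s]))
        (𝕆.solve 2 (λ g s → (𝕆.con (+ 1) 𝕆.:+ g 𝕆.:* s) 𝕆.:* (𝕆.con (+ 1) 𝕆.:- s)
           𝕆.:= 𝕆.con (+ 1) 𝕆.:+ s 𝕆.:* (g 𝕆.:* (𝕆.con (+ 1) 𝕆.:- s) 𝕆.:- 𝕆.con (+ 1))) ℝ.refl g s)
        where
        1≤g[1-s] : 1ℝ ≤ g * (1ℝ ℝ.- s)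
        1≤g[1-s] = begin
          1ℝ              ≈⟨ 𝔾.g*[1-r]≈1 ⟨
          g * (1ℝ ℝ.- r)  ≤⟨ 𝕆.*-monoʳ-≤ g 𝔾.0≤g (𝕆.y≈x+z⇒x≤y (𝕆.x≤y⇒0≤y-x s≤r)
                                (𝕆.solve 2 (λ s r → 𝕆.con (+ 1) 𝕆.:- s 𝕆.:= 𝕆.con (+ 1) 𝕆.:- r 𝕆.:+ (r 𝕆.:- s)) ℝ.refl s r)) ⟩
          g * (1ℝ ℝ.- s)  ∎

  open NormedRing A
  open ℤ-Solver commutativeRing
  open Algebra.Properties.Semiring.Exp semiring using (_^_)
  open FoldrProperties *-monoid

  record Disc : Set (a ⊔ ℓ′) where
    no-eta-equality
    constructor _∈disc_
    field
      pt  : Carrier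
      pt⊑ : pt ⊑ ρ
  open Disc public

  private opaque
    0⊑ρ : 0# ⊑ ρ
    0⊑ρ = 0⊑ 0≤ρ

    xy⊑ρ : ∀ {x y} → x ⊑ ρ → y ⊑ ρ → x * y ⊑ ρ
    xy⊑ρ x⊑ρ y⊑ρ = ⊑-mono (⊑-* x⊑ρ y⊑ρ)
      (𝕆.≤-trans (𝕆.*-monoʳ-≤ ρ 0≤ρ (𝕆.<⇒≤ ρ<1)) (𝕆.≤-reflexive (ℝ.*-identityʳ ρ)))

  0ᴰ : Disc
  0ᴰ = 0# ∈disc 0⊑ρ

  qᴰ : Disc
  qᴰ = q ∈disc q⊑ρ

  infixl 7 _*ᴰ_
  _*ᴰ_ : Disc → Disc → Disc
  x *ᴰ y = (pt x * pt y) ∈disc xy⊑ρ (pt⊑ x) (pt⊑ y)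

  -- (x;q)ₙ, extended by its last factor, whereas `product` recurses at its first; `Q≈product`
  -- reconciles the two.
  Q : Carrier → ℕ → Carrier
  Q x zero    = 1#
  Q x (suc n) = Q x n * (1# - x * q ^ n)

  -- P x n = (q/x;q)ₙ xⁿ, which also makes sense for x = 0.
  P : Carrier → ℕ → Carrier
  P x zero    = 1#
  P x (suc n) = P x n * (x - q ^ suc n)

  opaque
    Q≈product : ∀ x n → Q x n ≈ foldr _*_ 1# {n} (λ j → 1# - x * q ^ toℕ j)
    Q≈product x zero    = refl
    Q≈product x (suc n) = trans (*-congʳ (Q≈product x n)) (sym (foldr-snoc (λ j → 1# - x * q ^ j) n))

    Q-cong : ∀ {x y} → x ≈ y → ∀ n → Q x n ≈ Q y n
    Q-cong x≈y zero    = refl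
    Q-cong x≈y (suc n) = *-cong (Q-cong x≈y n) (+-congˡ (-‿cong (*-congʳ x≈y)))

    Q-front : ∀ x n → Q x (suc n) ≈ (1# - x) * Q (x * q) n
    Q-front x zero = solve 1 (λ x → con (+ 1) :* (con (+ 1) :- x :* con (+ 1)) := (con (+ 1) :- x) :* con (+ 1)) refl x
    Q-front x (suc n) = begin
      Q x (suc n) * (1# - x * (q * q ^ n))                 ≈⟨ *-congʳ (Q-front x n) ⟩
      (1# - x) * Q (x * q) n * (1# - x * (q * q ^ n))      ≈⟨ *-assoc _ _ _ ⟩
      (1# - x) * (Q (x * q) n * (1# - x * (q * q ^ n)))    ≈⟨ *-congˡ (*-congˡ (+-congˡ (-‿cong (*-assoc x q (q ^ n))))) ⟨
      (1# - x) * (Q (x * q) n * (1# - x * q * q ^ n))      ∎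
      where open Relation.Binary.Reasoning.Setoid setoid

    q^⊑ : ∀ n → q ^ n ⊑ ρ 𝕆.^ n
    q^⊑ = ⊑-^ q⊑ρ

    q^⊑r^ : ∀ n → q ^ n ⊑ r 𝕆.^ n
    q^⊑r^ n = ⊑-mono (q^⊑ n) (ρ^≤r^ n)

    xq^n⊑ : ∀ (x : Disc) n → pt x * q ^ n ⊑ r 𝕆.^ suc n
    xq^n⊑ x n = ⊑-* (⊑-mono (pt⊑ x) ρ≤r) (q^⊑r^ n)

    W-snoc : ∀ n → W (suc n) ℝ.≈ W n ℝ.* (ℝ.1# ℝ.+ g ℝ.* r 𝕆.^ n)
    W-snoc = 𝔹.∏1+xr^-snoc g

    Q⊑W : ∀ (x : Disc) n → Q (pt x) n ⊑ W n
    Q⊑W x zero    = 1⊑1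
    Q⊑W x (suc n) = ⊑-cong (ℝ.sym (W-snoc n))
      (⊑-* (Q⊑W x n) (⊑-mono (⊑-- 1⊑1 (xq^n⊑ x n)) (1+r^[1+n]≤1+gr^n n)))

    Q⊑K : ∀ (x : Disc) n → Q (pt x) n ⊑ K
    Q⊑K x n = ⊑-mono (Q⊑W x n) (W≤K n)

    x-q^⊑ : ∀ (x : Disc) n → pt x - q ^ suc n ⊑ ρ ℝ.* (ℝ.1# ℝ.+ g ℝ.* r 𝕆.^ n)
    x-q^⊑ x n = ⊑-mono (⊑-- (pt⊑ x) (q^⊑ (suc n))) (begin
      ρ ℝ.+ ρ ℝ.* ρ 𝕆.^ n                   ≈⟨ ℝ.+-congʳ (ℝ.*-identityʳ ρ) ⟨
      ρ ℝ.* ℝ.1# ℝ.+ ρ ℝ.* ρ 𝕆.^ n          ≈⟨ ℝ.distribˡ ρ _ _ ⟨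
      ρ ℝ.* (ℝ.1# ℝ.+ ρ 𝕆.^ n)              ≤⟨ 𝕆.*-monoʳ-≤ ρ 0≤ρ (𝕆.+-monoʳ-≤ ℝ.1# ρ^≤gr^) ⟩
      ρ ℝ.* (ℝ.1# ℝ.+ g ℝ.* r 𝕆.^ n)        ∎)
      where
      open 𝕆.≤-Reasoning
      ρ^≤gr^ : ρ 𝕆.^ n ≤ g ℝ.* r 𝕆.^ n
      ρ^≤gr^ = begin
        ρ 𝕆.^ n            ≤⟨ ρ^≤r^ n ⟩
        r 𝕆.^ n            ≈⟨ ℝ.*-identityˡ _ ⟨
        ℝ.1# ℝ.* r 𝕆.^ n   ≤⟨ 𝕆.*-monoˡ-≤ _ (𝔾.0≤r^ n) 𝔾.1≤g ⟩
        g ℝ.* r 𝕆.^ n      ∎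

    P⊑ρ^W : ∀ (x : Disc) n → P (pt x) n ⊑ ρ 𝕆.^ n ℝ.* W n
    P⊑ρ^W x zero    = ⊑-cong (ℝ.sym (ℝ.*-identityˡ _)) 1⊑1
    P⊑ρ^W x (suc n) = ⊑-cong (begin-equality
      ρ 𝕆.^ n ℝ.* W n ℝ.* (ρ ℝ.* v)     ≈⟨ 𝕆.solve 4 (λ e w p v → e 𝕆.:* w 𝕆.:* (p 𝕆.:* v) 𝕆.:= p 𝕆.:* e 𝕆.:* (w 𝕆.:* v)) ℝ.refl (ρ 𝕆.^ n) (W n) ρ v ⟩
      ρ ℝ.* ρ 𝕆.^ n ℝ.* (W n ℝ.* v)     ≈⟨ ℝ.*-congˡ (W-snoc n) ⟨
      ρ 𝕆.^ suc n ℝ.* W (suc n)         ∎)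
      (⊑-* (P⊑ρ^W x n) (x-q^⊑ x n))
      where
      open 𝕆.≤-Reasoning
      v : ℝ.Carrier
      v = ℝ.1# ℝ.+ g ℝ.* r 𝕆.^ n

    P⊑ρ^K : ∀ (x : Disc) n → P (pt x) n ⊑ ρ 𝕆.^ n ℝ.* K
    P⊑ρ^K x n = ⊑-mono (P⊑ρ^W x n) (𝕆.*-monoʳ-≤ _ (0≤ρ^ n) (W≤K n))

    -- Replacing x by 0 one factor at a time, each replacement puts δ where the bound of `P⊑ρ^W` has
    -- ρ, that is, it costs κ δ = δ/ρ times that bound. There are n ≤ `ν n` replacements.
    P-P0⊑ : ∀ (x : Disc) {δ} → pt x ⊑ δ → ∀ n → P (pt x) n - P 0# n ⊑ δ ℝ.* κ ℝ.* ν n ℝ.* (ρ 𝕆.^ n ℝ.* W n)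
    P-P0⊑ x {δ} x⊑δ zero = ⊑-resp (sym (-‿inverseʳ 1#))
      (0⊑ (𝕆.0≤* (𝕆.0≤* (𝕆.0≤* (⊑⇒0≤ x⊑δ) 0≤κ) (0≤ν 0)) (𝕆.0≤* 𝕆.0≤1 𝕆.0≤1)))
    P-P0⊑ x {δ} x⊑δ (suc n) = ⊑-resp
      (solve 4 (λ p z x e → (p :- z) :* (x :- e) :+ z :* x := p :* (x :- e) :- z :* (con (+ 0) :- e)) refl (P (pt x) n) (P 0# n) (pt x) (q ^ suc n))
      (⊑-mono (⊑-+ (⊑-* (P-P0⊑ x x⊑δ n) (x-q^⊑ x n)) (⊑-* (P⊑ρ^W 0ᴰ n) x⊑δ)) (begin
        δ ℝ.* κ ℝ.* ν n ℝ.* (e ℝ.* W n) ℝ.* (ρ ℝ.* v) ℝ.+ e ℝ.* W n ℝ.* δ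
          ≈⟨ ℝ.+-congˡ (ℝ.trans (ℝ.*-congˡ κρ≈1) (ℝ.*-identityʳ _)) ⟨
        δ ℝ.* κ ℝ.* ν n ℝ.* (e ℝ.* W n) ℝ.* (ρ ℝ.* v) ℝ.+ e ℝ.* W n ℝ.* δ ℝ.* (κ ℝ.* ρ)
          ≤⟨ 𝕆.+-monoʳ-≤ _ (𝕆.y≈x+z⇒x≤y (𝕆.0≤* (𝕆.0≤* (𝕆.0≤* (𝕆.0≤* (0≤ρ^ n) (0≤W n)) (⊑⇒0≤ x⊑δ)) (𝕆.0≤* 0≤κ 0≤ρ)) (𝕆.0≤* 𝔾.0≤g (𝔾.0≤r^ n)))
               (𝕆.solve 2 (λ z u → z 𝕆.:* (𝕆.con (+ 1) 𝕆.:+ u) 𝕆.:= z 𝕆.:+ z 𝕆.:* u) ℝ.refl (e ℝ.* W n ℝ.* δ ℝ.* (κ ℝ.* ρ)) (g ℝ.* r 𝕆.^ n))) ⟩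
        δ ℝ.* κ ℝ.* ν n ℝ.* (e ℝ.* W n) ℝ.* (ρ ℝ.* v) ℝ.+ e ℝ.* W n ℝ.* δ ℝ.* (κ ℝ.* ρ) ℝ.* v
          ≈⟨ 𝕆.solve 7 (λ δ κ n e w p v → δ 𝕆.:* κ 𝕆.:* n 𝕆.:* (e 𝕆.:* w) 𝕆.:* (p 𝕆.:* v) 𝕆.:+ e 𝕆.:* w 𝕆.:* δ 𝕆.:* (κ 𝕆.:* p) 𝕆.:* v
               𝕆.:= δ 𝕆.:* κ 𝕆.:* (𝕆.con (+ 1) 𝕆.:+ n) 𝕆.:* (p 𝕆.:* e 𝕆.:* (w 𝕆.:* v))) ℝ.refl δ κ (ν n) e (W n) ρ v ⟩
        δ ℝ.* κ ℝ.* ν (suc n) ℝ.* (ρ ℝ.* e ℝ.* (W n ℝ.* v))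
          ≈⟨ ℝ.*-congˡ (ℝ.*-congˡ (W-snoc n)) ⟨
        δ ℝ.* κ ℝ.* ν (suc n) ℝ.* (ρ ℝ.* e ℝ.* W (suc n)) ∎))
      where
      open 𝕆.≤-Reasoning
      e v : ℝ.Carrier
      e = ρ 𝕆.^ n
      v = ℝ.1# ℝ.+ g ℝ.* r 𝕆.^ n

  private
    1-xq^-invertible : ∀ (x : Disc) n → ∃[ u ] u * (1# - pt x * q ^ n) ≈ 1#
    1-xq^-invertible x n = 1-z-invertible (xq^n⊑ x n) (r^[1+n]<1 n)

  -- R⁻ x n = 1 / (x;q)ₙ
  R⁻ : Disc → ℕ → Carrier
  R⁻ x zero    = 1#
  R⁻ x (suc n) = R⁻ x n * proj₁ (1-xq^-invertible x n)

  opaque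
    R⁻-snoc : ∀ x n → R⁻ x (suc n) * (1# - pt x * q ^ n) ≈ R⁻ x n
    R⁻-snoc x n = trans (*-assoc _ _ _) (trans (*-congˡ (proj₂ (1-xq^-invertible x n))) (*-identityʳ _))

    R⁻-inverse : ∀ x n → R⁻ x n * Q (pt x) n ≈ 1#
    R⁻-inverse x zero    = *-identityˡ 1#
    R⁻-inverse x (suc n) = begin
      R⁻ x (suc n) * (Q (pt x) n * f)              ≈⟨ solve 3 (λ u v w → u :* (v :* w) := u :* w :* v) refl (R⁻ x (suc n)) (Q (pt x) n) f ⟩
      R⁻ x (suc n) * f * Q (pt x) n                ≈⟨ *-congʳ (R⁻-snoc x n) ⟩
      R⁻ x n * Q (pt x) n                          ≈⟨ R⁻-inverse x n ⟩
      1#                                           ∎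
      where
      open Relation.Binary.Reasoning.Setoid setoid
      f : Carrier
      f = 1# - pt x * q ^ n

    R⁻⊑W : ∀ x n → R⁻ x n ⊑ W n
    R⁻⊑W x zero    = 1⊑1
    R⁻⊑W x (suc n) = ⊑-mono (u[1-z]⊑⇒u⊑ (xq^n⊑ x n) (r^[1+n]<1 n)
        (1≤[1+gs][1-s] (𝔾.0≤r^ (suc n)) r^[1+n]≤r)
        (⊑-resp (sym (R⁻-snoc x n)) (R⁻⊑W x n)))
      (𝕆.≤-trans (𝕆.*-monoʳ-≤ _ (0≤W n) (𝕆.+-monoʳ-≤ ℝ.1# (𝕆.*-monoʳ-≤ g 𝔾.0≤g r^[1+n]≤r^n))) (𝕆.≤-reflexive (ℝ.sym (W-snoc n))))
      where
      r^[1+n]≤r : r 𝕆.^ suc n ≤ r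
      r^[1+n]≤r = 𝕆.≤-trans (𝕆.*-monoʳ-≤ r 𝔾.0≤r (𝔾.r^≤1 n)) (𝕆.≤-reflexive (ℝ.*-identityʳ r))
      r^[1+n]≤r^n : r 𝕆.^ suc n ≤ r 𝕆.^ n
      r^[1+n]≤r^n = 𝕆.^-antiʳ-≤ 𝔾.0≤r 𝔾.r≤1 (ℕₚ.n≤1+n n)

    R⁻⊑K : ∀ x n → R⁻ x n ⊑ K
    R⁻⊑K x n = ⊑-mono (R⁻⊑W x n) (W≤K n)

    -- 1/(x)ₙ₊₁ - 1/(x)ₙ = x qⁿ / (x)ₙ₊₁. Decay in n gives convergence of 1/(x)ₙ, linearity in δ
    -- gives its continuity at x = 0.
    R⁻-increment⊑ : ∀ x {δ} → pt x ⊑ δ → ∀ n → R⁻ x (suc n) - R⁻ x n ⊑ K ℝ.* δ ·r^ n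
    R⁻-increment⊑ x {δ} x⊑δ n = ⊑-resp (begin
        R⁻ x (suc n) * (pt x * q ^ n)                       ≈⟨ solve 2 (λ u z → u :* z := u :- u :* (con (+ 1) :- z)) refl (R⁻ x (suc n)) (pt x * q ^ n) ⟩
        R⁻ x (suc n) - R⁻ x (suc n) * (1# - pt x * q ^ n)   ≈⟨ +-congˡ (-‿cong (R⁻-snoc x n)) ⟩
        R⁻ x (suc n) - R⁻ x n                               ∎)
      (⊑-cong (ℝ.sym (ℝ.*-assoc K δ (r 𝕆.^ n))) (⊑-* (R⁻⊑K x (suc n)) (⊑-* x⊑δ (q^⊑r^ n))))
      where open Relation.Binary.Reasoning.Setoid setoid

    R⁻-1⊑ : ∀ x {δ} → pt x ⊑ δ → ∀ n → R⁻ x n - 1# ⊑ K ℝ.* δ ℝ.* g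
    R⁻-1⊑ x {δ} x⊑δ n = ⊑-cong (ℝ.*-identityʳ _)
      (≡.subst (λ k → R⁻ x k - 1# ⊑ K ℝ.* δ ℝ.* g ·r^ 0) (ℕₚ.+-identityʳ n)
        (sum-of-increments {R⁻ x} (𝕆.0≤* 0≤K (⊑⇒0≤ x⊑δ)) (R⁻-increment⊑ x x⊑δ) 0 n))

    R⁻-R⁻0⊑ : ∀ x {δ} → pt x ⊑ δ → ∀ n → R⁻ x n - R⁻ 0ᴰ n ⊑ K ℝ.* δ ℝ.* g ℝ.+ K ℝ.* δ ℝ.* g
    R⁻-R⁻0⊑ x x⊑δ n = ⊑-triangle (R⁻-1⊑ x x⊑δ n) (x-y⊑⇒y-x⊑ (R⁻-1⊑ 0ᴰ (0⊑ (⊑⇒0≤ x⊑δ)) n))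

-- The bilateral sequence and its shift relation for finite sums.

module BilateralSums {c ℓ₁ ℓ₂ ℓ₃ a ℓ ℓ′} {R : Reals c ℓ₁ ℓ₂ ℓ₃} (A : NormedRing R a ℓ ℓ′)
  {r : Reals.Carrier R} (0<r : Reals._<_ R (Reals.0# R) r) (r<1 : Reals._<_ R r (Reals.1# R))
  {q : NormedRing.Carrier A} (q⊑ρ : NormedRing._⊑_ A q (RealOrder._⁴ R r)) where
  private module ℝ = Reals R
  open QBounds A 0<r r<1 q⊑ρ public
  open 𝕆 using (_≤_; ν)
  open 𝔾 using (g)
  open NormedRing A
  open ℤ-Solver commutativeRing
  open Algebra.Properties.Semiring.Exp semiring using (_^_)
  open FoldrProperties +-monoid
  private open module ≈-Reasoning = Relation.Binary.Reasoning.Setoid setoid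

  -- With u n the bilateral sequence (q/x;q)ₙ xⁿ / (y;q)ₙ₊₁, n ∈ ℤ:
  -- p x y n = u n, - p y x n = u (- n - 1), and pred-p x y n = u (n - 1).
  p : Disc → Disc → ℕ → Carrier
  p x y n = P (pt x) n * R⁻ y (suc n)

  pred-p : Disc → Disc → ℕ → Carrier
  pred-p x y zero    = - p y x 0
  pred-p x y (suc n) = p x y n

  opaque
    inverse-unique : ∀ {u v d} → u * d ≈ 1# → v * d ≈ 1# → u ≈ v
    inverse-unique {u} {v} {d} ud≈1 vd≈1 = begin
      u              ≈⟨ *-identityʳ u ⟨
      u * 1#         ≈⟨ *-congˡ vd≈1 ⟨
      u * (v * d)    ≈⟨ solve 3 (λ u v d → u :* (v :* d) := v :* (u :* d)) refl u v d ⟩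
      v * (u * d)    ≈⟨ *-congˡ ud≈1 ⟩
      v * 1#         ≈⟨ *-identityʳ v ⟩
      v              ∎

    R⁻-shift : ∀ x n → R⁻ (x *ᴰ qᴰ) n ≈ (1# - pt x) * R⁻ x (suc n)
    R⁻-shift x n = inverse-unique (R⁻-inverse (x *ᴰ qᴰ) n) (begin
      (1# - pt x) * R⁻ x (suc n) * Q (pt x * q) n    ≈⟨ solve 3 (λ x u v → x :* u :* v := u :* (x :* v)) refl (1# - pt x) (R⁻ x (suc n)) (Q (pt x * q) n) ⟩
      R⁻ x (suc n) * ((1# - pt x) * Q (pt x * q) n)  ≈⟨ *-congˡ (Q-front (pt x) n) ⟨
      R⁻ x (suc n) * Q (pt x) (suc n)                ≈⟨ R⁻-inverse x (suc n) ⟩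
      1#                                             ∎)

    -- Each of the n + 1 factors xq - qʲ yields a q, leaving x - qʲ⁻¹: the factors of `P x n` and
    -- the new first factor x - 1.
    P-shift : ∀ x n → P (x * q) (suc n) ≈ q ^ suc n * (x - 1#) * P x n
    P-shift x zero = solve 2 (λ x q → con (+ 1) :* (x :* q :- q :* con (+ 1)) := q :* con (+ 1) :* (x :- con (+ 1)) :* con (+ 1)) refl x q
    P-shift x (suc n) = begin
      P (x * q) (suc n) * (x * q - q * z)          ≈⟨ *-congʳ (P-shift x n) ⟩
      z * (x - 1#) * P x n * (x * q - q * z)       ≈⟨ solve 4 (λ z x v q → z :* (x :- con (+ 1)) :* v :* (x :* q :- q :* z)
                                                       := q :* z :* (x :- con (+ 1)) :* (v :* (x :- z))) refl z x (P x n) q ⟩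
      q * z * (x - 1#) * (P x n * (x - z))         ∎
      where
      z : Carrier
      z = q ^ suc n

    -- The shift relation at indices n ≥ 0. For n ≥ 1, with z = qⁿ, common factors cancel and (x -
    -- z) - x (1 - yz) = - z (1 - xy) remains. At n = 0 the predecessor lies in the negative half,
    -- and (1 - x) + x (1 - y) = 1 - xy is used.
    p-shift : ∀ x y n → (1# - pt x * pt y) * p (x *ᴰ qᴰ) y n ≈ (1# - pt x) * (p x y n - pt x * pred-p x y n)
    p-shift x y zero = begin
      (1# - X * Y) * (1# * s)
        ≈⟨ solve 3 (λ x y s → (con (+ 1) :- x :* y) :* (con (+ 1) :* s) := (con (+ 1) :- x) :* s :+ x :* (s :* (con (+ 1) :- y :* con (+ 1)))) refl X Y s ⟩
      (1# - X) * s + X * (s * (1# - Y * 1#))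
        ≈⟨ +-congˡ (*-congˡ (trans (R⁻-snoc y 0) (sym (R⁻-snoc x 0)))) ⟩
      (1# - X) * s + X * (t * (1# - X * 1#))
        ≈⟨ solve 3 (λ x s t → (con (+ 1) :- x) :* s :+ x :* (t :* (con (+ 1) :- x :* con (+ 1)))
             := (con (+ 1) :- x) :* (con (+ 1) :* s :- x :* (:- (con (+ 1) :* t)))) refl X s t ⟩
      (1# - X) * (1# * s - X * - (1# * t)) ∎
      where
      X Y s t : Carrier
      X = pt x
      Y = pt y
      s = R⁻ y 1
      t = R⁻ x 1
    p-shift x y (suc n) = begin
      (1# - X * Y) * (P (X * q) (suc n) * v)
        ≈⟨ *-congˡ (*-congʳ (P-shift X n)) ⟩
      (1# - X * Y) * (z * (X - 1#) * P X n * v)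
        ≈⟨ solve 5 (λ x y z u v → (con (+ 1) :- x :* y) :* (z :* (x :- con (+ 1)) :* u :* v)
             := (con (+ 1) :- x) :* (u :* (x :- z) :* v :- x :* (u :* (v :* (con (+ 1) :- y :* z))))) refl X Y z (P X n) v ⟩
      (1# - X) * (P X n * (X - z) * v - X * (P X n * (v * (1# - Y * z))))
        ≈⟨ *-congˡ (+-congˡ (-‿cong (*-congˡ (*-congˡ (R⁻-snoc y (suc n)))))) ⟩
      (1# - X) * (P X (suc n) * v - X * (P X n * R⁻ y (suc n))) ∎
      where
      X Y z v : Carrier
      X = pt x
      Y = pt y
      z = q ^ suc n
      v = R⁻ y (suc (suc n))

    -- The shift relation at the index - n - 1, whose predecessor is - (n + 1) - 1. With z = qⁿ⁺¹ it
    -- reduces to (1 - xz) - x (y - z) = 1 - xy.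
    p-shiftʳ : ∀ x y n → (1# - pt x * pt y) * p y (x *ᴰ qᴰ) n ≈ (1# - pt x) * (p y x n - pt x * p y x (suc n))
    p-shiftʳ x y n = begin
      (1# - X * Y) * (P Y n * R⁻ (x *ᴰ qᴰ) (suc n))
        ≈⟨ *-congˡ (*-congˡ (R⁻-shift x (suc n))) ⟩
      (1# - X * Y) * (P Y n * ((1# - X) * v))
        ≈⟨ solve 5 (λ x y z u v → (con (+ 1) :- x :* y) :* (u :* ((con (+ 1) :- x) :* v))
             := (con (+ 1) :- x) :* (u :* (v :* (con (+ 1) :- x :* z)) :- x :* (u :* (y :- z) :* v))) refl X Y z (P Y n) v ⟩
      (1# - X) * (P Y n * (v * (1# - X * z)) - X * (P Y n * (Y - z) * v))
        ≈⟨ *-congˡ (+-congʳ (*-congˡ (R⁻-snoc x (suc n)))) ⟩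
      (1# - X) * (P Y n * R⁻ x (suc n) - X * (P Y (suc n) * v)) ∎
      where
      X Y z v : Carrier
      X = pt x
      Y = pt y
      z = q ^ suc n
      v = R⁻ x (suc (suc n))

  -- A weight w : ℤ → A, given by α n = w n and β n = - w (- n - 1).
  record Weight : Set (a ⊔ ℓ′) where
    field
      α β : ℕ → Carrier
      α⊑  : ∀ n → α n ⊑ ν n
      β⊑  : ∀ n → β n ⊑ ν n
  open Weight public

  -- w⁺ n = w (n + 1)
  record Shift (w w⁺ : Weight) : Set ℓ where
    field
      α-shift : ∀ n → α w⁺ n ≈ α w (suc n)
      β-shift : ∀ n → β w⁺ (suc n) ≈ β w n
      0-shift : β w⁺ 0 ≈ - α w 0
  open Shift public

  -- The summands of Σ w u at n and at - n - 1 taken together; the minus signs in the encodings of w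
  -- and u on the negative half cancel.
  term : Weight → Disc → Disc → ℕ → Carrier
  term w x y n = α w n * p x y n + β w n * p y x n

  partial : Weight → Disc → Disc → ℕ → Carrier
  partial w x y zero    = 0#
  partial w x y (suc N) = partial w x y N + term w x y N

  -- Equals w N u (N - 1) - w (- N) u (- N - 1) at N: the two end terms by which the window - N ≤ n
  -- < N changes when its index is shifted by one.
  boundary : Weight → Weight → Disc → Disc → ℕ → Carrier
  boundary w w⁺ x y n = α w n * pred-p x y n - β w⁺ n * p y x n

  opaque
    partial≈sum : ∀ w x y N → partial w x y N ≈ foldr _+_ 0# {N} (λ i → term w x y (toℕ i))
    partial≈sum w x y zero    = refl
    partial≈sum w x y (suc N) = trans (+-congʳ (partial≈sum w x y N)) (sym (foldr-snoc (term w x y) N))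

    partial-shift : ∀ {w w⁺} → Shift w w⁺ → ∀ x y N →
      (1# - pt x * pt y) * partial w (x *ᴰ qᴰ) y N
        ≈ (1# - pt x) * ((partial w x y N - pt x * partial w⁺ x y N) + pt x * boundary w w⁺ x y N)
    partial-shift {w} {w⁺} sh x y zero = begin
      (1# - X * Y) * 0#
        ≈⟨ solve 4 (λ x y u v → (con (+ 1) :- x :* y) :* con (+ 0)
             := (con (+ 1) :- x) :* ((con (+ 0) :- x :* con (+ 0)) :+ x :* (u :* (:- v) :- (:- u) :* v))) refl X Y (α w 0) (p y x 0) ⟩
      (1# - X) * ((0# - X * 0#) + X * (α w 0 * - p y x 0 - - α w 0 * p y x 0))
        -- For the empty window both end terms are w 0 u (- 1), so they cancel.
        ≈⟨ *-congˡ (+-congˡ (*-congˡ (+-congˡ (-‿cong (*-congʳ (0-shift sh)))))) ⟨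
      (1# - X) * ((0# - X * 0#) + X * boundary w w⁺ x y 0) ∎
      where
      X Y : Carrier
      X = pt x
      Y = pt y
    partial-shift {w} {w⁺} sh x y (suc n) = begin
      (1# - X * Y) * (partial w (x *ᴰ qᴰ) y n + (α w n * p (x *ᴰ qᴰ) y n + β w n * p y (x *ᴰ qᴰ) n))
        ≈⟨ solve 6 (λ d s u v u′ v′ → d :* (s :+ (u :* v :+ u′ :* v′)) := d :* s :+ (u :* (d :* v) :+ u′ :* (d :* v′))) refl
             (1# - X * Y) (partial w (x *ᴰ qᴰ) y n) (α w n) (p (x *ᴰ qᴰ) y n) (β w n) (p y (x *ᴰ qᴰ) n) ⟩
      (1# - X * Y) * partial w (x *ᴰ qᴰ) y n
        + (α w n * ((1# - X * Y) * p (x *ᴰ qᴰ) y n) + β w n * ((1# - X * Y) * p y (x *ᴰ qᴰ) n))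
        ≈⟨ +-cong (partial-shift sh x y n) (+-cong (*-congˡ (p-shift x y n)) (*-congˡ (p-shiftʳ x y n))) ⟩
      (1# - X) * ((T - X * T⁺) + X * (α w n * pred-p x y n - β w⁺ n * p y x n))
        + (α w n * ((1# - X) * (p x y n - X * pred-p x y n)) + β w n * ((1# - X) * (p y x n - X * p y x (suc n))))
        ≈⟨ regroup X T T⁺ (α w n) (pred-p x y n) (β w⁺ n) (p y x n) (p x y n) (β w n) (p y x (suc n)) (α w (suc n)) ⟩
      (1# - X) * (((T + term w x y n) - X * (T⁺ + (α w (suc n) * p x y n + β w⁺ n * p y x n)))
        + X * (α w (suc n) * p x y n - β w n * p y x (suc n)))
        ≈⟨ *-congˡ (+-cong (+-congˡ (-‿cong (*-congˡ (+-congˡ (+-congʳ (*-congʳ (α-shift sh n)))))))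
                           (*-congˡ (+-congˡ (-‿cong (*-congʳ (β-shift sh n)))))) ⟨
      (1# - X) * ((partial w x y (suc n) - X * partial w⁺ x y (suc n)) + X * boundary w w⁺ x y (suc n)) ∎
      where
      X Y T T⁺ : Carrier
      X = pt x
      Y = pt y
      T = partial w x y n
      T⁺ = partial w⁺ x y n
      regroup : ∀ X T T⁺ α pm β⁺ p′ p β p′₁ α₁ →
        (1# - X) * ((T - X * T⁺) + X * (α * pm - β⁺ * p′)) + (α * ((1# - X) * (p - X * pm)) + β * ((1# - X) * (p′ - X * p′₁)))
        ≈ (1# - X) * (((T + (α * p + β * p′)) - X * (T⁺ + (α₁ * p + β⁺ * p′))) + X * (α₁ * p - β * p′₁))
      regroup = solve 11 (λ X T T⁺ α pm β⁺ p′ p β p′₁ α₁ →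
        (con (+ 1) :- X) :* ((T :- X :* T⁺) :+ X :* (α :* pm :- β⁺ :* p′)) :+ (α :* ((con (+ 1) :- X) :* (p :- X :* pm)) :+ β :* ((con (+ 1) :- X) :* (p′ :- X :* p′₁)))
        := (con (+ 1) :- X) :* (((T :+ (α :* p :+ β :* p′)) :- X :* (T⁺ :+ (α₁ :* p :+ β⁺ :* p′))) :+ X :* (α₁ :* p :- β :* p′₁))) refl

-- Convergence of the bilateral series, its functional equation, and continuity at 0.

module BilateralSeries {c ℓ₁ ℓ₂ ℓ₃ a ℓ ℓ′} {R : Reals c ℓ₁ ℓ₂ ℓ₃} (A : NormedRing R a ℓ ℓ′)
  {r : Reals.Carrier R} (0<r : Reals._<_ R (Reals.0# R) r) (r<1 : Reals._<_ R r (Reals.1# R))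
  {q : NormedRing.Carrier A} (q⊑ρ : NormedRing._⊑_ A q (RealOrder._⁴ R r)) where
  private module ℝ = Reals R
  open BilateralSums A 0<r r<1 q⊑ρ public
  open 𝕆 using (_≤_; ν)
  open 𝔾 using (g)
  open NormedRing A
  open ℤ-Solver commutativeRing

  B : ℝ.Carrier
  B = g ℝ.* g ℝ.* (K ℝ.* K)

  opaque
    0≤B : ℝ.0# ≤ B
    0≤B = 𝕆.0≤* (𝕆.0≤* 𝔾.0≤g 𝔾.0≤g) (𝕆.0≤* 0≤K 0≤K)

    p⊑ : ∀ x y n → p x y n ⊑ ρ 𝕆.^ n ℝ.* K ℝ.* K
    p⊑ x y n = ⊑-* (P⊑ρ^K x n) (R⁻⊑K y (suc n))

    νρ^KK≤Br^ : ∀ n → ν n ℝ.* (ρ 𝕆.^ n ℝ.* K ℝ.* K) ≤ B ·r^ n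
    νρ^KK≤Br^ n = begin
      ν n ℝ.* (ρ 𝕆.^ n ℝ.* K ℝ.* K)             ≈⟨ 𝕆.solve 3 (λ v e K → v 𝕆.:* (e 𝕆.:* K 𝕆.:* K) 𝕆.:= v 𝕆.:* e 𝕆.:* (K 𝕆.:* K)) ℝ.refl (ν n) (ρ 𝕆.^ n) K ⟩
      ν n ℝ.* ρ 𝕆.^ n ℝ.* (K ℝ.* K)             ≤⟨ 𝕆.*-monoˡ-≤ _ (𝕆.0≤* 0≤K 0≤K) (νρ^≤ n) ⟩
      g ℝ.* g ℝ.* r 𝕆.^ n ℝ.* (K ℝ.* K)         ≈⟨ 𝕆.solve 3 (λ g e K → g 𝕆.:* g 𝕆.:* e 𝕆.:* (K 𝕆.:* K) 𝕆.:= g 𝕆.:* g 𝕆.:* (K 𝕆.:* K) 𝕆.:* e) ℝ.refl g (r 𝕆.^ n) K ⟩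
      B ·r^ n                                   ∎
      where open 𝕆.≤-Reasoning

    αp⊑ : ∀ {z x y n} → z ⊑ ν n → z * p x y n ⊑ B ·r^ n
    αp⊑ {x = x} {y} {n} z⊑ = ⊑-mono (⊑-* z⊑ (p⊑ x y n)) (νρ^KK≤Br^ n)

    term⊑ : ∀ w x y n → term w x y n ⊑ (B ℝ.+ B) ·r^ n
    term⊑ w x y n = ⊑-cong (ℝ.sym (ℝ.distribʳ (r 𝕆.^ n) B B))
      (⊑-+ (αp⊑ {x = x} {y} (α⊑ w n)) (αp⊑ {x = y} {x} (β⊑ w n)))

    partial-increment : ∀ w x y n → partial w x y (suc n) - partial w x y n ≈ term w x y n
    partial-increment w x y n = solve 2 (λ s t → (s :+ t) :- s := t) refl (partial w x y n) (term w x y n)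

    series : ∀ w x y → ∃[ l ] (∀ n → partial w x y n - l ⊑ (B ℝ.+ B) ℝ.* g ·r^ n)
    series w x y = limit-of-increments {partial w x y} (𝕆.0≤+ 0≤B 0≤B) λ n → ⊑-resp (sym (partial-increment w x y n)) (term⊑ w x y n)

  T : Weight → Disc → Disc → Carrier
  T w x y = proj₁ (series w x y)

  opaque
    partial⇝T : ∀ w x y → partial w x y ⇝ T w x y
    partial⇝T w x y = geometrically (𝕆.0≤* (𝕆.0≤+ 0≤B 0≤B) 𝔾.0≤g) (proj₂ (series w x y))

    -- The factor κ makes up for the lag of one index, as ρⁿ = κ ρⁿ⁺¹; at index 0 it suffices that κ
    -- ≥ 1.
    pred-p⊑ : ∀ x y n → pred-p x y n ⊑ κ ℝ.* (ρ 𝕆.^ n ℝ.* K ℝ.* K)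
    pred-p⊑ x y zero = ⊑-mono (⊑-neg (p⊑ y x 0)) (begin
      ℝ.1# ℝ.* K ℝ.* K           ≈⟨ ℝ.*-identityˡ _ ⟨
      ℝ.1# ℝ.* (ℝ.1# ℝ.* K ℝ.* K)  ≤⟨ 𝕆.*-monoˡ-≤ _ (𝕆.0≤* (𝕆.0≤* 𝕆.0≤1 0≤K) 0≤K) 1≤κ ⟩
      κ ℝ.* (ℝ.1# ℝ.* K ℝ.* K)   ∎)
      where
      open 𝕆.≤-Reasoning
      1≤κ : ℝ.1# ≤ κ
      1≤κ = 𝕆.≤-trans (𝕆.≤-reflexive (ℝ.sym κρ≈1)) (𝕆.≤-trans (𝕆.*-monoʳ-≤ κ 0≤κ (𝕆.<⇒≤ ρ<1)) (𝕆.≤-reflexive (ℝ.*-identityʳ κ)))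
    pred-p⊑ x y (suc n) = ⊑-cong (ℝ.trans (ℝ.sym (ℝ.trans (ℝ.*-congʳ κρ≈1) (ℝ.*-identityˡ _)))
      (𝕆.solve 4 (λ κ p e K → κ 𝕆.:* p 𝕆.:* (e 𝕆.:* K 𝕆.:* K) 𝕆.:= κ 𝕆.:* (p 𝕆.:* e 𝕆.:* K 𝕆.:* K)) ℝ.refl κ ρ (ρ 𝕆.^ n) K)) (p⊑ x y n)

    boundary⇝0 : ∀ w w⁺ x y → boundary w w⁺ x y ⇝ 0#
    boundary⇝0 w w⁺ x y = geometrically (𝕆.0≤+ (𝕆.0≤* 0≤κ 0≤B) 0≤B) λ n →
      ⊑-resp (solve 1 (λ z → z := z :- con (+ 0)) refl (boundary w w⁺ x y n))
        (⊑-cong (𝕆.solve 3 (λ κ B e → κ 𝕆.:* (B 𝕆.:* e) 𝕆.:+ B 𝕆.:* e 𝕆.:= (κ 𝕆.:* B 𝕆.:+ B) 𝕆.:* e) ℝ.refl κ B (r 𝕆.^ n))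
          (⊑-- (⊑-mono (⊑-* (α⊑ w n) (pred-p⊑ x y n))
                 (𝕆.≤-trans (𝕆.≤-reflexive (𝕆.solve 3 (λ v κ z → v 𝕆.:* (κ 𝕆.:* z) 𝕆.:= κ 𝕆.:* (v 𝕆.:* z)) ℝ.refl (ν n) κ (ρ 𝕆.^ n ℝ.* K ℝ.* K)))
                   (𝕆.*-monoʳ-≤ κ 0≤κ (νρ^KK≤Br^ n))))
               (αp⊑ {x = y} {x} (β⊑ w⁺ n))))

    T-shift : ∀ {w w⁺} → Shift w w⁺ → ∀ x y →
      (1# - pt x * pt y) * T w (x *ᴰ qᴰ) y ≈ (1# - pt x) * (T w x y - pt x * T w⁺ x y)
    T-shift {w} {w⁺} sh x y = trans (⇝-unique lhs (⇝-cong eq rhs)) simplify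
      where
      lhs : (λ n → (1# - pt x * pt y) * partial w (x *ᴰ qᴰ) y n) ⇝ (1# - pt x * pt y) * T w (x *ᴰ qᴰ) y
      lhs = ⇝-* (⇝-const (1# - pt x * pt y)) (partial⇝T w (x *ᴰ qᴰ) y)
      rhs₁ : (λ n → partial w x y n - pt x * partial w⁺ x y n) ⇝ T w x y - pt x * T w⁺ x y
      rhs₁ = ⇝-- (partial⇝T w x y) (⇝-* (⇝-const (pt x)) (partial⇝T w⁺ x y))
      rhs₂ : (λ n → pt x * boundary w w⁺ x y n) ⇝ pt x * 0#
      rhs₂ = ⇝-* (⇝-const (pt x)) (boundary⇝0 w w⁺ x y)
      rhs : (λ n → (1# - pt x) * ((partial w x y n - pt x * partial w⁺ x y n) + pt x * boundary w w⁺ x y n))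
        ⇝ (1# - pt x) * ((T w x y - pt x * T w⁺ x y) + pt x * 0#)
      rhs = ⇝-* (⇝-const (1# - pt x)) (⇝-+ rhs₁ rhs₂)
      eq : ∀ n → (1# - pt x) * ((partial w x y n - pt x * partial w⁺ x y n) + pt x * boundary w w⁺ x y n) ≈ (1# - pt x * pt y) * partial w (x *ᴰ qᴰ) y n
      eq n = sym (partial-shift sh x y n)
      simplify : (1# - pt x) * ((T w x y - pt x * T w⁺ x y) + pt x * 0#) ≈ (1# - pt x) * (T w x y - pt x * T w⁺ x y)
      simplify = *-congˡ (trans (+-congˡ (zeroʳ (pt x))) (+-identityʳ _))

  -- In the bound for the change of a summand, κ stems from varying x in (q/x)ₙ xⁿ, and g + g from
  -- varying it in 1/(x)ₙ₊₁, where x and 0 are both compared through the value 1.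
  C : ℝ.Carrier
  C = (κ ℝ.+ (g ℝ.+ g)) ℝ.* B

  opaque
    0≤C : ℝ.0# ≤ C
    0≤C = 𝕆.0≤* (𝕆.0≤+ 0≤κ (𝕆.0≤+ 𝔾.0≤g 𝔾.0≤g)) 0≤B

    term-term0⊑ : ∀ w x y {δ} → pt x ⊑ δ → ∀ n → term w x y n - term w 0ᴰ y n ⊑ C ℝ.* δ ·r^ n
    term-term0⊑ w x y {δ} x⊑δ n = ⊑-resp
      (solve 8 (λ α β u u₀ v s t t₀ → α :* ((u :- u₀) :* v) :+ β :* (s :* (t :- t₀))
         := (α :* (u :* v) :+ β :* (s :* t)) :- (α :* (u₀ :* v) :+ β :* (s :* t₀))) refl
         (α w n) (β w n) (P (pt x) n) (P 0# n) (R⁻ y (suc n)) (P (pt y) n) (R⁻ x (suc n)) (R⁻ 0ᴰ (suc n)))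
      (⊑-mono (⊑-+ (⊑-* (α⊑ w n) (⊑-* (P-P0⊑ x x⊑δ n) (R⁻⊑K y (suc n)))) (⊑-* (β⊑ w n) (⊑-* (P⊑ρ^K y n) (R⁻-R⁻0⊑ x x⊑δ (suc n)))))
        (begin
          v ℝ.* (δ ℝ.* κ ℝ.* v ℝ.* (e ℝ.* W n) ℝ.* K) ℝ.+ v ℝ.* (e ℝ.* K ℝ.* (K ℝ.* δ ℝ.* g ℝ.+ K ℝ.* δ ℝ.* g))
            ≈⟨ 𝕆.solve 7 (λ δ κ v e w K g →
                  v 𝕆.:* (δ 𝕆.:* κ 𝕆.:* v 𝕆.:* (e 𝕆.:* w) 𝕆.:* K) 𝕆.:+ v 𝕆.:* (e 𝕆.:* K 𝕆.:* (K 𝕆.:* δ 𝕆.:* g 𝕆.:+ K 𝕆.:* δ 𝕆.:* g))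
                  𝕆.:= δ 𝕆.:* κ 𝕆.:* K 𝕆.:* (v 𝕆.:* (v 𝕆.:* e)) 𝕆.:* w 𝕆.:+ δ 𝕆.:* (g 𝕆.:+ g) 𝕆.:* (v 𝕆.:* (e 𝕆.:* K 𝕆.:* K))) ℝ.refl δ κ v e (W n) K g ⟩
          δ ℝ.* κ ℝ.* K ℝ.* (v ℝ.* (v ℝ.* e)) ℝ.* W n ℝ.+ δ ℝ.* (g ℝ.+ g) ℝ.* (v ℝ.* (e ℝ.* K ℝ.* K))
            ≤⟨ 𝕆.+-mono-≤
                 (𝕆.*-mono-≤ (𝕆.0≤* 0≤δκK 0≤vve) (𝕆.*-monoʳ-≤ _ 0≤δκK (ν²ρ^≤ n)) (0≤W n) (W≤K n))
                 (𝕆.*-monoʳ-≤ _ (𝕆.0≤* 0≤δ (𝕆.0≤+ 𝔾.0≤g 𝔾.0≤g)) (νρ^KK≤Br^ n)) ⟩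
          δ ℝ.* κ ℝ.* K ℝ.* (g ℝ.* g ℝ.* r 𝕆.^ n) ℝ.* K ℝ.+ δ ℝ.* (g ℝ.+ g) ℝ.* (B ℝ.* r 𝕆.^ n)
            ≈⟨ 𝕆.solve 5 (λ δ κ K g e → δ 𝕆.:* κ 𝕆.:* K 𝕆.:* (g 𝕆.:* g 𝕆.:* e) 𝕆.:* K 𝕆.:+ δ 𝕆.:* (g 𝕆.:+ g) 𝕆.:* (g 𝕆.:* g 𝕆.:* (K 𝕆.:* K) 𝕆.:* e)
                  𝕆.:= (κ 𝕆.:+ (g 𝕆.:+ g)) 𝕆.:* (g 𝕆.:* g 𝕆.:* (K 𝕆.:* K)) 𝕆.:* δ 𝕆.:* e) ℝ.refl δ κ K g (r 𝕆.^ n) ⟩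
          C ℝ.* δ ·r^ n ∎))
      where
      open 𝕆.≤-Reasoning
      v e : ℝ.Carrier
      v = ν n
      e = ρ 𝕆.^ n
      0≤δ : ℝ.0# ≤ δ
      0≤δ = ⊑⇒0≤ x⊑δ
      0≤δκK : ℝ.0# ≤ δ ℝ.* κ ℝ.* K
      0≤δκK = 𝕆.0≤* (𝕆.0≤* 0≤δ 0≤κ) 0≤K
      0≤vve : ℝ.0# ≤ v ℝ.* (v ℝ.* e)
      0≤vve = 𝕆.0≤* (0≤ν n) (𝕆.0≤* (0≤ν n) (0≤ρ^ n))

    -- The differences of the partial sums converge with the explicit error C δ g rⁿ. At n = 0 the
    -- partial sums are empty, so there the error is, up to sign, the limit itself.
    T-T0⊑ : ∀ w x y {δ} → pt x ⊑ δ → T w x y - T w 0ᴰ y ⊑ C ℝ.* g ℝ.* δ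
    T-T0⊑ w x y {δ} x⊑δ = ⊑-resp
      (trans (-‿cong (+-congˡ (-‿cong (⇝-unique f⇝l (⇝-- (partial⇝T w x y) (partial⇝T w 0ᴰ y))))))
        (solve 1 (λ t → :- ((con (+ 0) :- con (+ 0)) :- t) := t) refl (T w x y - T w 0ᴰ y)))
      (⊑-neg (⊑-cong (𝕆.solve 3 (λ C g δ → C 𝕆.:* δ 𝕆.:* g 𝕆.:* 𝕆.con (+ 1) 𝕆.:= C 𝕆.:* g 𝕆.:* δ) ℝ.refl C g δ) (f-l⊑ 0)))
      where
      f : ℕ → Carrier
      f n = partial w x y n - partial w 0ᴰ y n
      lim : ∃[ l ] (∀ n → f n - l ⊑ C ℝ.* δ ℝ.* g ·r^ n)
      lim = limit-of-increments {f} (𝕆.0≤* 0≤C (⊑⇒0≤ x⊑δ)) λ n → ⊑-resp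
        (trans (sym (+-cong (partial-increment w x y n) (-‿cong (partial-increment w 0ᴰ y n))))
          (solve 4 (λ s s₁ t t₁ → (s₁ :- s) :- (t₁ :- t) := (s₁ :- t₁) :- (s :- t)) refl
            (partial w x y n) (partial w x y (suc n)) (partial w 0ᴰ y n) (partial w 0ᴰ y (suc n))))
        (term-term0⊑ w x y x⊑δ n)
      f-l⊑ : ∀ n → f n - proj₁ lim ⊑ C ℝ.* δ ℝ.* g ·r^ n
      f-l⊑ = proj₂ lim
      f⇝l : f ⇝ proj₁ lim
      f⇝l = geometrically (𝕆.0≤* (𝕆.0≤* 0≤C (⊑⇒0≤ x⊑δ)) 𝔾.0≤g) f-l⊑

-- Infinite products, vanishing of `U`, and evaluation of `S`.

module ProductFormula {c ℓ₁ ℓ₂ ℓ₃ a ℓ ℓ′} {R : Reals c ℓ₁ ℓ₂ ℓ₃} (A : NormedRing R a ℓ ℓ′)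
  {r : Reals.Carrier R} (0<r : Reals._<_ R (Reals.0# R) r) (r<1 : Reals._<_ R r (Reals.1# R))
  {q : NormedRing.Carrier A} (q⊑ρ : NormedRing._⊑_ A q (RealOrder._⁴ R r)) where
  private module ℝ = Reals R
  open BilateralSeries A 0<r r<1 q⊑ρ public
  open 𝕆 using (_≤_; ν)
  open 𝔾 using (g)
  open NormedRing A
  open ℤ-Solver commutativeRing
  open Algebra.Properties.Semiring.Mult semiring using () renaming (_×_ to _·_)
  open Algebra.Properties.Semiring.Exp semiring using (_^_)
  open Relation.Binary.Reasoning.Setoid setoid

  opaque
    increments⇒⇝ : ∀ {f : ℕ → Carrier} {B} → ℝ.0# ≤ B → (∀ n → f (suc n) - f n ⊑ B ·r^ n) → ∃[ l ] f ⇝ l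
    increments⇒⇝ {f} 0≤B f′⊑ =
      let l , f-l⊑ = limit-of-increments {f} 0≤B f′⊑ in l , geometrically (𝕆.0≤* 0≤B 𝔾.0≤g) f-l⊑

    ⇝-suc : ∀ {f l} → f ⇝ l → (λ n → f (suc n)) ⇝ l
    ⇝-suc (geometrically 0≤D p) = geometrically 0≤D λ n →
      ⊑-mono (p (suc n)) (𝕆.*-monoʳ-≤ _ 0≤D (𝕆.^-antiʳ-≤ 𝔾.0≤r 𝔾.r≤1 (ℕₚ.n≤1+n n)))

  private opaque
    Q-limit : ∀ x → ∃[ l ] Q (pt x) ⇝ l
    Q-limit x = increments⇒⇝ 0≤K λ n → ⊑-resp
      (solve 2 (λ u z → u :* :- z := u :* (con (+ 1) :- z) :- u) refl (Q (pt x) n) (pt x * q ^ n))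
      (⊑-* (Q⊑K x n) (⊑-neg (⊑-mono (xq^n⊑ x n) (𝕆.^-antiʳ-≤ 𝔾.0≤r 𝔾.r≤1 (ℕₚ.n≤1+n n)))))

    R⁻-limit : ∀ x → ∃[ l ] R⁻ x ⇝ l
    R⁻-limit x = increments⇒⇝ (𝕆.0≤* 0≤K 0≤ρ) (R⁻-increment⊑ x (pt⊑ x))

  Q∞ : Disc → Carrier
  Q∞ x = proj₁ (Q-limit x)

  opaque
    Q⇝Q∞ : ∀ x → Q (pt x) ⇝ Q∞ x
    Q⇝Q∞ x = proj₂ (Q-limit x)

    -- The inverse is the limit of 1/(x;q)ₙ, so no lower bound for the infinite product has to be
    -- found.
    Q∞-invertible : ∀ x → ∃[ u ] u * Q∞ x ≈ 1#
    Q∞-invertible x = let u , R⁻⇝u = R⁻-limit x in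
      u , ⇝-unique (⇝-cong (R⁻-inverse x) (⇝-* R⁻⇝u (Q⇝Q∞ x))) (⇝-const 1#)

    invertible-cancel : ∀ {x y z} → ∃[ u ] u * z ≈ 1# → z * x ≈ z * y → x ≈ y
    invertible-cancel {x} {y} {z} (u , uz≈1) zx≈zy = begin
      x              ≈⟨ *-identityˡ x ⟨
      1# * x         ≈⟨ *-congʳ uz≈1 ⟨
      u * z * x      ≈⟨ *-assoc u z x ⟩
      u * (z * x)    ≈⟨ *-congˡ zx≈zy ⟩
      u * (z * y)    ≈⟨ *-assoc u z y ⟨
      u * z * y      ≈⟨ *-congʳ uz≈1 ⟩
      1# * y         ≈⟨ *-identityˡ y ⟩
      y              ∎

    Q∞-cancel : ∀ x {y z} → Q∞ x * y ≈ Q∞ x * z → y ≈ z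
    Q∞-cancel x = invertible-cancel (Q∞-invertible x)

    Q∞-≈0 : ∀ x → pt x ≈ 0# → Q∞ x ≈ 1#
    Q∞-≈0 x x≈0 = ⇝-unique (Q⇝Q∞ x) (⇝-cong (λ n → sym (Q≈1 n)) (⇝-const 1#))
      where
      Q≈1 : ∀ n → Q (pt x) n ≈ 1#
      Q≈1 zero    = refl
      Q≈1 (suc n) = begin
        Q (pt x) n * (1# - pt x * q ^ n)  ≈⟨ *-cong (Q≈1 n) (+-congˡ (-‿cong (*-congʳ x≈0))) ⟩
        1# * (1# - 0# * q ^ n)            ≈⟨ solve 1 (λ z → con (+ 1) :* (con (+ 1) :- con (+ 0) :* z) := con (+ 1)) refl (q ^ n) ⟩
        1#                                ∎

    Q∞-front : ∀ x → Q∞ x ≈ (1# - pt x) * Q∞ (x *ᴰ qᴰ)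
    Q∞-front x = ⇝-unique (⇝-suc (Q⇝Q∞ x))
      (⇝-cong (λ n → sym (Q-front (pt x) n)) (⇝-* (⇝-const (1# - pt x)) (Q⇝Q∞ (x *ᴰ qᴰ))))

  infixl 7 _*q^_
  _*q^_ : Disc → ℕ → Disc
  x *q^ zero  = x
  x *q^ suc n = x *ᴰ qᴰ *q^ n

  opaque
    *q^⊑ : ∀ x {s} → pt x ⊑ s → ∀ n → pt (x *q^ n) ⊑ s ·r^ n
    *q^⊑ x x⊑s zero    = ⊑-cong (ℝ.sym (ℝ.*-identityʳ _)) x⊑s
    *q^⊑ x x⊑s (suc n) = ⊑-cong (ℝ.*-assoc _ _ _) (*q^⊑ (x *ᴰ qᴰ) (⊑-* x⊑s (⊑-mono q⊑ρ ρ≤r)) n)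

    *q^⊑r^ : ∀ x n → pt (x *q^ n) ⊑ r 𝕆.^ n
    *q^⊑r^ x n = ⊑-cong (ℝ.*-identityˡ _) (*q^⊑ x (⊑-mono (pt⊑ x) (𝕆.<⇒≤ ρ<1)) n)

    -- n steps give (xb;q)ₙ F(x qⁿ) = (x;q)ₙ² F(x). The Lipschitz bound, applied with δ = rⁿ, turns
    -- F(x qⁿ) into F(0) in the limit.
    iterate : ∀ (F : Disc → Carrier) (b : Disc) {D} → ℝ.0# ≤ D →
      (∀ x {δ} → pt x ⊑ δ → F x - F 0ᴰ ⊑ D ℝ.* δ) →
      (∀ x → (1# - pt x * pt b) * F (x *ᴰ qᴰ) ≈ (1# - pt x) * (1# - pt x) * F x) →
      ∀ x → Q∞ (x *ᴰ b) * F 0ᴰ ≈ Q∞ x * Q∞ x * F x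
    iterate F b {D} 0≤D continuous step x = ⇝-unique
      (⇝-* (Q⇝Q∞ (x *ᴰ b)) (geometrically 0≤D λ n → continuous (x *q^ n) (*q^⊑r^ x n)))
      (⇝-cong (λ n → sym (iterated x n)) (⇝-* (⇝-* (Q⇝Q∞ x) (Q⇝Q∞ x)) (⇝-const (F x))))
      where
      iterated : ∀ x n → Q (pt x * pt b) n * F (x *q^ n) ≈ Q (pt x) n * Q (pt x) n * F x
      iterated x zero    = *-congʳ (sym (*-identityˡ 1#))
      iterated x (suc n) = begin
        Q (X * Y) (suc n) * F (xq *q^ n)
          ≈⟨ *-congʳ (trans (Q-front (X * Y) n) (*-congˡ (Q-cong (solve 3 (λ x y q → x :* y :* q := x :* q :* y) refl X Y q) n))) ⟩
        (1# - X * Y) * Q (X * q * Y) n * F (xq *q^ n)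
          ≈⟨ trans (*-assoc _ _ _) (*-congˡ (iterated xq n)) ⟩
        (1# - X * Y) * (Q (X * q) n * Q (X * q) n * F xq)
          ≈⟨ solve 3 (λ d u v → d :* (u :* u :* v) := u :* u :* (d :* v)) refl (1# - X * Y) (Q (X * q) n) (F xq) ⟩
        Q (X * q) n * Q (X * q) n * ((1# - X * Y) * F xq)
          ≈⟨ *-congˡ (step x) ⟩
        Q (X * q) n * Q (X * q) n * ((1# - X) * (1# - X) * F x)
          ≈⟨ solve 3 (λ u e v → u :* u :* (e :* e :* v) := (e :* u) :* (e :* u) :* v) refl (Q (X * q) n) (1# - X) (F x) ⟩
        ((1# - X) * Q (X * q) n) * ((1# - X) * Q (X * q) n) * F x
          ≈⟨ *-congʳ (*-cong (Q-front X n) (Q-front X n)) ⟨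
        Q X (suc n) * Q X (suc n) * F x ∎
        where
        X Y : Carrier
        X = pt x
        Y = pt b
        xq : Disc
        xq = x *ᴰ qᴰ

  private opaque
    n·1⊑ : ∀ n → n · 1# ⊑ n 𝕆.· ℝ.1#
    n·1⊑ zero    = 0⊑0
    n·1⊑ (suc n) = ⊑-+ 1⊑1 (n·1⊑ n)

    n·1⊑ν : ∀ n → n · 1# ⊑ ν n
    n·1⊑ν n = ⊑-mono (n·1⊑ n) (𝕆.y≈x+z⇒x≤y 𝕆.0≤1 (ℝ.+-comm ℝ.1# (n 𝕆.· ℝ.1#)))

  -- The weights w n = 1, n and n + 1. As β n = - w (- n - 1), the last two have their α and β
  -- interchanged; `nʷ` yields exactly the coefficients n and n + 1 of the theorem.
  𝟙ʷ nʷ 1+nʷ : Weight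
  𝟙ʷ = record
    { α = λ _ → 1# ; β = λ _ → - 1#
    ; α⊑ = λ n → ⊑-mono 1⊑1 (𝕆.1≤ν n) ; β⊑ = λ n → ⊑-neg (⊑-mono 1⊑1 (𝕆.1≤ν n)) }
  nʷ = record { α = λ n → n · 1# ; β = λ n → suc n · 1# ; α⊑ = n·1⊑ν ; β⊑ = λ n → n·1⊑ (suc n) }
  1+nʷ = record { α = λ n → suc n · 1# ; β = λ n → n · 1# ; α⊑ = λ n → n·1⊑ (suc n) ; β⊑ = n·1⊑ν }

  U S : Disc → Disc → Carrier
  U = T 𝟙ʷ
  S = T nʷ

  private opaque
    𝟙ʷ-shift : Shift 𝟙ʷ 𝟙ʷ
    𝟙ʷ-shift = record { α-shift = λ _ → refl ; β-shift = λ _ → refl ; 0-shift = refl }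

    nʷ-shift : Shift nʷ 1+nʷ
    nʷ-shift = record { α-shift = λ _ → refl ; β-shift = λ _ → refl
      ; 0-shift = solve 0 (con (+ 0) := :- con (+ 0)) refl }

    -- The reflection n ↦ - n - 1 turns the weight n + 1 into - n and u(x,y) into - u(y,x). Together
    -- with `T1+n≈S+U` this makes `U` the defect of symmetry of `S`.
    T1+n-swap : ∀ x y → T 1+nʷ x y ≈ S y x
    T1+n-swap x y = ⇝-unique (partial⇝T 1+nʷ x y) (⇝-cong eq (partial⇝T nʷ y x))
      where
      eq : ∀ N → partial nʷ y x N ≈ partial 1+nʷ x y N
      eq zero    = refl
      eq (suc N) = +-cong (eq N) (+-comm _ _)

    T1+n≈S+U : ∀ x y → T 1+nʷ x y ≈ S x y + U x y
    T1+n≈S+U x y = ⇝-unique (partial⇝T 1+nʷ x y) (⇝-cong eq (⇝-+ (partial⇝T nʷ x y) (partial⇝T 𝟙ʷ x y)))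
      where
      eq : ∀ N → partial nʷ x y N + partial 𝟙ʷ x y N ≈ partial 1+nʷ x y N
      eq zero    = +-identityʳ 0#
      eq (suc N) = begin
        (partial nʷ x y N + term nʷ x y N) + (partial 𝟙ʷ x y N + term 𝟙ʷ x y N)
          ≈⟨ solve 5 (λ s u n v w → (s :+ (n :* v :+ (con (+ 1) :+ n) :* w)) :+ (u :+ (con (+ 1) :* v :+ :- con (+ 1) :* w))
               := (s :+ u) :+ ((con (+ 1) :+ n) :* v :+ n :* w)) refl
               (partial nʷ x y N) (partial 𝟙ʷ x y N) (N · 1#) (p x y N) (p y x N) ⟩
        (partial nʷ x y N + partial 𝟙ʷ x y N) + term 1+nʷ x y N
          ≈⟨ +-congʳ (eq N) ⟩
        partial 1+nʷ x y N + term 1+nʷ x y N ∎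

    U-swap : ∀ x y → U y x ≈ - U x y
    U-swap x y = ⇝-unique (partial⇝T 𝟙ʷ y x) (⇝-cong eq (⇝-neg (partial⇝T 𝟙ʷ x y)))
      where
      eq : ∀ N → - partial 𝟙ʷ x y N ≈ partial 𝟙ʷ y x N
      eq zero    = solve 0 (:- con (+ 0) := con (+ 0)) refl
      eq (suc N) = begin
        - (partial 𝟙ʷ x y N + term 𝟙ʷ x y N)
          ≈⟨ solve 3 (λ s v w → :- (s :+ (con (+ 1) :* v :+ :- con (+ 1) :* w)) := :- s :+ (con (+ 1) :* w :+ :- con (+ 1) :* v)) refl
               (partial 𝟙ʷ x y N) (p x y N) (p y x N) ⟩
        - partial 𝟙ʷ x y N + term 𝟙ʷ y x N
          ≈⟨ +-congʳ (eq N) ⟩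
        partial 𝟙ʷ y x N + term 𝟙ʷ y x N ∎

    -- For equal arguments the summands at n and - n - 1 cancel, so every partial sum vanishes.
    -- Antisymmetry alone would give U = - U and require a division by 2.
    U00≈0 : U 0ᴰ 0ᴰ ≈ 0#
    U00≈0 = ⇝-unique (partial⇝T 𝟙ʷ 0ᴰ 0ᴰ) (⇝-cong eq (⇝-const 0#))
      where
      eq : ∀ N → 0# ≈ partial 𝟙ʷ 0ᴰ 0ᴰ N
      eq zero    = refl
      eq (suc N) = begin
        0#                                          ≈⟨ solve 1 (λ v → con (+ 0) := con (+ 0) :+ (con (+ 1) :* v :+ :- con (+ 1) :* v)) refl (p 0ᴰ 0ᴰ N) ⟩
        0# + term 𝟙ʷ 0ᴰ 0ᴰ N                        ≈⟨ +-congʳ (eq N) ⟩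
        partial 𝟙ʷ 0ᴰ 0ᴰ N + term 𝟙ʷ 0ᴰ 0ᴰ N        ∎

    iterate-T : ∀ w (b : Disc) →
      (∀ x → (1# - pt x * pt b) * T w (x *ᴰ qᴰ) b ≈ (1# - pt x) * (1# - pt x) * T w x b) →
      ∀ x → Q∞ (x *ᴰ b) * T w 0ᴰ b ≈ Q∞ x * Q∞ x * T w x b
    iterate-T w b = iterate (λ x → T w x b) b (𝕆.0≤* 0≤C 𝔾.0≤g) (λ x → T-T0⊑ w x b)

    U-iterated : ∀ x b → Q∞ (x *ᴰ b) * U 0ᴰ b ≈ Q∞ x * Q∞ x * U x b
    U-iterated x b = iterate-T 𝟙ʷ b (λ x → trans (T-shift 𝟙ʷ-shift x b)
      (solve 2 (λ x u → (con (+ 1) :- x) :* (u :- x :* u) := (con (+ 1) :- x) :* (con (+ 1) :- x) :* u) refl (pt x) (U x b))) x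

    U0≈0⇒U≈0 : ∀ x b → U 0ᴰ b ≈ 0# → U x b ≈ 0#
    U0≈0⇒U≈0 x b U0b≈0 = Q∞-cancel x (Q∞-cancel x (begin
      Q∞ x * (Q∞ x * U x b)     ≈⟨ *-assoc _ _ _ ⟨
      Q∞ x * Q∞ x * U x b       ≈⟨ U-iterated x b ⟨
      Q∞ (x *ᴰ b) * U 0ᴰ b      ≈⟨ *-congˡ U0b≈0 ⟩
      Q∞ (x *ᴰ b) * 0#          ≈⟨ solve 2 (λ u v → u :* con (+ 0) := v :* (v :* con (+ 0))) refl (Q∞ (x *ᴰ b)) (Q∞ x) ⟩
      Q∞ x * (Q∞ x * 0#)        ∎))

    U≈0 : ∀ x y → U x y ≈ 0#
    U≈0 x y = U0≈0⇒U≈0 x y (begin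
      U 0ᴰ y      ≈⟨ U-swap y 0ᴰ ⟩
      - U y 0ᴰ    ≈⟨ -‿cong (U0≈0⇒U≈0 y 0ᴰ U00≈0) ⟩
      - 0#        ≈⟨ solve 0 (:- con (+ 0) := con (+ 0)) refl ⟩
      0#          ∎)

    T1+n≈S : ∀ x y → T 1+nʷ x y ≈ S x y
    T1+n≈S x y = trans (T1+n≈S+U x y) (trans (+-congˡ (U≈0 x y)) (+-identityʳ _))

    S-swap : ∀ x y → S y x ≈ S x y
    S-swap x y = trans (sym (T1+n-swap x y)) (T1+n≈S x y)

    S-iterated : ∀ x b → Q∞ (x *ᴰ b) * S 0ᴰ b ≈ Q∞ x * Q∞ x * S x b
    S-iterated x b = iterate-T nʷ b (λ x → begin
      (1# - pt x * pt b) * S (x *ᴰ qᴰ) b            ≈⟨ T-shift nʷ-shift x b ⟩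
      (1# - pt x) * (S x b - pt x * T 1+nʷ x b)     ≈⟨ *-congˡ (+-congˡ (-‿cong (*-congˡ (T1+n≈S x b)))) ⟩
      (1# - pt x) * (S x b - pt x * S x b)          ≈⟨ solve 2 (λ x u → (con (+ 1) :- x) :* (u :- x :* u) := (con (+ 1) :- x) :* (con (+ 1) :- x) :* u) refl (pt x) (S x b) ⟩
      (1# - pt x) * (1# - pt x) * S x b             ∎) x

    S-product-up-to-S00 : ∀ x y → Q∞ x * Q∞ x * (Q∞ y * Q∞ y) * S x y ≈ Q∞ (x *ᴰ y) * S 0ᴰ 0ᴰ
    S-product-up-to-S00 x y = begin
      X * X * (Y * Y) * S x y                     ≈⟨ solve 3 (λ x y s → x :* x :* (y :* y) :* s := y :* y :* (x :* x :* s)) refl X Y (S x y) ⟩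
      Y * Y * (X * X * S x y)                     ≈⟨ *-congˡ (S-iterated x y) ⟨
      Y * Y * (Q∞ (x *ᴰ y) * S 0ᴰ y)              ≈⟨ solve 3 (λ y u s → y :* y :* (u :* s) := u :* (y :* y :* s)) refl Y (Q∞ (x *ᴰ y)) (S 0ᴰ y) ⟩
      Q∞ (x *ᴰ y) * (Y * Y * S 0ᴰ y)              ≈⟨ *-congˡ (*-congˡ (S-swap 0ᴰ y)) ⟨
      Q∞ (x *ᴰ y) * (Y * Y * S y 0ᴰ)              ≈⟨ *-congˡ (S-iterated y 0ᴰ) ⟨
      Q∞ (x *ᴰ y) * (Q∞ (y *ᴰ 0ᴰ) * S 0ᴰ 0ᴰ)      ≈⟨ *-congˡ (*-congʳ (Q∞-≈0 (y *ᴰ 0ᴰ) (zeroʳ (pt y)))) ⟩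
      Q∞ (x *ᴰ y) * (1# * S 0ᴰ 0ᴰ)                ≈⟨ *-congˡ (*-identityˡ _) ⟩
      Q∞ (x *ᴰ y) * S 0ᴰ 0ᴰ                       ∎
      where
      X Y : Carrier
      X = Q∞ x
      Y = Q∞ y

    Pq≈0 : ∀ n → P q (suc n) ≈ 0#
    Pq≈0 zero    = solve 1 (λ q → con (+ 1) :* (q :- q :* con (+ 1)) := con (+ 0)) refl q
    Pq≈0 (suc n) = trans (*-congʳ (Pq≈0 n)) (zeroˡ _)

    Sqq≈ : S qᴰ qᴰ ≈ R⁻ qᴰ 1
    -- The partial sums are constant from length 1 on, where the weight 1 of the second half
    -- contributes 1/(1 - q); the shift skips the empty sum.
    Sqq≈ = ⇝-unique (⇝-suc (partial⇝T nʷ qᴰ qᴰ)) (⇝-cong eq (⇝-const (R⁻ qᴰ 1)))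
      where
      eq : ∀ N → R⁻ qᴰ 1 ≈ partial nʷ qᴰ qᴰ (suc N)
      eq zero = solve 1 (λ u → u := con (+ 0) :+ (con (+ 0) :* (con (+ 1) :* u) :+ (con (+ 1) :+ con (+ 0)) :* (con (+ 1) :* u))) refl (R⁻ qᴰ 1)
      eq (suc N) = begin
        R⁻ qᴰ 1                                                 ≈⟨ solve 4 (λ u v α β → u := u :+ (α :* (con (+ 0) :* v) :+ β :* (con (+ 0) :* v))) refl
                                                                     (R⁻ qᴰ 1) (R⁻ qᴰ (suc (suc N))) (suc N · 1#) (suc (suc N) · 1#) ⟩
        R⁻ qᴰ 1 + (suc N · 1# * (0# * v) + suc (suc N) · 1# * (0# * v))
          ≈⟨ +-cong (eq N) (+-cong (*-congˡ (*-congʳ (sym (Pq≈0 N)))) (*-congˡ (*-congʳ (sym (Pq≈0 N))))) ⟩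
        partial nʷ qᴰ qᴰ (suc N) + term nʷ qᴰ qᴰ (suc N)        ∎
        where
        v : Carrier
        v = R⁻ qᴰ (suc (suc N))

    -- Jacobi's identity for (q;q)∞³, read off from x = y = q, where S has a single nonzero term.
    S00≈Q∞q³ : S 0ᴰ 0ᴰ ≈ Q∞ qᴰ * (Q∞ qᴰ * Q∞ qᴰ)
    S00≈Q∞q³ = Q∞-cancel qᴰ (begin
      Z * S 0ᴰ 0ᴰ                                            ≈⟨ *-congʳ (Q∞-front qᴰ) ⟩
      (1# - q) * Q∞ (qᴰ *ᴰ qᴰ) * S 0ᴰ 0ᴰ                     ≈⟨ *-assoc _ _ _ ⟩
      (1# - q) * (Q∞ (qᴰ *ᴰ qᴰ) * S 0ᴰ 0ᴰ)                   ≈⟨ *-congˡ (S-product-up-to-S00 qᴰ qᴰ) ⟨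
      (1# - q) * (Z * Z * (Z * Z) * S qᴰ qᴰ)                 ≈⟨ *-congˡ (*-congˡ Sqq≈) ⟩
      (1# - q) * (Z * Z * (Z * Z) * R⁻ qᴰ 1)                 ≈⟨ solve 3 (λ q z u → (con (+ 1) :- q) :* (z :* z :* (z :* z) :* u)
                                                                  := z :* (z :* (z :* z)) :* (u :* (con (+ 1) :- q :* con (+ 1)))) refl q Z (R⁻ qᴰ 1) ⟩
      Z * (Z * (Z * Z)) * (R⁻ qᴰ 1 * (1# - q * 1#))          ≈⟨ *-congˡ (R⁻-snoc qᴰ 0) ⟩
      Z * (Z * (Z * Z)) * 1#                                 ≈⟨ *-identityʳ _ ⟩
      Z * (Z * (Z * Z))                                      ∎)
      where
      Z : Carrier
      Z = Q∞ qᴰ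

  opaque
    S-product : ∀ x y → (Q∞ x ^ 2 * Q∞ y ^ 2) * S x y ≈ Q∞ qᴰ ^ 3 * Q∞ (x *ᴰ y)
    S-product x y = begin
      (Q∞ x ^ 2 * Q∞ y ^ 2) * S x y                  ≈⟨ solve 3 (λ x y s → (x :* (x :* con (+ 1)) :* (y :* (y :* con (+ 1)))) :* s := x :* x :* (y :* y) :* s) refl (Q∞ x) (Q∞ y) (S x y) ⟩
      Q∞ x * Q∞ x * (Q∞ y * Q∞ y) * S x y            ≈⟨ S-product-up-to-S00 x y ⟩
      Q∞ (x *ᴰ y) * S 0ᴰ 0ᴰ                          ≈⟨ *-congˡ S00≈Q∞q³ ⟩
      Q∞ (x *ᴰ y) * (Z * (Z * Z))                    ≈⟨ solve 2 (λ u z → u :* (z :* (z :* z)) := z :* (z :* (z :* con (+ 1))) :* u) refl (Q∞ (x *ᴰ y)) Z ⟩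
      Q∞ qᴰ ^ 3 * Q∞ (x *ᴰ y)                        ∎
      where
      Z : Carrier
      Z = Q∞ qᴰ

    -- Each factor of (q/x;q)ₙ takes one x from xⁿ: x (1 - q x⁻¹ qʲ) = x - qʲ⁺¹.
    Q[q/x]x^≈P : ∀ {x x⁻¹} → x⁻¹ * x ≈ 1# → ∀ n → Q (q * x⁻¹) n * x ^ n ≈ P x n
    Q[q/x]x^≈P x⁻¹x≈1 zero    = *-identityˡ 1#
    Q[q/x]x^≈P {x} {x⁻¹} x⁻¹x≈1 (suc n) = begin
      Q (q * x⁻¹) n * (1# - q * x⁻¹ * q ^ n) * (x * x ^ n)
        ≈⟨ solve 6 (λ u q y z x e → u :* (con (+ 1) :- q :* y :* z) :* (x :* e) := u :* e :* (x :- y :* x :* (q :* z))) refl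
             (Q (q * x⁻¹) n) q x⁻¹ (q ^ n) x (x ^ n) ⟩
      Q (q * x⁻¹) n * x ^ n * (x - x⁻¹ * x * (q * q ^ n))
        ≈⟨ *-cong (Q[q/x]x^≈P x⁻¹x≈1 n) (+-congˡ (-‿cong (trans (*-congʳ x⁻¹x≈1) (*-identityˡ _)))) ⟩
      P x n * (x - q * q ^ n) ∎

-- The complex numbers as a complete normed ring.

module ComplexNormedRing {c ℓ₁ ℓ₂ ℓ₃} (R : Reals c ℓ₁ ℓ₂ ℓ₃) where
  private
    module ℝ = Reals R
    module 𝕆 = RealOrder R
  open 𝕆 using (_≤_; module ≤-Reasoning)
  open 𝕆 using (solve; con; _:+_; _:*_; _:-_; :-_; _:=_)
  open ℝ using (0#; 1#; _<_) renaming (Carrier to ℝ)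
  open Complex R

  infix 4 _≋_
  -- The equality of `rawRing` repackaged as a record, so that z and w remain visible in the type
  -- and can be inferred.
  record _≋_ (z w : ℂ) : Set ℓ₁ where
    constructor _+i_
    field
      re-≈ : re z ℝ.≈ re w
      im-≈ : im z ℝ.≈ im w
  open _≋_ public

  ℂ-commutativeRing : CommutativeRing c ℓ₁
  ℂ-commutativeRing = record
    { Carrier = ℂ ; _≈_ = _≋_ ; _+_ = _+_ ; _*_ = _*_ ; -_ = -_ ; 0# = 0ℂ ; 1# = 1ℂ
    ; isCommutativeRing = record
      { isRing = record
        { +-isAbelianGroup = record
          { isGroup = record
            { isMonoid = record
              { isSemigroup = record
                { isMagma = record
                  { isEquivalence = record
                    { refl  = ℝ.refl +i ℝ.refl
                    ; sym   = λ p → ℝ.sym (re-≈ p) +i ℝ.sym (im-≈ p)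
                    ; trans = λ p q → ℝ.trans (re-≈ p) (re-≈ q) +i ℝ.trans (im-≈ p) (im-≈ q) }
                  ; ∙-cong = λ p q → ℝ.+-cong (re-≈ p) (re-≈ q) +i ℝ.+-cong (im-≈ p) (im-≈ q) }
                ; assoc = λ x y z → ℝ.+-assoc _ _ _ +i ℝ.+-assoc _ _ _ }
              ; identity = (λ x → ℝ.+-identityˡ _ +i ℝ.+-identityˡ _) , (λ x → ℝ.+-identityʳ _ +i ℝ.+-identityʳ _) }
            ; inverse = (λ x → ℝ.-‿inverseˡ _ +i ℝ.-‿inverseˡ _) , (λ x → ℝ.-‿inverseʳ _ +i ℝ.-‿inverseʳ _)
            ; ⁻¹-cong = λ p → ℝ.-‿cong (re-≈ p) +i ℝ.-‿cong (im-≈ p) }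
          ; comm = λ x y → ℝ.+-comm _ _ +i ℝ.+-comm _ _ }
        ; *-cong = *-cong
        ; *-assoc = *-assoc
        ; *-identity = (λ x → trans (*-comm 1ℂ x) (*-identityʳ x)) , *-identityʳ
        ; distrib = distribˡ , (λ x y z → trans (*-comm (y + z) x) (trans (distribˡ x y z) (+-cong (*-comm x y) (*-comm x z)))) }
      ; *-comm = *-comm } }
    where
    trans : ∀ {x y z} → x ≋ y → y ≋ z → x ≋ z
    trans p q = ℝ.trans (re-≈ p) (re-≈ q) +i ℝ.trans (im-≈ p) (im-≈ q)
    +-cong : ∀ {w x y z} → w ≋ x → y ≋ z → (w + y) ≋ (x + z)
    +-cong p q = ℝ.+-cong (re-≈ p) (re-≈ q) +i ℝ.+-cong (im-≈ p) (im-≈ q)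
    *-cong : ∀ {w x y z} → w ≋ x → y ≋ z → (w * y) ≋ (x * z)
    *-cong p q = ℝ.+-cong (ℝ.*-cong (re-≈ p) (re-≈ q)) (ℝ.-‿cong (ℝ.*-cong (im-≈ p) (im-≈ q)))
              +i ℝ.+-cong (ℝ.*-cong (re-≈ p) (im-≈ q)) (ℝ.*-cong (im-≈ p) (re-≈ q))
    *-assoc : ∀ x y z → (x * y * z) ≋ (x * (y * z))
    *-assoc (a +i b) (c +i d) (e +i f) =
      solve 6 (λ a b c d e f → (a :* c :- b :* d) :* e :- (a :* d :+ b :* c) :* f := a :* (c :* e :- d :* f) :- b :* (c :* f :+ d :* e)) ℝ.refl a b c d e f
      +i solve 6 (λ a b c d e f → (a :* c :- b :* d) :* f :+ (a :* d :+ b :* c) :* e := a :* (c :* f :+ d :* e) :+ b :* (c :* e :- d :* f)) ℝ.refl a b c d e f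
    *-comm : ∀ x y → (x * y) ≋ (y * x)
    *-comm (a +i b) (c +i d) =
      solve 4 (λ a b c d → a :* c :- b :* d := c :* a :- d :* b) ℝ.refl a b c d
      +i solve 4 (λ a b c d → a :* d :+ b :* c := c :* b :+ d :* a) ℝ.refl a b c d
    *-identityʳ : ∀ x → (x * 1ℂ) ≋ x
    *-identityʳ (a +i b) =
      solve 2 (λ a b → a :* con (+ 1) :- b :* con (+ 0) := a) ℝ.refl a b
      +i solve 2 (λ a b → a :* con (+ 0) :+ b :* con (+ 1) := b) ℝ.refl a b
    distribˡ : ∀ x y z → (x * (y + z)) ≋ (x * y + x * z)
    distribˡ (a +i b) (c +i d) (e +i f) =
      solve 6 (λ a b c d e f → a :* (c :+ e) :- b :* (d :+ f) := (a :* c :- b :* d) :+ (a :* e :- b :* f)) ℝ.refl a b c d e f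
      +i solve 6 (λ a b c d e f → a :* (d :+ f) :+ b :* (c :+ e) := (a :* d :+ b :* c) :+ (a :* f :+ b :* e)) ℝ.refl a b c d e f

  infix 4 _⊑_
  -- | z | ≤ s without a square root. Squaring forgets the sign of s, hence the first field.
  record _⊑_ (z : ℂ) (s : ℝ) : Set ℓ₃ where
    constructor _∧_
    field
      0≤s     : 0# ≤ s
      ∣z∣²≤s² : ∣ z ∣² ≤ s ℝ.* s
  open _⊑_ public

  opaque
    ∣∣²-cong : ∀ {z w} → z ≋ w → ∣ z ∣² ℝ.≈ ∣ w ∣²
    ∣∣²-cong p = ℝ.+-cong (ℝ.*-cong (re-≈ p) (re-≈ p)) (ℝ.*-cong (im-≈ p) (im-≈ p))

    ⊑-resp : ∀ {z w s} → z ≋ w → z ⊑ s → w ⊑ s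
    ⊑-resp z≋w (0≤s ∧ p) = 0≤s ∧ 𝕆.≤-trans (𝕆.≤-reflexive (ℝ.sym (∣∣²-cong z≋w))) p

    ⊑-mono : ∀ {z s t} → z ⊑ s → s ≤ t → z ⊑ t
    ⊑-mono (0≤s ∧ p) s≤t = 𝕆.≤-trans 0≤s s≤t ∧ 𝕆.≤-trans p (𝕆.x²-mono-≤ 0≤s s≤t)

    re²≤∣∣² : ∀ z → re z ℝ.* re z ≤ ∣ z ∣²
    re²≤∣∣² z = 𝕆.y≈x+z⇒x≤y (𝕆.0≤x² (im z)) ℝ.refl

    im²≤∣∣² : ∀ z → im z ℝ.* im z ≤ ∣ z ∣²
    im²≤∣∣² z = 𝕆.y≈x+z⇒x≤y (𝕆.0≤x² (re z)) (ℝ.+-comm _ _)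

    re≤ : ∀ {z s} → z ⊑ s → re z ≤ s
    re≤ {z} (0≤s ∧ p) = 𝕆.x²≤y²⇒x≤y 0≤s (𝕆.≤-trans (re²≤∣∣² z) p)

    im≤ : ∀ {z s} → z ⊑ s → im z ≤ s
    im≤ {z} (0≤s ∧ p) = 𝕆.x²≤y²⇒x≤y 0≤s (𝕆.≤-trans (im²≤∣∣² z) p)

    0⊑0 : 0ℂ ⊑ 0#
    0⊑0 = 𝕆.≤-refl ∧ 𝕆.≤-reflexive (solve 0 (con (+ 0) :* con (+ 0) :+ con (+ 0) :* con (+ 0) := con (+ 0) :* con (+ 0)) ℝ.refl)

    1⊑1 : 1ℂ ⊑ 1#
    1⊑1 = 𝕆.0≤1 ∧ 𝕆.≤-reflexive (ℝ.trans ∣1∣²≈1 (ℝ.sym (ℝ.*-identityˡ 1#)))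

    ⊑0⇒≋0 : ∀ {z} → z ⊑ 0# → z ≋ 0ℂ
    ⊑0⇒≋0 {z} (_ ∧ p) = 𝕆.x²≤0⇒x≈0 (𝕆.≤-trans (re²≤∣∣² z) p′) +i 𝕆.x²≤0⇒x≈0 (𝕆.≤-trans (im²≤∣∣² z) p′)
      where
      p′ : ∣ z ∣² ≤ 0#
      p′ = 𝕆.≤-trans p (𝕆.≤-reflexive (ℝ.zeroˡ 0#))

    -- The cross term is bounded by Cauchy–Schwarz, (re z̄w)² + (im z̄w)² = |z|²|w|².
    ⊑-+ : ∀ {z w s t} → z ⊑ s → w ⊑ t → z + w ⊑ s ℝ.+ t
    ⊑-+ {a +i b} {c +i d} {s} {t} (0≤s ∧ p) (0≤t ∧ q) = 𝕆.0≤+ 0≤s 0≤t ∧ (begin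
      (a ℝ.+ c) ℝ.* (a ℝ.+ c) ℝ.+ (b ℝ.+ d) ℝ.* (b ℝ.+ d)
        ≈⟨ solve 4 (λ a b c d → (a :+ c) :* (a :+ c) :+ (b :+ d) :* (b :+ d)
             := ((a :* a :+ b :* b) :+ (c :* c :+ d :* d)) :+ con (+ 2) :* (a :* c :+ b :* d)) ℝ.refl a b c d ⟩
      ((a ℝ.* a ℝ.+ b ℝ.* b) ℝ.+ (c ℝ.* c ℝ.+ d ℝ.* d)) ℝ.+ (1# ℝ.+ 1#) ℝ.* (a ℝ.* c ℝ.+ b ℝ.* d)
        ≤⟨ 𝕆.+-mono-≤ (𝕆.+-mono-≤ p q) (𝕆.*-monoʳ-≤ _ (𝕆.0≤+ 𝕆.0≤1 𝕆.0≤1) cross≤st) ⟩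
      (s ℝ.* s ℝ.+ t ℝ.* t) ℝ.+ (1# ℝ.+ 1#) ℝ.* (s ℝ.* t)
        ≈⟨ solve 2 (λ s t → (s :* s :+ t :* t) :+ con (+ 2) :* (s :* t) := (s :+ t) :* (s :+ t)) ℝ.refl s t ⟩
      (s ℝ.+ t) ℝ.* (s ℝ.+ t) ∎)
      where
      open ≤-Reasoning
      cross≤st : a ℝ.* c ℝ.+ b ℝ.* d ≤ s ℝ.* t
      cross≤st = 𝕆.x²≤y²⇒x≤y (𝕆.0≤* 0≤s 0≤t) (begin
        (a ℝ.* c ℝ.+ b ℝ.* d) ℝ.* (a ℝ.* c ℝ.+ b ℝ.* d)
          ≤⟨ 𝕆.y≈x+z⇒x≤y (𝕆.0≤x² (a ℝ.* d ℝ.- b ℝ.* c))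
               (solve 4 (λ a b c d → (a :* a :+ b :* b) :* (c :* c :+ d :* d)
                 := (a :* c :+ b :* d) :* (a :* c :+ b :* d) :+ (a :* d :- b :* c) :* (a :* d :- b :* c)) ℝ.refl a b c d) ⟩
        (a ℝ.* a ℝ.+ b ℝ.* b) ℝ.* (c ℝ.* c ℝ.+ d ℝ.* d)
          ≤⟨ 𝕆.*-mono-≤ (∣∣²≮0 (a +i b)) p (∣∣²≮0 (c +i d)) q ⟩
        (s ℝ.* s) ℝ.* (t ℝ.* t)
          ≈⟨ solve 2 (λ s t → (s :* s) :* (t :* t) := (s :* t) :* (s :* t)) ℝ.refl s t ⟩
        (s ℝ.* t) ℝ.* (s ℝ.* t) ∎)

    ⊑-* : ∀ {z w s t} → z ⊑ s → w ⊑ t → z * w ⊑ s ℝ.* t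
    ⊑-* {z} {w} {s} {t} (0≤s ∧ p) (0≤t ∧ q) = 𝕆.0≤* 0≤s 0≤t ∧ (begin
      ∣ z * w ∣²                  ≈⟨ ∣zw∣² z w ⟩
      ∣ z ∣² ℝ.* ∣ w ∣²           ≤⟨ 𝕆.*-mono-≤ (∣∣²≮0 z) p (∣∣²≮0 w) q ⟩
      (s ℝ.* s) ℝ.* (t ℝ.* t)     ≈⟨ solve 2 (λ s t → (s :* s) :* (t :* t) := (s :* t) :* (s :* t)) ℝ.refl s t ⟩
      (s ℝ.* t) ℝ.* (s ℝ.* t)     ∎)
      where open ≤-Reasoning

    ⊑-neg : ∀ {z s} → z ⊑ s → - z ⊑ s
    ⊑-neg {a +i b} (0≤s ∧ p) = 0≤s ∧ 𝕆.≤-trans (𝕆.≤-reflexive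
      (solve 2 (λ a b → :- a :* :- a :+ :- b :* :- b := a :* a :+ b :* b) ℝ.refl a b)) p

    bounded : ∀ z → ∃[ s ] z ⊑ s
    -- The modulus itself would need a root; with m = | z |² the bound 1 + m works, as m ≤ (1 + m)².
    bounded z = 1# ℝ.+ ∣ z ∣² , (𝕆.0≤+ 𝕆.0≤1 (∣∣²≮0 z) ∧ 𝕆.y≈x+z⇒x≤y
      (𝕆.0≤+ (𝕆.0≤+ 𝕆.0≤1 (∣∣²≮0 z)) (𝕆.0≤x² ∣ z ∣²))
      (solve 1 (λ m → (con (+ 1) :+ m) :* (con (+ 1) :+ m) := m :+ ((con (+ 1) :+ m) :+ m :* m)) ℝ.refl ∣ z ∣²))

  opaque
    half : ∀ {x} → 0# < x → ∃[ y ] (0# < y × y ℝ.+ y ℝ.≈ x)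
    half {x} 0<x = let h , 0<h , h2≈1 = 𝕆.reciprocal (𝕆.+-pos-nonneg 𝕆.0<1 𝕆.0≤1) in
      h ℝ.* x , ℝ.*-pos 0<h 0<x ,
      ℝ.trans (solve 2 (λ h x → h :* x :+ h :* x := h :* (con (+ 1) :+ con (+ 1)) :* x) ℝ.refl h x)
        (ℝ.trans (ℝ.*-congʳ h2≈1) (ℝ.*-identityˡ x))

    x<x+y : ∀ {x y} → 0# < y → x < x ℝ.+ y
    x<x+y {x} {y} 0<y = ℝ.<-respˡ-≈ (ℝ.+-identityˡ x) (ℝ.<-respʳ-≈ (ℝ.+-comm y x) (ℝ.+-monoˡ-< x 0<y))

    x≤y+ε⇒x≤y : ∀ {x y} → (∀ {ε} → 0# < ε → x ≤ y ℝ.+ ε) → x ≤ y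
    x≤y+ε⇒x≤y {x} {y} x≤y+ε y<x = let ε , 0<ε , 2ε≈ = half (𝕆.x<y⇒0<y-x y<x) in
      x≤y+ε 0<ε (ℝ.<-respʳ-≈ (ℝ.trans (ℝ.+-assoc y ε ε) (ℝ.trans (ℝ.+-congˡ 2ε≈)
        (solve 2 (λ x y → y :+ (x :- y) := x) ℝ.refl x y))) (x<x+y 0<ε))

  opaque
    ⊑-closed : ∀ {z s} → (∀ {ε} → 0# < ε → z ⊑ s ℝ.+ ε) → z ⊑ s
    ⊑-closed {z} {s} z⊑ = 0≤s′ ∧ x≤y+ε⇒x≤y square
      where
      open ≤-Reasoning
      0≤s′ : 0# ≤ s
      0≤s′ = x≤y+ε⇒x≤y λ 0<ε → 0≤s (z⊑ 0<ε)
      square : ∀ {η} → 0# < η → ∣ z ∣² ≤ s ℝ.* s ℝ.+ η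
      square {η} 0<η = go (𝕆.reciprocal 0<d)
        where
        -- With ε = η/d one has ε ≤ 1, hence (s + ε)² ≤ s² + ε (1 + 2s) ≤ s² + ε d = s² + η.
        d : ℝ
        d = (1# ℝ.+ (s ℝ.+ s)) ℝ.+ η
        0<d : 0# < d
        0<d = 𝕆.+-pos-nonneg (𝕆.+-pos-nonneg 𝕆.0<1 (𝕆.0≤+ 0≤s′ 0≤s′)) (𝕆.<⇒≤ 0<η)
        go : ∃[ u ] (0# < u × u ℝ.* d ℝ.≈ 1#) → ∣ z ∣² ≤ s ℝ.* s ℝ.+ η
        go (u , 0<u , ud≈1) = begin
          ∣ z ∣²                                  ≤⟨ ∣z∣²≤s² (z⊑ (ℝ.*-pos 0<η 0<u)) ⟩
          (s ℝ.+ ε) ℝ.* (s ℝ.+ ε)                 ≤⟨ 𝕆.y≈x+z⇒x≤y (𝕆.0≤+ (𝕆.0≤* 0≤ε (𝕆.x≤y⇒0≤y-x ε≤1)) (𝕆.0≤* 0≤ε (𝕆.<⇒≤ 0<η)))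
                                                      (solve 3 (λ s e n → s :* s :+ e :* ((con (+ 1) :+ (s :+ s)) :+ n)
                                                        := (s :+ e) :* (s :+ e) :+ (e :* (con (+ 1) :- e) :+ e :* n)) ℝ.refl s ε η) ⟩
          s ℝ.* s ℝ.+ ε ℝ.* d                     ≈⟨ ℝ.+-congˡ εd≈η ⟩
          s ℝ.* s ℝ.+ η                           ∎
          where
          ε : ℝ
          ε = η ℝ.* u
          0≤ε : 0# ≤ ε
          0≤ε = 𝕆.<⇒≤ (ℝ.*-pos 0<η 0<u)
          εd≈η : ε ℝ.* d ℝ.≈ η
          εd≈η = ℝ.trans (ℝ.*-assoc η u d) (ℝ.trans (ℝ.*-congˡ ud≈1) (ℝ.*-identityʳ η))
          ε≤1 : ε ≤ 1#
          ε≤1 = 𝕆.*-cancelʳ-≤ d 0<d (begin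
            ε ℝ.* d    ≈⟨ εd≈η ⟩
            η          ≤⟨ 𝕆.y≈x+z⇒x≤y (𝕆.0≤+ 𝕆.0≤1 (𝕆.0≤+ 0≤s′ 0≤s′)) (ℝ.+-comm _ _) ⟩
            d          ≈⟨ ℝ.*-identityˡ d ⟨
            1# ℝ.* d   ∎)

    ∣x∣≤e∧∣y∣≤e⇒⊑2e : ∀ {x y e} → 0# ≤ e → x ≤ e → ℝ.- x ≤ e → y ≤ e → ℝ.- y ≤ e → (x +i y) ⊑ e ℝ.+ e
    ∣x∣≤e∧∣y∣≤e⇒⊑2e {x} {y} {e} 0≤e x≤e -x≤e y≤e -y≤e = 𝕆.0≤+ 0≤e 0≤e ∧ (begin
      x ℝ.* x ℝ.+ y ℝ.* y            ≤⟨ 𝕆.+-mono-≤ (sq x≤e -x≤e) (sq y≤e -y≤e) ⟩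
      e ℝ.* e ℝ.+ e ℝ.* e            ≤⟨ 𝕆.y≈x+z⇒x≤y (𝕆.0≤+ (𝕆.0≤x² e) (𝕆.0≤x² e))
                                          (solve 1 (λ e → (e :+ e) :* (e :+ e) := (e :* e :+ e :* e) :+ (e :* e :+ e :* e)) ℝ.refl e) ⟩
      (e ℝ.+ e) ℝ.* (e ℝ.+ e)        ∎)
      where
      open ≤-Reasoning
      sq : ∀ {x} → x ≤ e → ℝ.- x ≤ e → x ℝ.* x ≤ e ℝ.* e
      sq {x} x≤e -x≤e = 𝕆.y≈x+z⇒x≤y (𝕆.0≤* (𝕆.x≤y⇒0≤y-x x≤e) (𝕆.x≤y⇒0≤y-x -x≤e))
        (solve 2 (λ x e → e :* e := x :* x :+ (e :- x) :* (e :- :- x)) ℝ.refl x e)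

    cauchy-component : ∀ (h : ℂ → ℝ) → (∀ {z s} → z ⊑ s → h z ≤ s) → (∀ z w → h (z - w) ℝ.≈ h z ℝ.- h w) →
      ∀ (f : ℕ → ℂ) → (∀ {ε} → 0# < ε → ∃[ N ] (∀ n → N ℕ.≤ n → f n - f N ⊑ ε)) → ℝ.Cauchy (λ n → h (f n))
    cauchy-component h h≤ h-- f cauchy ε 0<ε =
      -- The detour through index N costs ε/4 twice; the remaining ε/2 makes the inequality strict.
      let ε₁ , 0<ε₁ , 2ε₁≈ε = half 0<ε
          ε₂ , 0<ε₂ , 2ε₂≈ε₁ = half 0<ε₁
          N , f⊑ = cauchy 0<ε₂
      in N , λ m n N≤m N≤n → begin-strict
        h (f m)
          ≈⟨ solve 3 (λ x y z → x := (z :+ (x :- y)) :+ (y :- z)) ℝ.refl (h (f m)) (h (f N)) (h (f n)) ⟩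
        (h (f n) ℝ.+ (h (f m) ℝ.- h (f N))) ℝ.+ (h (f N) ℝ.- h (f n))
          ≤⟨ 𝕆.+-mono-≤ (𝕆.+-monoʳ-≤ _ (≤-resp (h-- _ _) (h≤ (f⊑ m N≤m))))
                        (≤-resp (h-- _ _) (h≤ (⊑-resp (neg-minus (f n) (f N)) (⊑-neg (f⊑ n N≤n))))) ⟩
        (h (f n) ℝ.+ ε₂) ℝ.+ ε₂
          ≈⟨ ℝ.trans (ℝ.+-assoc _ _ _) (ℝ.+-congˡ 2ε₂≈ε₁) ⟩
        h (f n) ℝ.+ ε₁
          <⟨ x<x+y 0<ε₁ ⟩
        (h (f n) ℝ.+ ε₁) ℝ.+ ε₁
          ≈⟨ ℝ.trans (ℝ.+-assoc _ _ _) (ℝ.+-congˡ 2ε₁≈ε) ⟩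
        h (f n) ℝ.+ ε ∎
      where
      open ≤-Reasoning
      ≤-resp : ∀ {x y s} → x ℝ.≈ y → x ≤ s → y ≤ s
      ≤-resp x≈y x≤s = 𝕆.≤-trans (𝕆.≤-reflexive (ℝ.sym x≈y)) x≤s
      neg-minus : ∀ z w → - (z - w) ≋ w - z
      neg-minus (a +i b) (c +i d) = solve 2 (λ a c → :- (a :- c) := c :- a) ℝ.refl a c
                                 +i solve 2 (λ a c → :- (a :- c) := c :- a) ℝ.refl b d

    complete : ∀ (f : ℕ → ℂ) → (∀ {ε} → 0# < ε → ∃[ N ] (∀ n → N ℕ.≤ n → f n - f N ⊑ ε)) →
      ∃[ l ] (∀ {ε} → 0# < ε → ∃[ N ] (∀ n → N ℕ.≤ n → f n - l ⊑ ε))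
    complete f cauchy =
      let x , f→x = ℝ.complete (λ n → re (f n)) (cauchy-component re re≤ (λ _ _ → ℝ.refl) f cauchy)
          y , f→y = ℝ.complete (λ n → im (f n)) (cauchy-component im im≤ (λ _ _ → ℝ.refl) f cauchy)
      in (x +i y) , λ 0<ε →
        let e , 0<e , 2e≈ε = half 0<ε
            M , fx = f→x e 0<e
            N , fy = f→y e 0<e
        in M ℕ.⊔ N , λ n M⊔N≤n →
          let f<x+e , x<f+e = fx n (ℕₚ.≤-trans (ℕₚ.m≤m⊔n M N) M⊔N≤n)
              f<y+e , y<f+e = fy n (ℕₚ.≤-trans (ℕₚ.m≤n⊔m M N) M⊔N≤n)
          in ⊑-mono (∣x∣≤e∧∣y∣≤e⇒⊑2e (𝕆.<⇒≤ 0<e) (minus f<x+e) (neg-minus x<f+e) (minus f<y+e) (neg-minus y<f+e))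
                    (𝕆.≤-reflexive 2e≈ε)
      where
      minus : ∀ {u v e} → u < v ℝ.+ e → u ℝ.- v ≤ e
      minus {u} {v} {e} u<v+e = 𝕆.≤-trans (𝕆.+-monoˡ-≤ (ℝ.- v) (𝕆.<⇒≤ u<v+e))
        (𝕆.≤-reflexive (solve 2 (λ v e → (v :+ e) :- v := e) ℝ.refl v e))
      neg-minus : ∀ {u v e} → v < u ℝ.+ e → ℝ.- (u ℝ.- v) ≤ e
      neg-minus {u} {v} p = 𝕆.≤-trans (𝕆.≤-reflexive (solve 2 (λ u v → :- (u :- v) := v :- u) ℝ.refl u v)) (minus p)

  opaque
    *-inv : ∀ z (z≠0 : NonZero z) → inv z z≠0 * z ≋ 1ℂ
    *-inv (a +i b) z≠0 = go (ℝ.#⇒invertible (𝕆.0<x⇒x#0 z≠0))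
      where
      go : ((d , _) : ∃[ d ] (d ℝ.* (∣ a +i b ∣² ℝ.- 0#) ℝ.≈ 1# × (∣ a +i b ∣² ℝ.- 0#) ℝ.* d ℝ.≈ 1#)) →
        ((a ℝ.* d) +i (ℝ.- b ℝ.* d)) * (a +i b) ≋ 1ℂ
      go (d , eq , _) =
        ℝ.trans (solve 3 (λ a b d → a :* d :* a :- :- b :* d :* b := d :* ((a :* a :+ b :* b) :- con (+ 0))) ℝ.refl a b d) eq
        +i solve 3 (λ a b d → a :* d :* b :+ :- b :* d :* a := con (+ 0)) ℝ.refl a b d

    1-z-invertible : ∀ {z s} → z ⊑ s → s < 1# → ∃[ u ] (u * (1ℂ - z)) ≋ 1ℂ
    1-z-invertible {z} {s} (0≤s ∧ p) s<1 = inv (1ℂ - z) 1-z≠0 , *-inv (1ℂ - z) 1-z≠0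
      where
      open ≤-Reasoning
      1-z≠0 : NonZero (1ℂ - z)
      1-z≠0 = 1-z-nonZero {z} (begin-strict
        ∣ z ∣²     ≤⟨ p ⟩
        s ℝ.* s    ≤⟨ 𝕆.*-monoʳ-≤ s 0≤s (𝕆.<⇒≤ s<1) ⟩
        s ℝ.* 1#   ≈⟨ ℝ.*-identityʳ s ⟩
        s          <⟨ s<1 ⟩
        1#         ∎)

    -- | 1 - z | ≥ 1 - re z ≥ 1 - s, so the real part alone gives the lower bound; the estimate is
    -- then carried out on squares.
    u[1-z]⊑⇒u⊑ : ∀ {z u s t w} → z ⊑ s → s < 1# → 1# ≤ w ℝ.* (1# ℝ.- s) → u * (1ℂ - z) ⊑ t → u ⊑ t ℝ.* w
    u[1-z]⊑⇒u⊑ {z} {u} {s} {t} {w} z⊑s s<1 1≤w[1-s] (0≤t ∧ p) = 𝕆.0≤* 0≤t 0≤w ∧ (begin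
      ∣ u ∣²
        ≈⟨ ℝ.trans (ℝ.*-congˡ (ℝ.*-identityˡ 1#)) (ℝ.*-identityʳ _) ⟨
      ∣ u ∣² ℝ.* (1# ℝ.* 1#)
        ≤⟨ 𝕆.*-monoʳ-≤ _ (∣∣²≮0 u) (𝕆.x²-mono-≤ 𝕆.0≤1 1≤w[1-s]) ⟩
      ∣ u ∣² ℝ.* ((w ℝ.* (1# ℝ.- s)) ℝ.* (w ℝ.* (1# ℝ.- s)))
        ≈⟨ solve 3 (λ m w s → m :* ((w :* (con (+ 1) :- s)) :* (w :* (con (+ 1) :- s))) := m :* ((con (+ 1) :- s) :* (con (+ 1) :- s)) :* (w :* w)) ℝ.refl ∣ u ∣² w s ⟩
      ∣ u ∣² ℝ.* ((1# ℝ.- s) ℝ.* (1# ℝ.- s)) ℝ.* (w ℝ.* w)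
        ≤⟨ 𝕆.*-monoˡ-≤ _ (𝕆.0≤x² w) (𝕆.*-monoʳ-≤ _ (∣∣²≮0 u) [1-s]²≤) ⟩
      ∣ u ∣² ℝ.* ∣ 1ℂ - z ∣² ℝ.* (w ℝ.* w)
        ≈⟨ ℝ.*-congʳ (∣zw∣² u (1ℂ - z)) ⟨
      ∣ u * (1ℂ - z) ∣² ℝ.* (w ℝ.* w)
        ≤⟨ 𝕆.*-monoˡ-≤ _ (𝕆.0≤x² w) p ⟩
      t ℝ.* t ℝ.* (w ℝ.* w)
        ≈⟨ solve 2 (λ t w → t :* t :* (w :* w) := (t :* w) :* (t :* w)) ℝ.refl t w ⟩
      (t ℝ.* w) ℝ.* (t ℝ.* w) ∎)
      where
      open ≤-Reasoning
      0<1-s : 0# < 1# ℝ.- s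
      0<1-s = 𝕆.x<y⇒0<y-x s<1
      0≤w : 0# ≤ w
      0≤w = 𝕆.*-cancelʳ-≤ (1# ℝ.- s) 0<1-s (𝕆.≤-trans (𝕆.≤-reflexive (ℝ.zeroˡ _)) (𝕆.≤-trans 𝕆.0≤1 1≤w[1-s]))
      [1-s]²≤ : (1# ℝ.- s) ℝ.* (1# ℝ.- s) ≤ ∣ 1ℂ - z ∣²
      [1-s]²≤ = 𝕆.≤-trans (𝕆.x²-mono-≤ (𝕆.<⇒≤ 0<1-s) (𝕆.y≈x+z⇒x≤y (𝕆.x≤y⇒0≤y-x (re≤ z⊑s))
          (solve 2 (λ x s → con (+ 1) :- x := (con (+ 1) :- s) :+ (s :- x)) ℝ.refl (re z) s)))
        (re²≤∣∣² (1ℂ - z))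

  ℂ-normedRing : NormedRing R c ℓ₁ ℓ₃
  ℂ-normedRing = record
    { commutativeRing = ℂ-commutativeRing
    ; _⊑_ = _⊑_
    ; ⊑-resp = ⊑-resp ; ⊑-mono = ⊑-mono ; ⊑⇒0≤ = 0≤s
    ; 0⊑0 = 0⊑0 ; 1⊑1 = 1⊑1 ; ⊑0⇒≈0 = ⊑0⇒≋0
    ; ⊑-+ = ⊑-+ ; ⊑-* = ⊑-* ; ⊑-neg = ⊑-neg
    ; bounded = bounded ; ⊑-closed = ⊑-closed ; complete = complete
    ; 1-z-invertible = 1-z-invertible
    ; u[1-z]⊑⇒u⊑ = u[1-z]⊑⇒u⊑
    }

-- One disc containing q, a and b.

module CommonRadius {c ℓ₁ ℓ₂ ℓ₃} (R : Reals c ℓ₁ ℓ₂ ℓ₃) where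
  open Reals R
  open RealOrder R

  private opaque
    -- 1 - (1 - x)(1 - y) takes the place of the maximum: it dominates x and y and stays below 1,
    -- without deciding which of them is larger.
    join : ∀ {x y} → 0# ≤ x → x < 1# → 0# ≤ y → y < 1# → ∃[ m ] (0# ≤ m × m < 1# × x ≤ m × y ≤ m)
    join {x} {y} 0≤x x<1 0≤y y<1 = x + (1# - x) * y ,
      0≤+ 0≤x (0≤* 0≤1-x 0≤y) ,
      0<y-x⇒x<y (<-respʳ-≈
        (solve 2 (λ x y → (con (+ 1) :- x) :* (con (+ 1) :- y) := con (+ 1) :- (x :+ (con (+ 1) :- x) :* y)) refl x y)
        (*-pos (x<y⇒0<y-x x<1) (x<y⇒0<y-x y<1))) ,
      y≈x+z⇒x≤y (0≤* 0≤1-x 0≤y) refl ,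
      y≈x+z⇒x≤y (0≤* (<⇒≤ (x<y⇒0<y-x y<1)) 0≤x)
        (solve 2 (λ x y → x :+ (con (+ 1) :- x) :* y := y :+ (con (+ 1) :- y) :* x) refl x y)
      where
      0≤1-x : 0# ≤ 1# - x
      0≤1-x = <⇒≤ (x<y⇒0<y-x x<1)

  opaque
    -- The inputs will be the squared moduli, to be bounded by ρ² = r⁸; three successive upper
    -- bounds for square roots produce r.
    radius : ∀ {x y z} → 0# ≤ x → x < 1# → 0# ≤ y → y < 1# → 0# ≤ z → z < 1# →
      ∃[ r ] (0# < r × r < 1# × x ≤ r ⁴ * r ⁴ × y ≤ r ⁴ * r ⁴ × z ≤ r ⁴ * r ⁴)
    radius 0≤x x<1 0≤y y<1 0≤z z<1 =
      let m , 0≤m , m<1 , x≤m , y≤m = join 0≤x x<1 0≤y y<1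
          n , 0≤n , n<1 , m≤n , z≤k = join 0≤m m<1 0≤z z<1
          s , 0<s , s<1 , n≤s² = x≤√ 0≤n n<1
          t , 0<t , t<1 , s≤t² = x≤√ (<⇒≤ 0<s) s<1
          r , 0<r , r<1 , t≤r² = x≤√ (<⇒≤ 0<t) t<1
          n≤ρ² = ≤-trans n≤s² (x²-mono-≤ (<⇒≤ 0<s) (≤-trans s≤t² (x²-mono-≤ (<⇒≤ 0<t) t≤r²)))
      in r , 0<r , r<1 , ≤-trans x≤m (≤-trans m≤n n≤ρ²) , ≤-trans y≤m (≤-trans m≤n n≤ρ²) , ≤-trans z≤k n≤ρ²

-- Translation into the terms of the statement.

module QIdentity {c ℓ₁ ℓ₂ ℓ₃} (R : Reals c ℓ₁ ℓ₂ ℓ₃) where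
  private module ℝ = Reals R
  open Complex R

  Identity : ∀ {q a b} (∣q∣<1 : ∣ q ∣< ℝ.1#) (a≠0 : NonZero a) (b≠0 : NonZero b) (∣a∣<1 : ∣ a ∣< ℝ.1#) (∣b∣<1 : ∣ b ∣< ℝ.1#) → Set (c ⊔ ℓ₃)
  Identity {q} {a} {b} ∣q∣<1 a≠0 b≠0 ∣a∣<1 ∣b∣<1 =
    ∃[ qq ] ∃[ abq ] ∃[ aq ] ∃[ bq ]
      (⟨ q ﹔ q ⟩∞≔ qq) × (⟨ a * b ﹔ q ⟩∞≔ abq) ×
      (⟨ a ﹔ q ⟩∞≔ aq) × (⟨ b ﹔ q ⟩∞≔ bq) ×
      Σ[ den≠0 ∈ NonZero (aq ^ 2 * bq ^ 2) ]
        SumsTo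
          (λ n →
            (n · (⟨ q / a ⟨ a≠0 ⟩ ﹔ q ⟩ n * a ^ n))
              / (⟨ b ﹔ q ⟩ (suc n)) ⟨ ⟨﹔⟩-nonZero {b} {q} ∣b∣<1 ∣q∣<1 (suc n) ⟩
            + (suc n · (⟨ q / b ⟨ b≠0 ⟩ ﹔ q ⟩ n * b ^ n))
              / (⟨ a ﹔ q ⟩ (suc n)) ⟨ ⟨﹔⟩-nonZero {a} {q} ∣a∣<1 ∣q∣<1 (suc n) ⟩)
          ((qq ^ 3 * abq) / (aq ^ 2 * bq ^ 2) ⟨ den≠0 ⟩)

module Assembly {c ℓ₁ ℓ₂ ℓ₃} (R : Reals c ℓ₁ ℓ₂ ℓ₃)
  {r : Reals.Carrier R} (0<r : Reals._<_ R (Reals.0# R) r) (r<1 : Reals._<_ R r (Reals.1# R))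
  {q a b : Complex.ℂ R} (q⊑ρ : ComplexNormedRing._⊑_ R q (RealOrder._⁴ R r))
  (a⊑ρ : ComplexNormedRing._⊑_ R a (RealOrder._⁴ R r)) (b⊑ρ : ComplexNormedRing._⊑_ R b (RealOrder._⁴ R r)) where
  private module ℝ = Reals R
  open Complex R
  open QIdentity R
  open ComplexNormedRing R using (ℂ-normedRing; _≋_; _∧_; *-inv; ∣∣²-cong)
  open ProductFormula ℂ-normedRing 0<r r<1 q⊑ρ
  open NormedRing ℂ-normedRing using (semiring; *-monoid; +-monoid; *-cong; *-congˡ; *-congʳ; +-cong; *-assoc; *-comm; *-identityˡ; sym; trans; refl; reflexive; setoid)
  open Algebra.Properties.Semiring.Mult semiring using (×-assoc-*; ×-congʳ) renaming (_×_ to _·ᴬ_)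
  open Algebra.Properties.Semiring.Exp semiring using () renaming (_^_ to _^ᴬ_)
  open FoldrProperties *-monoid using () renaming (foldr-cong to foldr-cong*)
  open FoldrProperties +-monoid using (foldr-cong)
  open import Relation.Binary.Reasoning.Setoid setoid

  aᴰ bᴰ : Disc
  aᴰ = a ∈disc a⊑ρ
  bᴰ = b ∈disc b⊑ρ

  opaque
    x<y⇒x²<y² : ∀ {x y} → ℝ.0# 𝕆.≤ x → x ℝ.< y → x ℝ.* x ℝ.< y ℝ.* y
    x<y⇒x²<y² {x} {y} 0≤x x<y = 𝕆.≤-<-trans (𝕆.*-monoʳ-≤ x 0≤x (𝕆.<⇒≤ x<y)) (𝕆.*-monoˡ-< y (𝕆.≤-<-trans 0≤x x<y) x<y)

    ⇝⇒⟶ : ∀ {f l} → f ⇝ l → f ⟶ l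
    ⇝⇒⟶ (geometrically 0≤D f-l⊑) ε 0<ε =
      let N , small = 𝔾.Cr^n-small 0≤D 0<ε
      in N , λ n N≤n → 0<ε ,
        𝕆.≤-<-trans (ComplexNormedRing.∣z∣²≤s² (f-l⊑ n)) (x<y⇒x²<y² (𝕆.0≤* 0≤D (𝔾.0≤r^ n)) (small n N≤n))

    -- Both powers obey the same recursion, but they are taken over different raw structures, which
    -- disagree on the equality.
    ^≡^ : ∀ z n → z ^ᴬ n ≡ z ^ n
    ^≡^ z zero    = ≡.refl
    ^≡^ z (suc n) = ≡.cong (z *_) (^≡^ z n)

    ·≡· : ∀ n z → n ·ᴬ z ≡ n · z
    ·≡· zero    z = ≡.refl
    ·≡· (suc n) z = ≡.cong (λ w → z + w) (·≡· n z)

    Q≈⟨﹔⟩ : ∀ x n → Q x n ≋ ⟨ x ﹔ q ⟩ n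
    Q≈⟨﹔⟩ x n = trans (Q≈product x n) (foldr-cong* n λ j → reflexive (≡.cong (λ z → 1ℂ - x * z) (^≡^ q (toℕ j))))

    ⟨﹔⟩⟶Q∞ : ∀ x → ⟨ pt x ﹔ q ⟩ ⟶ Q∞ x
    ⟨﹔⟩⟶Q∞ x = ⇝⇒⟶ (⇝-cong {Q (pt x)} {⟨ pt x ﹔ q ⟩} (Q≈⟨﹔⟩ (pt x)) (Q⇝Q∞ x))

    -- | u |² | z |² = 1 makes | z |² apart from 0, and a nonnegative real apart from 0 is positive.
    invertible⇒NonZero : ∀ {z} → ∃[ u ] (u * z ≋ 1ℂ) → NonZero z
    invertible⇒NonZero {z} (u , uz≋1) = 𝕆.x#0∧0≤x⇒0<x
      (𝕆.yx#0⇒x#0 (𝕆.0<x⇒x#0 (ℝ.<-respʳ-≈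
        (ℝ.trans (ℝ.sym (ℝ.trans (∣∣²-cong uz≋1) ∣1∣²≈1)) (∣zw∣² u z)) 𝕆.0<1)))
      (∣∣²≮0 z)

    Q∞²-nonZero : ∀ x → NonZero (Q∞ x ^ 2)
    Q∞²-nonZero x = *-nonZero {Q∞ x} Q∞≠0 (*-nonZero {Q∞ x} {1ℂ} Q∞≠0 (ℝ.<-respʳ-≈ (ℝ.sym ∣1∣²≈1) 𝕆.0<1))
      where
      Q∞≠0 : NonZero (Q∞ x)
      Q∞≠0 = invertible⇒NonZero (Q∞-invertible x)

    inv≈R⁻ : ∀ x n (Q≠0 : NonZero (⟨ pt x ﹔ q ⟩ n)) → R⁻ x n ≋ inv (⟨ pt x ﹔ q ⟩ n) Q≠0
    inv≈R⁻ x n Q≠0 = inverse-unique (trans (*-congˡ (sym (Q≈⟨﹔⟩ (pt x) n))) (R⁻-inverse x n)) (*-inv (⟨ pt x ﹔ q ⟩ n) Q≠0)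

    weighted : ∀ k x y (x≠0 : NonZero (pt x)) n (Q≠0 : NonZero (⟨ pt y ﹔ q ⟩ (suc n))) →
      (k ·ᴬ 1ℂ) * p x y n ≋ (k · (⟨ q / pt x ⟨ x≠0 ⟩ ﹔ q ⟩ n * pt x ^ n)) / (⟨ pt y ﹔ q ⟩ (suc n)) ⟨ Q≠0 ⟩
    weighted k x y x≠0 n Q≠0 = begin
      (k ·ᴬ 1ℂ) * (P (pt x) n * R⁻ y (suc n))
        ≈⟨ *-assoc (k ·ᴬ 1ℂ) (P (pt x) n) (R⁻ y (suc n)) ⟨
      (k ·ᴬ 1ℂ) * P (pt x) n * R⁻ y (suc n)
        ≈⟨ *-cong (trans (×-assoc-* k 1ℂ (P (pt x) n)) (×-congʳ k (*-identityˡ (P (pt x) n)))) (inv≈R⁻ y (suc n) Q≠0) ⟩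
      (k ·ᴬ P (pt x) n) * inv (⟨ pt y ﹔ q ⟩ (suc n)) Q≠0
        ≈⟨ *-congʳ (×-congʳ k (trans (sym (Q[q/x]x^≈P (*-inv (pt x) x≠0) n))
             (*-cong (Q≈⟨﹔⟩ (q / pt x ⟨ x≠0 ⟩) n) (reflexive (^≡^ (pt x) n))))) ⟩
      (k ·ᴬ (⟨ q / pt x ⟨ x≠0 ⟩ ﹔ q ⟩ n * pt x ^ n)) * inv (⟨ pt y ﹔ q ⟩ (suc n)) Q≠0
        ≈⟨ *-congʳ (reflexive (·≡· k _)) ⟩
      (k · (⟨ q / pt x ⟨ x≠0 ⟩ ﹔ q ⟩ n * pt x ^ n)) * inv (⟨ pt y ﹔ q ⟩ (suc n)) Q≠0 ∎

    S≈quotient : ∀ x y (den≠0 : NonZero (Q∞ x ^ 2 * Q∞ y ^ 2)) →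
      S x y ≋ (Q∞ qᴰ ^ 3 * Q∞ (x *ᴰ y)) / (Q∞ x ^ 2 * Q∞ y ^ 2) ⟨ den≠0 ⟩
    S≈quotient x y den≠0 = invertible-cancel (d⁻¹ , *-inv d den≠0) (begin
      d * S x y          ≈⟨ S-product x y ⟩
      N                  ≈⟨ *-identityˡ N ⟨
      1ℂ * N             ≈⟨ *-congʳ (*-inv d den≠0) ⟨
      d⁻¹ * d * N        ≈⟨ *-congʳ (*-comm d⁻¹ d) ⟩
      d * d⁻¹ * N        ≈⟨ *-assoc d d⁻¹ N ⟩
      d * (d⁻¹ * N)      ≈⟨ *-congˡ {d} (*-comm d⁻¹ N) ⟩
      d * (N * d⁻¹)      ∎)
      where
      d N d⁻¹ : ℂ
      d = Q∞ x ^ 2 * Q∞ y ^ 2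
      N = Q∞ qᴰ ^ 3 * Q∞ (x *ᴰ y)
      d⁻¹ = inv d den≠0

  identity : (∣q∣<1 : ∣ q ∣< ℝ.1#) (a≠0 : NonZero a) (b≠0 : NonZero b) (∣a∣<1 : ∣ a ∣< ℝ.1#) (∣b∣<1 : ∣ b ∣< ℝ.1#) →
    Identity {q} {a} {b} ∣q∣<1 a≠0 b≠0 ∣a∣<1 ∣b∣<1
  identity ∣q∣<1 a≠0 b≠0 ∣a∣<1 ∣b∣<1 =
    Q∞ qᴰ , Q∞ (aᴰ *ᴰ bᴰ) , Q∞ aᴰ , Q∞ bᴰ ,
    ⟨﹔⟩⟶Q∞ qᴰ , ⟨﹔⟩⟶Q∞ (aᴰ *ᴰ bᴰ) , ⟨﹔⟩⟶Q∞ aᴰ , ⟨﹔⟩⟶Q∞ bᴰ ,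
    den≠0 ,
    ⇝⇒⟶ (⇝-congʳ (S≈quotient aᴰ bᴰ den≠0) (⇝-cong (λ N → trans (partial≈sum nʷ aᴰ bᴰ N) (foldr-cong N λ i →
      +-cong (weighted (toℕ i) aᴰ bᴰ a≠0 (toℕ i) (⟨﹔⟩-nonZero {b} {q} ∣b∣<1 ∣q∣<1 (suc (toℕ i))))
             (weighted (suc (toℕ i)) bᴰ aᴰ b≠0 (toℕ i) (⟨﹔⟩-nonZero {a} {q} ∣a∣<1 ∣q∣<1 (suc (toℕ i)))))) (partial⇝T nʷ aᴰ bᴰ)))
    where
    den≠0 : NonZero (Q∞ aᴰ ^ 2 * Q∞ bᴰ ^ 2)
    den≠0 = *-nonZero {Q∞ aᴰ ^ 2} (Q∞²-nonZero aᴰ) (Q∞²-nonZero bᴰ)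

module _ {c ℓ₁ ℓ₂ ℓ₃} (R : Reals c ℓ₁ ℓ₂ ℓ₃) where
  private module ℝ = Reals R
  open Complex R
  open RealOrder R using (_≤_; _⁴; <⇒≤)
  open ComplexNormedRing R using (_∧_)
  open QIdentity R

  identity-from-radius : ∀ {q a b} (∣q∣<1 : ∣ q ∣< ℝ.1#) (a≠0 : NonZero a) (b≠0 : NonZero b) (∣a∣<1 : ∣ a ∣< ℝ.1#) (∣b∣<1 : ∣ b ∣< ℝ.1#) →
    ∃[ r ] (ℝ.0# ℝ.< r × r ℝ.< ℝ.1# × ∣ q ∣² ≤ r ⁴ ℝ.* r ⁴ × ∣ a ∣² ≤ r ⁴ ℝ.* r ⁴ × ∣ b ∣² ≤ r ⁴ ℝ.* r ⁴) →
    Identity {q} {a} {b} ∣q∣<1 a≠0 b≠0 ∣a∣<1 ∣b∣<1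
  identity-from-radius {q} {a} {b} ∣q∣<1 a≠0 b≠0 ∣a∣<1 ∣b∣<1 (r , 0<r , r<1 , q≤ , a≤ , b≤) =
    Assembly.identity R 0<r r<1 {q} {a} {b} (0≤r⁴ ∧ q≤) (0≤r⁴ ∧ a≤) (0≤r⁴ ∧ b≤) ∣q∣<1 a≠0 b≠0 ∣a∣<1 ∣b∣<1
    where
    0≤r⁴ : ℝ.0# ≤ r ⁴
    0≤r⁴ = <⇒≤ (ℝ.*-pos (ℝ.*-pos 0<r 0<r) (ℝ.*-pos 0<r 0<r))

theorem2p13 : ∀ {c ℓ₁ ℓ₂ ℓ₃} (R : Reals c ℓ₁ ℓ₂ ℓ₃) →
    let open Reals R using (1#)
        open Complex R
    in (q a b : ℂ) →
       NonZero q → (∣q∣<1 : ∣ q ∣< 1#) →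
       (a≠0 : NonZero a) (b≠0 : NonZero b) →
       (∣a∣<1 : ∣ a ∣< 1#) (∣b∣<1 : ∣ b ∣< 1#) →
       ∃[ qq ] ∃[ abq ] ∃[ aq ] ∃[ bq ]
         (⟨ q ﹔ q ⟩∞≔ qq) × (⟨ a * b ﹔ q ⟩∞≔ abq) ×
         (⟨ a ﹔ q ⟩∞≔ aq) × (⟨ b ﹔ q ⟩∞≔ bq) ×
         Σ[ den≠0 ∈ NonZero (aq ^ 2 * bq ^ 2) ]
           SumsTo
             (λ n →
               (n · (⟨ q / a ⟨ a≠0 ⟩ ﹔ q ⟩ n * a ^ n))
                 / (⟨ b ﹔ q ⟩ (suc n)) ⟨ ⟨﹔⟩-nonZero {b} {q} ∣b∣<1 ∣q∣<1 (suc n) ⟩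
               + (suc n · (⟨ q / b ⟨ b≠0 ⟩ ﹔ q ⟩ n * b ^ n))
                 / (⟨ a ﹔ q ⟩ (suc n)) ⟨ ⟨﹔⟩-nonZero {a} {q} ∣a∣<1 ∣q∣<1 (suc n) ⟩)
             ((qq ^ 3 * abq) / (aq ^ 2 * bq ^ 2) ⟨ den≠0 ⟩)
theorem2p13 R q a b _ ∣q∣<1 a≠0 b≠0 ∣a∣<1 ∣b∣<1 =
  identity-from-radius R {q} {a} {b} ∣q∣<1 a≠0 b≠0 ∣a∣<1 ∣b∣<1
    (CommonRadius.radius R (∣∣²≮0 q) (<1 q ∣q∣<1) (∣∣²≮0 a) (<1 a ∣a∣<1) (∣∣²≮0 b) (<1 b ∣b∣<1))
  where
  open Reals R
  open Complex R using (∣_∣²; ∣_∣<_; ∣∣²≮0)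
  <1 : ∀ z → ∣ z ∣< 1# → ∣ z ∣² < 1#
  <1 _ (_ , p) = <-respʳ-≈ (*-identityˡ 1#) p
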